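{- Let $\beta(x)$ be a formal power series. Let $a, b$ be real-valued functions on the set of unlabeled rooted trees together with an extra empty object $\emptyset$, with $a(\emptyset) = 1$, and let $c = a * b$ be their subtree convolution. Then the corresponding weighted tree sums satisfy $$f^c(t,g) = f^b\big(t, f^a(t,g)\big)$$ as formal power series in $t$ (with coefficients formal power series in $g$).
   Context: A labeled rooted tree on a non-empty finite set $U$ consists of a root $r\in U$ and a function $T:U\setminus\{r\}\to U$ such that no non-empty $S\subseteq U\setminus\{r\}$ satisfies $T(S)\subseteq S$; $\mathcal{A}[U]$ is the set of these, $|T|=|U|$, and the degree of $j$ is $|T^{ -1}(j)|$. Unlabeled rooted trees are isomorphism classes under relabeling, so a function $c$ on unlabeled rooted trees also gives values $c(T)$ on labeled rooted trees. For $j\in U$, $T_j$ denotes the restriction of $T$ to the set of $k$ with $T^m(k)=j$ for some $m\ge0$, a rooted tree with root $j$. A rooted subtree $T_0\to T$ is either the empty object, or the restriction of $T$ to a non-empty $U_0\subseteq U$ containing $r$ with $T(U_0\setminus\{r\})\subseteq U_0$. The difference forest $T\setminus T_0$ is the collection of trees $T_j$ with $j\in U\setminus U_0$ and $T(j)\in U_0$; if $T_0$ is the empty object it is $\{T\}$. For a forest $F$, $a^\times(F)=\prod_{T'\in F} a(T')$ (equal to $1$ for the empty forest). The subtree convolution $c=a*b$ (defined when $a(\emptyset)=1$) is $c(\emptyset)=b(\emptyset)$ and, for a rooted tree $T$, $c(T)=\sum_{T_0\to T} b(T_0)\,a^\times(T\setminus T_0)$, where the empty-subtree term is $b(\emptyset)a(T)$.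 For a coefficient function $c$, with $U_n$ any set of $n$ elements, $$f^c(t,g) = c(\emptyset)\,g + \sum_{n\ge1}\frac{t^n}{n!}\sum_{T\in\mathcal{A}[U_n]} c(T)\, f_T(g),\qquad f_T(g) = \prod_{\ell\in U_n}\beta^{(|T^{ -1}(\ell)|)}(g).$$ The composite $f^b(t,f^a(t,g))$ is interpreted by substituting $f^a(t,g) = g + O(t)$ for $g$ and expanding in powers of $t$ (Taylor expansion around $g$). -}

module Defs where

open import Level using (Level) renaming (_⊔_ to _⊔ˡ_)
open import Algebra.Bundles using (CommutativeRing)
open import Data.Nat using (ℕ; zero; suc; _∸_)
open import Data.Fin using (Fin)
open import Data.Fin.Properties using (all?; any?) renaming (_≟_ to _≟F_)
open import Data.Fin.Subset using (Subset; inside; outside; _∈_; _∉_; Nonempty; ⊤)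
open import Data.Fin.Subset.Properties using (_∈?_; anySubset?; nonempty?)
open import Data.List using (List; []; _∷_; map; foldr; filter; upTo; allFin; mapMaybe; concatMap; _++_; length)
open import Data.List.Relation.Binary.Pointwise using (Pointwise)
open import Data.List.Relation.Binary.Permutation.Propositional using (_↭_)
open import Data.Maybe using (Maybe; nothing; just)
import Data.Maybe.Properties as MaybeP
open import Data.Product using (Σ; ∃; _×_; _,_)
open import Data.Vec using (Vec; lookup) renaming ([] to []ᵛ; _∷_ to _∷ᵛ_)
open import Relation.Binary.PropositionalEquality using (_≡_)
open import Relation.Nullary using (¬_; Dec; yes; no)
open import Relation.Nullary.Decidable using (_×-dec_; _→-dec_; ¬?)

-- Unlabeled rooted trees.
-- A rose tree `node ts` is a root with an (ordered) list of child subtrees;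
-- unlabeled rooted trees are rose trees up to `_≃ᵀ_`, i.e. up to
-- (recursive) reordering of children.

data Tree : Set where
  node : List Tree → Tree

data _≃ᵀ_ : Tree → Tree → Set where
  node : ∀ {ts vs us} → Pointwise _≃ᵀ_ ts vs → vs ↭ us → node ts ≃ᵀ node us

-- Labeled rooted trees on U_n = Fin n.
-- The parent map T : U ∖ {r} → U is encoded as a vector
-- p : Vec (Maybe (Fin n)) n with  p[i] = just (T i)  for i ≠ r  and p[r] = nothing.

Parent : ℕ → Set
Parent n = Vec (Maybe (Fin n)) n

IsRoot : ∀ {n} → Parent n → Fin n → Set
IsRoot {n} p r = (lookup p r ≡ nothing) × (∀ i → lookup p i ≡ nothing → i ≡ r)

ClosedUnder : ∀ {n} → Parent n → Subset n → Set
ClosedUnder p S = ∀ i → i ∈ S → ∀ j → lookup p i ≡ just j → j ∈ S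

Acyclic : ∀ {n} → Parent n → Fin n → Set
Acyclic p r = ¬ (∃ λ S → Nonempty S × r ∉ S × ClosedUnder p S)

IsLTree : ∀ {n} → Parent n → Fin n → Set
IsLTree p r = IsRoot p r × Acyclic p r

record LTree (n : ℕ) : Set where
  constructor ltree
  field
    parent : Parent n
    root   : Fin n
    isTree : IsLTree parent root
open LTree public

_≟M_ : ∀ {n} → (x y : Maybe (Fin n)) → Dec (x ≡ y)
_≟M_ = MaybeP.≡-dec _≟F_

closed? : ∀ {n} (p : Parent n) (S : Subset n) → Dec (ClosedUnder p S)
closed? p S = all? (λ i → (i ∈? S) →-dec all? (λ j → (lookup p i ≟M just j) →-dec (j ∈? S)))

isLTree? : ∀ {n} (p : Parent n) (r : Fin n) → Dec (IsLTree p r)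
isLTree? p r =
  ((lookup p r ≟M nothing) ×-dec all? (λ i → (lookup p i ≟M nothing) →-dec (i ≟F r)))
  ×-dec ¬? (anySubset? (λ S → nonempty? S ×-dec (¬? (r ∈? S) ×-dec closed? p S)))

allVecs : ∀ {A : Set} (n : ℕ) → List A → List (Vec A n)
allVecs zero    xs = []ᵛ ∷ []
allVecs (suc n) xs = concatMap (λ x → map (x ∷ᵛ_) (allVecs n xs)) xs

allSubsets : (n : ℕ) → List (Subset n)
allSubsets n = allVecs n (inside ∷ outside ∷ [])

allMaybeFin : (n : ℕ) → List (Maybe (Fin n))
allMaybeFin n = nothing ∷ map just (allFin n)

mkTree? : ∀ {n} → Parent n → Fin n → Maybe (LTree n)
mkTree? p r with isLTree? p r
... | yes t = just (ltree p r t)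
... | no _  = nothing

-- the set 𝒜[U_n] (each labeled rooted tree listed exactly once)
labeledTrees : (n : ℕ) → List (LTree n)
labeledTrees n =
  concatMap (λ p → mapMaybe (mkTree? p) (allFin n)) (allVecs n (allMaybeFin n))

degree : ∀ {n} → LTree n → Fin n → ℕ
degree {n} T j = length (filter (λ i → lookup (parent T) i ≟M just j) (allFin n))

-- unlabeled shape of the restriction of T to U₀, seen from node j
-- (children of j inside U₀; fuel n suffices since depths are < n)
shapeIn : ∀ {n} → Parent n → Subset n → ℕ → Fin n → Tree
shapeIn p U zero    j = node []
shapeIn {n} p U (suc f) j =
  node (map (shapeIn p U f) (filter (λ k → (k ∈? U) ×-dec (lookup p k ≟M just j)) (allFin n)))

restrictShape : ∀ {n} → LTree n → Subset n → Fin n → Tree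
restrictShape {n} T U j = shapeIn (parent T) U n j

shapeOf : ∀ {n} → LTree n → Tree
shapeOf T = restrictShape T ⊤ (root T)

subtreeShape : ∀ {n} → LTree n → Fin n → Tree
subtreeShape T j = restrictShape T ⊤ j

-- non-empty rooted subtrees T₀ → T, given by their vertex set U₀
IsRootedSubtree : ∀ {n} → LTree n → Subset n → Set
IsRootedSubtree T U₀ = (root T ∈ U₀) × ClosedUnder (parent T) U₀

isRootedSubtree? : ∀ {n} (T : LTree n) (U₀ : Subset n) → Dec (IsRootedSubtree T U₀)
isRootedSubtree? T U₀ = (root T ∈? U₀) ×-dec closed? (parent T) U₀

-- roots j of the difference forest T ∖ T₀ : j ∉ U₀ and T(j) ∈ U₀
InDiff : ∀ {n} → LTree n → Subset n → Fin n → Set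
InDiff T U₀ j = (j ∉ U₀) × (∃ λ k → (k ∈ U₀) × (lookup (parent T) j ≡ just k))

inDiff? : ∀ {n} (T : LTree n) (U₀ : Subset n) (j : Fin n) → Dec (InDiff T U₀ j)
inDiff? T U₀ j = ¬? (j ∈? U₀) ×-dec any? (λ k → (k ∈? U₀) ×-dec (lookup (parent T) j ≟M just k))

diffForest : ∀ {n} → LTree n → Subset n → List Tree
diffForest {n} T U₀ = map (subtreeShape T) (filter (inDiff? T U₀) (allFin n))

-- Everything below is over a commutative ring R together with inverses
-- `recip k` of the positive integers (so R is a ℚ-algebra; e.g. R = ℝ).

module WithRing {c ℓ : Level} (R : CommutativeRing c ℓ) (recip : ℕ → CommutativeRing.Carrier R) where
  open CommutativeRing R

  natR : ℕ → Carrier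
  natR zero    = 0#
  natR (suc n) = 1# + natR n

  invFact : ℕ → Carrier
  invFact zero    = 1#
  invFact (suc n) = recip (suc n) * invFact n

  sumL : List Carrier → Carrier
  sumL = foldr _+_ 0#

  prodL : List Carrier → Carrier
  prodL = foldr _*_ 1#

  sumTo : ℕ → (ℕ → Carrier) → Carrier
  sumTo n f = sumL (map f (upTo (suc n)))

  -- Coefficient functions on unlabeled rooted trees together with ∅ (= nothing)
  Coef : Set c
  Coef = Maybe Tree → Carrier

  Invariant : Coef → Set ℓ
  Invariant a = ∀ {s t} → s ≃ᵀ t → a (just s) ≈ a (just t)

  prodCoef : Coef → List Tree → Carrier
  prodCoef a F = prodL (map (λ t → a (just t)) F)

  conv : Coef → Coef → ∀ {n} → LTree n → Carrier
  conv a b {n} T =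
    b nothing * a (just (shapeOf T))
    + sumL (map (λ U₀ → b (just (restrictShape T U₀ (root T))) * prodCoef a (diffForest T U₀))
                (filter (isRootedSubtree? T) (allSubsets n)))

  PS : Set c
  PS = ℕ → Carrier

  _⊛_ : PS → PS → PS
  (F ⊛ G) n = sumTo n (λ i → F i * G (n ∸ i))

  oneS : PS
  oneS zero    = 1#
  oneS (suc _) = 0#

  gS : PS
  gS (suc zero) = 1#
  gS _          = 0#

  prodS : List PS → PS
  prodS = foldr _⊛_ oneS

  deriv : PS → PS
  deriv F m = natR (suc m) * F (suc m)

  derivIter : ℕ → PS → PS
  derivIter zero    F = F
  derivIter (suc k) F = deriv (derivIter k F)

  -- formal power series in t with coefficients in PS : F n m = [tⁿ gᵐ]
  PS2 : Set c
  PS2 = ℕ → PS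

  _⊛₂_ : PS2 → PS2 → PS2
  (F ⊛₂ G) n m = sumTo n (λ i → (F i ⊛ G (n ∸ i)) m)

  one2 : PS2
  one2 zero    = oneS
  one2 (suc _) = λ _ → 0#

  g2 : PS2
  g2 zero    = gS
  g2 (suc _) = λ _ → 0#

  pow2 : PS2 → ℕ → PS2
  pow2 H zero    = one2
  pow2 H (suc k) = H ⊛₂ pow2 H k

  dgIter : ℕ → PS2 → PS2
  dgIter k F n = derivIter k (F n)

  fT : PS → ∀ {n} → LTree n → PS
  fT β {n} T = prodS (map (λ l → derivIter (degree T l) β) (allFin n))

  -- f^c(t,g) for c given by c(∅) and its values on labeled rooted trees
  fSeries : PS → Carrier → (∀ {n} → LTree n → Carrier) → PS2
  fSeries β cE cL zero    m = cE * gS m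
  fSeries β cE cL (suc k) m =
    invFact (suc k) * sumL (map (λ T → cL T * fT β T m) (labeledTrees (suc k)))

  onTrees : Coef → ∀ {n} → LTree n → Carrier
  onTrees a T = a (just (shapeOf T))

  fCoef : PS → Coef → PS2
  fCoef β a = fSeries β (a nothing) (onTrees a)

  -- F(t, G(t,g)) via Taylor expansion around g, with H = G − g = O(t):
  -- Σ_k (1/k!) H^k ∂_g^k F ; only k ≤ n contributes to tⁿ.
  composeTaylor : PS2 → PS2 → PS2
  composeTaylor F G n m = sumTo n (λ k → invFact k * (pow2 H k ⊛₂ dgIter k F) n m)
    where
    H : PS2
    H i j = G i j - g2 i j

-- A labelled tree with vertices of degree d_v has Π d_v! plane orderings, and a plane tree with n
-- vertices has n! labellings. Hence (1/n!) Σ_T Φ(T) over the labelled trees T equals Σ_t w(t) Φ(t)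
-- over the plane trees t, where w(t) = Π 1/d_v!, and pruning can be studied on plane trees.
-- There the sum over all t and all rooted subtrees of t can be evaluated by looking at the first
-- child of the root: it is absent, cut or kept. This gives a t-adically contracting recursion.
-- Writing f^a(t, g) = g + H, the series φ ↦ φ(g + H) is multiplicative, so that on the composition side
-- a vertex with d kept children contributes (1/d!) β^(d)(g + H) = Σ_j C(d+j, d) H^j β^(d+j)/(d+j)!,
-- and Pascal's rule shows that the composite satisfies the same recursion.

module Submission where

open import Defs
open import Algebra.Bundles using (CommutativeRing)
open import Data.Bool using (Bool; true; false)
open import Data.Empty using (⊥; ⊥-elim)
open import Data.Fin as Fin using (Fin)
open import Data.Fin.Properties as Fin using (all?; any?)
open import Data.Fin.Subset as Subset using (Subset; inside; outside; ⊤)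
open import Data.Fin.Subset.Properties as Subset using (∈⊤)
open import Data.List using (List; []; _∷_; [_]; _++_; map; concatMap; mapMaybe; cartesianProductWith; filter; take; drop; length; allFin; applyUpTo)
open import Data.List.Properties as List using (length-++; length-map; length-take; length-drop; length-filter; length-tabulate; take++drop≡id; map-++; ∷-injective; ∷-injectiveˡ; ∷-injectiveʳ)
open import Data.List.Membership.Propositional using (_∈_; _∉_; find; lose)
open import Data.List.Membership.Propositional.Properties using (∈-++⁺ˡ; ∈-++⁺ʳ; ∈-++⁻; ∈-∃++; ∈-map⁺; ∈-map⁻; ∈-filter⁺; ∈-filter⁻; ∈-allFin; ∈-concatMap⁺; ∈-concatMap⁻; ∈-cartesianProductWith⁺; ∈-cartesianProductWith⁻)
import Data.List.Membership.DecPropositional as DecMembership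
open import Data.List.Relation.Binary.Permutation.Propositional as Perm using (_↭_; ↭-refl; ↭-sym; ↭-trans; prep)
open import Data.List.Relation.Binary.Permutation.Propositional.Properties as Perm using (∈-resp-↭; All-resp-↭; drop-∷; ↭-length; ↭-empty-inv; ↭-map-inv)
open import Data.List.Relation.Binary.Pointwise using (Pointwise; []; _∷_)
open import Data.List.Relation.Unary.All as All using (All; []; _∷_)
open import Data.List.Relation.Unary.AllPairs using ([]; _∷_)
open import Data.List.Relation.Unary.Any using (here; there)
open import Data.List.Relation.Unary.Unique.Propositional using (Unique)
import Data.List.Relation.Unary.Unique.Propositional.Properties as Unique
open import Data.Maybe using (Maybe; just; nothing; fromMaybe)
open import Data.Maybe.Properties using (just-injective)
open import Data.Nat as ℕ using (ℕ; zero; suc; _≤_; z≤n; s≤s; _∸_; _!)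
import Data.Nat.Properties as ℕ
open import Data.Nat.Tactic.RingSolver using (solve-∀)
open import Data.Product using (∃; ∃₂; _×_; _,_; proj₁; proj₂)
open import Data.Sum using (_⊎_; inj₁; inj₂)
open import Data.Vec as Vec using (Vec; []; _∷_; lookup; tabulate)
open import Data.Vec.Properties as Vec using (lookup∘tabulate; tabulate∘lookup; tabulate-cong; []=⇒lookup; lookup⇒[]=)
open import Function using (id)
open import Relation.Binary.PropositionalEquality as ≡ using (_≡_; _≢_; cong; cong₂; subst)
import Relation.Binary.Reasoning.Setoid as SetoidReasoning
open import Relation.Nullary using (¬_; Dec; yes; no; does)
open import Relation.Nullary.Decidable using (¬?; _×-dec_)
open import Relation.Unary using (Decidable)

-- Finite sums and formal power series

-- Since b is an arbitrary function of the kept tree, a sum over rooted subtrees does not factor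
-- over the children of the root. The recursion therefore runs on forests, for all test functions
-- `B` of the kept forest at once: keeping a first tree with kept children `ls` replaces `B` by
-- `λ ks → B (node ls ∷ ks)`, and summing over the remaining forest turns this into a new test
-- function of `ls`, now with values in power series in t. Likewise, when the first child of the
-- root is removed, the root must still be weighted by its original degree. So the root has its own
-- weight sequence `q`, which becomes `tl q` with each removed child, while all other vertices use
-- `q̂`. The contraction comes from the factor t carried by the root of the first tree, whether cut
-- or kept. A plane ordering need not list children in the order of `Fin n`, so its shape agrees
-- with `shapeOf` only up to `_≃ᵀ_`; this is where the invariance of a and b enters.

module Sums {c ℓ} (R : CommutativeRing c ℓ) where
  open CommutativeRing R hiding (zero)
  open SetoidReasoning setoid

  open import Algebra.Solver.Ring.NaturalCoefficients.Default commutativeSemiring using (solve; _:=_; _:+_; _:*_)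

  +-interchange : ∀ w x y z → (w + x) + (y + z) ≈ (w + y) + (x + z)
  +-interchange = solve 4 (λ w x y z → (w :+ x) :+ (y :+ z) := (w :+ y) :+ (x :+ z)) refl

  +-swapˡ : ∀ x y z → x + (y + z) ≈ y + (x + z)
  +-swapˡ = solve 3 (λ x y z → x :+ (y :+ z) := y :+ (x :+ z)) refl

  *-swapˡ : ∀ x y z → x * (y * z) ≈ y * (x * z)
  *-swapˡ = solve 3 (λ x y z → x :* (y :* z) := y :* (x :* z)) refl

  sum : {A : Set} → List A → (A → Carrier) → Carrier
  sum []       f = 0#
  sum (x ∷ xs) f = f x + sum xs f

  module _ {A : Set} where

    sum-cong-∈ : ∀ xs {f g : A → Carrier} → (∀ {x} → x ∈ xs → f x ≈ g x) → sum xs f ≈ sum xs g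
    sum-cong-∈ []       h = refl
    sum-cong-∈ (x ∷ xs) h = +-cong (h (here ≡.refl)) (sum-cong-∈ xs (λ x∈ → h (there x∈)))

    sum-cong : ∀ xs {f g : A → Carrier} → (∀ x → f x ≈ g x) → sum xs f ≈ sum xs g
    sum-cong xs h = sum-cong-∈ xs (λ {x} _ → h x)

    sum-zero : ∀ xs → sum xs (λ (_ : A) → 0#) ≈ 0#
    sum-zero []       = refl
    sum-zero (x ∷ xs) = trans (+-identityˡ _) (sum-zero xs)

    sum-+ : ∀ xs (f g : A → Carrier) → sum xs (λ x → f x + g x) ≈ sum xs f + sum xs g
    sum-+ []       f g = sym (+-identityˡ _)
    sum-+ (x ∷ xs) f g = begin
      (f x + g x) + sum xs (λ x → f x + g x)   ≈⟨ +-congˡ (sum-+ xs f g) ⟩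
      (f x + g x) + (sum xs f + sum xs g)      ≈⟨ +-interchange _ _ _ _ ⟩
      (f x + sum xs f) + (g x + sum xs g)      ∎

    *-distribˡ-sum : ∀ xs a (f : A → Carrier) → a * sum xs f ≈ sum xs (λ x → a * f x)
    *-distribˡ-sum []       a f = zeroʳ a
    *-distribˡ-sum (x ∷ xs) a f = begin
      a * (f x + sum xs f)             ≈⟨ distribˡ a _ _ ⟩
      a * f x + a * sum xs f           ≈⟨ +-congˡ (*-distribˡ-sum xs a f) ⟩
      a * f x + sum xs (λ x → a * f x) ∎

    *-distribʳ-sum : ∀ xs a (f : A → Carrier) → sum xs f * a ≈ sum xs (λ x → f x * a)
    *-distribʳ-sum xs a f = begin
      sum xs f * a             ≈⟨ *-comm _ a ⟩
      a * sum xs f             ≈⟨ *-distribˡ-sum xs a f ⟩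
      sum xs (λ x → a * f x)   ≈⟨ sum-cong xs (λ x → *-comm a (f x)) ⟩
      sum xs (λ x → f x * a)   ∎

    sum-++ : ∀ xs ys (f : A → Carrier) → sum (xs ++ ys) f ≈ sum xs f + sum ys f
    sum-++ []       ys f = sym (+-identityˡ _)
    sum-++ (x ∷ xs) ys f = begin
      f x + sum (xs ++ ys) f        ≈⟨ +-congˡ (sum-++ xs ys f) ⟩
      f x + (sum xs f + sum ys f)   ≈⟨ +-assoc _ _ _ ⟨
      (f x + sum xs f) + sum ys f   ∎

    sum-↭ : ∀ {xs ys} (f : A → Carrier) → xs ↭ ys → sum xs f ≈ sum ys f
    sum-↭ f Perm.refl          = refl
    sum-↭ f (Perm.prep x p)    = +-congˡ (sum-↭ f p)
    sum-↭ f (Perm.swap x y p)  = trans (+-swapˡ _ _ _) (+-congˡ (+-congˡ (sum-↭ f p)))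
    sum-↭ f (Perm.trans p q)   = trans (sum-↭ f p) (sum-↭ f q)

  sum-map : ∀ {A B : Set} (g : A → B) xs (f : B → Carrier) → sum (map g xs) f ≡ sum xs (λ x → f (g x))
  sum-map g []       f = ≡.refl
  sum-map g (x ∷ xs) f = ≡.cong (f (g x) +_) (sum-map g xs f)

  sum-concatMap : ∀ {A B : Set} (g : A → List B) xs (f : B → Carrier) →
                  sum (concatMap g xs) f ≈ sum xs (λ x → sum (g x) f)
  sum-concatMap g []       f = refl
  sum-concatMap g (x ∷ xs) f = begin
    sum (g x ++ concatMap g xs) f               ≈⟨ sum-++ (g x) _ f ⟩
    sum (g x) f + sum (concatMap g xs) f        ≈⟨ +-congˡ (sum-concatMap g xs f) ⟩
    sum (g x) f + sum xs (λ x → sum (g x) f)    ∎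

  sum-cartesianProductWith : ∀ {A B C : Set} (g : A → B → C) xs ys (f : C → Carrier) →
    sum (cartesianProductWith g xs ys) f ≈ sum xs (λ x → sum ys (λ y → f (g x y)))
  sum-cartesianProductWith g []       ys f = refl
  sum-cartesianProductWith g (x ∷ xs) ys f = begin
    sum (map (g x) ys ++ cartesianProductWith g xs ys) f
      ≈⟨ sum-++ (map (g x) ys) _ f ⟩
    sum (map (g x) ys) f + sum (cartesianProductWith g xs ys) f
      ≈⟨ +-cong (reflexive (sum-map (g x) ys f)) (sum-cartesianProductWith g xs ys f) ⟩
    sum ys (λ y → f (g x y)) + sum xs (λ x → sum ys (λ y → f (g x y))) ∎

  -- tri n f = Σ_{i+j=n} f i j
  tri : ℕ → (ℕ → ℕ → Carrier) → Carrier
  tri zero    f = f 0 0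
  tri (suc n) f = f 0 (suc n) + tri n (λ i → f (suc i))

  tri-cong-≡ : ∀ n {f g} → (∀ i j → i ℕ.+ j ≡ n → f i j ≈ g i j) → tri n f ≈ tri n g
  tri-cong-≡ zero    h = h 0 0 ≡.refl
  tri-cong-≡ (suc n) h = +-cong (h 0 (suc n) ≡.refl) (tri-cong-≡ n (λ i j eq → h (suc i) j (≡.cong suc eq)))

  tri-cong : ∀ n {f g} → (∀ i j → f i j ≈ g i j) → tri n f ≈ tri n g
  tri-cong n h = tri-cong-≡ n (λ i j _ → h i j)

  tri-zero : ∀ n → tri n (λ _ _ → 0#) ≈ 0#
  tri-zero zero    = refl
  tri-zero (suc n) = trans (+-identityˡ _) (tri-zero n)

  tri-+ : ∀ n f g → tri n (λ i j → f i j + g i j) ≈ tri n f + tri n g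
  tri-+ zero    f g = refl
  tri-+ (suc n) f g = trans (+-congˡ (tri-+ n _ _)) (+-interchange _ _ _ _)

  *-distribˡ-tri : ∀ n a f → a * tri n f ≈ tri n (λ i j → a * f i j)
  *-distribˡ-tri zero    a f = refl
  *-distribˡ-tri (suc n) a f = trans (distribˡ a _ _) (+-congˡ (*-distribˡ-tri n a _))

  *-distribʳ-tri : ∀ n a f → tri n f * a ≈ tri n (λ i j → f i j * a)
  *-distribʳ-tri zero    a f = refl
  *-distribʳ-tri (suc n) a f = trans (distribʳ a _ _) (+-congˡ (*-distribʳ-tri n a _))

  tri-last : ∀ n f → tri (suc n) f ≈ f (suc n) 0 + tri n (λ i j → f i (suc j))
  tri-last zero    f = +-comm _ _
  tri-last (suc n) f = trans (+-congˡ (tri-last n (λ i → f (suc i)))) (+-swapˡ _ _ _)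

  tri-comm : ∀ n f → tri n f ≈ tri n (λ i j → f j i)
  tri-comm zero    f = refl
  tri-comm (suc n) f = begin
    f 0 (suc n) + tri n (λ i → f (suc i))           ≈⟨ +-congˡ (tri-comm n _) ⟩
    f 0 (suc n) + tri n (λ i j → f (suc j) i)       ≈⟨ tri-last n (λ i j → f j i) ⟨
    tri (suc n) (λ i j → f j i)                     ∎

  -- Both sides run over all i + j + l = n. Associativity of the product, the recursion for
  -- substitution and the generating series all reduce to this reindexing.
  tri-assoc : ∀ n (f : ℕ → ℕ → ℕ → Carrier) →
              tri n (λ k l → tri k (λ i j → f i j l)) ≈ tri n (λ i m → tri m (λ j l → f i j l))
  tri-assoc zero    f = refl
  tri-assoc (suc n) f = begin
    f 0 0 (suc n) + tri n (λ k l → f 0 (suc k) l + tri k (λ i j → f (suc i) j l))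
      ≈⟨ +-congˡ (tri-+ n _ _) ⟩
    f 0 0 (suc n) + (tri n (λ k l → f 0 (suc k) l) + tri n (λ k l → tri k (λ i j → f (suc i) j l)))
      ≈⟨ +-congˡ (+-congˡ (tri-assoc n _)) ⟩
    f 0 0 (suc n) + (tri n (λ k l → f 0 (suc k) l) + tri n (λ i m → tri m (λ j l → f (suc i) j l)))
      ≈⟨ +-assoc _ _ _ ⟨
    tri (suc n) (f 0) + tri n (λ i m → tri m (λ j l → f (suc i) j l)) ∎

  tri-sum : ∀ {A : Set} n (xs : List A) (f : ℕ → ℕ → A → Carrier) →
            tri n (λ i j → sum xs (f i j)) ≈ sum xs (λ x → tri n (λ i j → f i j x))
  tri-sum zero    xs f = refl
  tri-sum (suc n) xs f = trans (+-congˡ (tri-sum n xs _)) (sym (sum-+ xs _ _))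

module PowerSeries {c ℓ} (R : CommutativeRing c ℓ) where
  open CommutativeRing R hiding (zero)
  open Sums R
  open SetoidReasoning setoid

  Series : Set c
  Series = ℕ → Carrier

  infix  4 _≋_
  infixl 6 _⊕_
  infixl 7 _⊗_

  _≋_ : Series → Series → Set ℓ
  F ≋ G = ∀ n → F n ≈ G n

  _⊕_ _⊗_ : Series → Series → Series
  (F ⊕ G) n = F n + G n
  (F ⊗ G) n = tri n (λ i j → F i * G j)

  const : Carrier → Series
  const a zero    = a
  const a (suc _) = 0#

  tl : Series → Series
  tl F n = F (suc n)

  shift : Series → Series
  shift F zero    = 0#
  shift F (suc n) = F n

  const-⊗ : ∀ a F → const a ⊗ F ≋ λ n → a * F n
  const-⊗ a F zero    = refl
  const-⊗ a F (suc n) = begin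
    a * F (suc n) + tri n (λ i j → 0# * F j)  ≈⟨ +-congˡ (tri-cong n (λ i j → zeroˡ _)) ⟩
    a * F (suc n) + tri n (λ i j → 0#)        ≈⟨ +-congˡ (tri-zero n) ⟩
    a * F (suc n) + 0#                        ≈⟨ +-identityʳ _ ⟩
    a * F (suc n)                             ∎

  shift-⊗ : ∀ F G → shift F ⊗ G ≋ shift (F ⊗ G)
  shift-⊗ F G zero    = zeroˡ _
  shift-⊗ F G (suc n) = trans (+-congʳ (zeroˡ _)) (+-identityˡ _)

  ⊗-comm : ∀ F G → F ⊗ G ≋ G ⊗ F
  ⊗-comm F G n = trans (tri-comm n _) (tri-cong n (λ i j → *-comm _ _))

  ⊗-cong : ∀ {F F′ G G′} → F ≋ F′ → G ≋ G′ → F ⊗ G ≋ F′ ⊗ G′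
  ⊗-cong p q n = tri-cong n (λ i j → *-cong (p i) (q j))

  ⊗-assoc : ∀ F G H → (F ⊗ G) ⊗ H ≋ F ⊗ (G ⊗ H)
  ⊗-assoc F G H n = begin
    tri n (λ k l → tri k (λ i j → F i * G j) * H l)    ≈⟨ tri-cong n (λ k l → *-distribʳ-tri k (H l) _) ⟩
    tri n (λ k l → tri k (λ i j → (F i * G j) * H l))  ≈⟨ tri-assoc n (λ i j l → (F i * G j) * H l) ⟩
    tri n (λ i m → tri m (λ j l → (F i * G j) * H l))  ≈⟨ tri-cong n (λ i m → tri-cong m (λ j l → *-assoc _ _ _)) ⟩
    tri n (λ i m → tri m (λ j l → F i * (G j * H l)))  ≈⟨ tri-cong n (λ i m → *-distribˡ-tri m (F i) _) ⟨
    tri n (λ i m → F i * tri m (λ j l → G j * H l))    ∎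

  ⊗-distribˡ : ∀ F G H → F ⊗ (G ⊕ H) ≋ F ⊗ G ⊕ F ⊗ H
  ⊗-distribˡ F G H n = trans (tri-cong n (λ i j → distribˡ _ _ _)) (tri-+ n _ _)

  ⊗-distribʳ : ∀ F G H → (G ⊕ H) ⊗ F ≋ G ⊗ F ⊕ H ⊗ F
  ⊗-distribʳ F G H n = trans (tri-cong n (λ i j → distribʳ _ _ _)) (tri-+ n _ _)

  ⊗-identityˡ : ∀ F → const 1# ⊗ F ≋ F
  ⊗-identityˡ F n = trans (const-⊗ 1# F n) (*-identityˡ _)

  infix 4 _≋[_]_

  -- Congruence modulo the power n + 1 of the variable.
  _≋[_]_ : Series → ℕ → Series → Set ℓ
  F ≋[ n ] G = ∀ m → m ≤ n → F m ≈ G m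

  ⊗-congˡ-≤ : ∀ F {G G′ n} → G ≋[ n ] G′ → (F ⊗ G) ≋[ n ] (F ⊗ G′)
  ⊗-congˡ-≤ F h m m≤n = tri-cong-≡ m λ i j i+j≡m →
    *-congˡ (h j (ℕ.≤-trans (ℕ.≤-trans (ℕ.m≤n+m j i) (ℕ.≤-reflexive i+j≡m)) m≤n))

  -- The gain of one order drives the contraction argument: what stands under `shift` needs to be
  -- known only to lower order.
  shift-cong-≤ : ∀ {F F′ n} → F ≋[ n ] F′ → shift F ≋[ suc n ] shift F′
  shift-cong-≤ h zero    _         = refl
  shift-cong-≤ h (suc m) (s≤s m≤n) = h m m≤n

  shift-cong : ∀ {F F′} → F ≋ F′ → shift F ≋ shift F′
  shift-cong h zero    = refl
  shift-cong h (suc n) = h n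

  shift-⊕ : ∀ F G → shift (F ⊕ G) ≋ shift F ⊕ shift G
  shift-⊕ F G zero    = sym (+-identityʳ _)
  shift-⊕ F G (suc n) = refl

  -- Having a ring again lets the construction be iterated, giving series in t whose coefficients
  -- are series in g, and lets the ring solver act on series.
  seriesRing : CommutativeRing c ℓ
  seriesRing = record
    { Carrier = Series
    ; _≈_ = _≋_
    ; _+_ = _⊕_
    ; _*_ = _⊗_
    ; -_ = λ F n → - F n
    ; 0# = λ _ → 0#
    ; 1# = const 1#
    ; isCommutativeRing = record
      { isRing = record
        { +-isAbelianGroup = record
          { isGroup = record
            { isMonoid = record
              { isSemigroup = record
                { isMagma = record
                  { isEquivalence = record
                    { refl = λ n → refl
                    ; sym = λ p n → sym (p n)
                    ; trans = λ p q n → trans (p n) (q n)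
                    }
                  ; ∙-cong = λ p q n → +-cong (p n) (q n)
                  }
                ; assoc = λ F G H n → +-assoc _ _ _
                }
              ; identity = (λ F n → +-identityˡ _) , (λ F n → +-identityʳ _)
              }
            ; inverse = (λ F n → -‿inverseˡ _) , (λ F n → -‿inverseʳ _)
            ; ⁻¹-cong = λ p n → -‿cong (p n)
            }
          ; comm = λ F G n → +-comm _ _
          }
        ; *-cong = ⊗-cong
        ; *-assoc = ⊗-assoc
        ; *-identity = ⊗-identityˡ , λ F n → trans (⊗-comm F (const 1#) n) (⊗-identityˡ F n)
        ; distrib = ⊗-distribˡ , ⊗-distribʳ
        }
      ; *-comm = ⊗-comm
      }
    }

-- Substitution and Taylor expansion

-- `binomial d j` is the binomial coefficient C(d + j, d). Indexing by the two parts makes Pascal's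
-- rule a structural recursion without subtraction.
binomial : ℕ → ℕ → ℕ
binomial zero    j       = 1
binomial (suc d) zero    = binomial d zero
binomial (suc d) (suc j) = binomial d (suc j) ℕ.+ binomial (suc d) j

-- Pascal's rule multiplied by (d + 1)! (j + 1)!: the two summands contribute d + 1 and j + 1 copies
-- of (d + j + 1)!, together (d + j + 2)!.
binomial-! : ∀ d j → binomial d j ℕ.* (d ! ℕ.* j !) ≡ (d ℕ.+ j) !
binomial-! zero    j       = ≡.trans (ℕ.*-identityˡ _) (ℕ.*-identityˡ _)
binomial-! (suc d) zero    = begin
  binomial d 0 ℕ.* (suc d ℕ.* d ! ℕ.* 1)     ≡⟨ rearrange (binomial d 0) d (d !) ⟩
  suc d ℕ.* (binomial d 0 ℕ.* (d ! ℕ.* 1))   ≡⟨ ≡.cong (suc d ℕ.*_) (binomial-! d 0) ⟩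
  suc d ℕ.* (d ℕ.+ 0) !                      ≡⟨ ≡.cong (λ k → suc k ℕ.* (d ℕ.+ 0) !) (ℕ.+-identityʳ d) ⟨
  (suc d ℕ.+ 0) !                            ∎
  where
  open ≡.≡-Reasoning
  rearrange : ∀ b d f → b ℕ.* (suc d ℕ.* f ℕ.* 1) ≡ suc d ℕ.* (b ℕ.* (f ℕ.* 1))
  rearrange = solve-∀
binomial-! (suc d) (suc j) = begin
  (binomial d (suc j) ℕ.+ binomial (suc d) j) ℕ.* (suc d ! ℕ.* suc j !)
    ≡⟨ rearrange (binomial d (suc j)) (binomial (suc d) j) d j (d !) (j !) ⟩
  suc d ℕ.* (binomial d (suc j) ℕ.* (d ! ℕ.* suc j !)) ℕ.+ suc j ℕ.* (binomial (suc d) j ℕ.* (suc d ! ℕ.* j !))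
    ≡⟨ ≡.cong₂ (λ x y → suc d ℕ.* x ℕ.+ suc j ℕ.* y) (binomial-! d (suc j)) (binomial-! (suc d) j) ⟩
  suc d ℕ.* (d ℕ.+ suc j) ! ℕ.+ suc j ℕ.* (suc d ℕ.+ j) !
    ≡⟨ ≡.cong (λ k → suc d ℕ.* (d ℕ.+ suc j) ! ℕ.+ suc j ℕ.* k !) (ℕ.+-suc d j) ⟨
  suc d ℕ.* (d ℕ.+ suc j) ! ℕ.+ suc j ℕ.* (d ℕ.+ suc j) !
    ≡⟨ ℕ.*-distribʳ-+ ((d ℕ.+ suc j) !) (suc d) (suc j) ⟨
  (suc d ℕ.+ suc j) !
    ∎
  where
  open ≡.≡-Reasoning
  rearrange : ∀ b c d j f g → (b ℕ.+ c) ℕ.* (suc d ℕ.* f ℕ.* (suc j ℕ.* g)) ≡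
              suc d ℕ.* (b ℕ.* (f ℕ.* (suc j ℕ.* g))) ℕ.+ suc j ℕ.* (c ℕ.* (suc d ℕ.* f ℕ.* g))
  rearrange = solve-∀

module Substitution {c ℓ} (S : CommutativeRing c ℓ) (h : ℕ → CommutativeRing.Carrier S) where
  open CommutativeRing S hiding (zero)
  open Sums S
  open PowerSeries S
  open SetoidReasoning setoid
  private
    module P = CommutativeRing seriesRing
  open import Algebra.Properties.Monoid.Mult +-monoid using (×-homo-1; ×-homo-+; ×-congʳ) renaming (_×_ to _·_)
  open import Algebra.Solver.Ring.NaturalCoefficients.Default P.commutativeSemiring using (solve; _:=_; _:+_; _:*_)

  -- Powers of h alone; the k factors t are accounted for by the index k in `sub`.
  pow : ℕ → Series
  pow zero    = const 1#
  pow (suc k) = h ⊗ pow k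

  -- sub X is the composite Σ_k X_k (t h(t))^k.
  sub : Series → Series
  sub X n = tri n (λ k j → pow k j * X k)

  sub-zero : ∀ X → sub X 0 ≈ X 0
  sub-zero X = *-identityˡ _

  -- Horner's rule: every term except the one of X 0 contains a factor t h, and what remains is the
  -- composite of the tail.
  sub-suc : ∀ X n → sub X (suc n) ≈ (h ⊗ sub (tl X)) n
  sub-suc X n = begin
    0# * X 0 + tri n (λ k l → (h ⊗ pow k) l * X (suc k))
      ≈⟨ trans (+-congʳ (zeroˡ _)) (+-identityˡ _) ⟩
    tri n (λ k l → (h ⊗ pow k) l * X (suc k))
      ≈⟨ tri-comm n _ ⟩
    tri n (λ l k → (h ⊗ pow k) l * X (suc k))
      ≈⟨ tri-cong n (λ l k → *-distribʳ-tri l _ _) ⟩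
    tri n (λ l k → tri l (λ i j → (h i * pow k j) * X (suc k)))
      ≈⟨ tri-assoc n (λ i j k → (h i * pow k j) * X (suc k)) ⟩
    tri n (λ i m → tri m (λ j k → (h i * pow k j) * X (suc k)))
      ≈⟨ tri-cong n (λ i m → tri-cong m (λ j k → *-assoc _ _ _)) ⟩
    tri n (λ i m → tri m (λ j k → h i * (pow k j * X (suc k))))
      ≈⟨ tri-cong n (λ i m → *-distribˡ-tri m (h i) _) ⟨
    tri n (λ i m → h i * tri m (λ j k → pow k j * X (suc k)))
      ≈⟨ tri-cong n (λ i m → *-congˡ (tri-comm m _)) ⟩
    tri n (λ i m → h i * tri m (λ k j → pow k j * X (suc k)))
      ∎

  sub-unfold : ∀ X → sub X ≋ const (X 0) ⊕ shift (h ⊗ sub (tl X))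
  sub-unfold X zero    = trans (sub-zero X) (sym (+-identityʳ _))
  sub-unfold X (suc n) = trans (sub-suc X n) (sym (+-identityˡ _))

  sub-cong : ∀ {X Y} → X ≋ Y → sub X ≋ sub Y
  sub-cong p n = tri-cong n (λ k j → *-congˡ (p k))

  sub-⊕ : ∀ X Y → sub (X ⊕ Y) ≋ sub X ⊕ sub Y
  sub-⊕ X Y n = trans (tri-cong n (λ k j → distribˡ _ _ _)) (tri-+ n _ _)

  sub-scale : ∀ a X → sub (λ k → a * X k) ≋ λ n → a * sub X n
  sub-scale a X n = trans (tri-cong n (λ k j → *-swapˡ _ _ _)) (sym (*-distribˡ-tri n a _))

  -- The tail of X ⊗ Y is X 0 times the tail of Y plus the tail of X times Y. By Horner's rule the
  -- product of this tail is needed only to lower order, so induction on the order works as long as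
  -- X and Y vary.
  sub-⊗ : ∀ X Y → sub (X ⊗ Y) ≋ sub X ⊗ sub Y
  sub-⊗ X Y n = up-to n X Y n ℕ.≤-refl
    where
    zeroth : ∀ X Y → sub (X ⊗ Y) 0 ≈ (sub X ⊗ sub Y) 0
    zeroth X Y = trans (sub-zero (X ⊗ Y)) (sym (*-cong (sub-zero X) (sub-zero Y)))

    up-to : ∀ n X Y → sub (X ⊗ Y) ≋[ n ] (sub X ⊗ sub Y)
    up-to n       X Y zero    _         = zeroth X Y
    up-to (suc n) X Y (suc m) (s≤s m≤n) = begin
      sub (X ⊗ Y) (suc m)
        ≈⟨ sub-suc (X ⊗ Y) m ⟩
      (h ⊗ sub ((λ k → X 0 * Y (suc k)) ⊕ (tl X ⊗ Y))) m
        ≈⟨ ⊗-congˡ-≤ h step m m≤n ⟩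
      (h ⊗ (const (X 0) ⊗ sub (tl Y) ⊕ sub (tl X) ⊗ sub Y)) m
        ≈⟨ solve 5 (λ h x y x′ y″ → h :* (x :* y :+ x′ :* y″) := x :* (h :* y) :+ (h :* x′) :* y″)
             (λ _ → refl) h (const (X 0)) (sub (tl Y)) (sub (tl X)) (sub Y) m ⟩
      (const (X 0) ⊗ (h ⊗ sub (tl Y))) m + ((h ⊗ sub (tl X)) ⊗ sub Y) m
        ≈⟨ +-cong (trans (const-⊗ (X 0) _ m) (*-congˡ (sym (sub-suc Y m))))
                  (sym (shift-⊗ (h ⊗ sub (tl X)) (sub Y) (suc m))) ⟩
      X 0 * sub Y (suc m) + (shift (h ⊗ sub (tl X)) ⊗ sub Y) (suc m)
        ≈⟨ +-congʳ (const-⊗ (X 0) (sub Y) (suc m)) ⟨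
      (const (X 0) ⊗ sub Y) (suc m) + (shift (h ⊗ sub (tl X)) ⊗ sub Y) (suc m)
        ≈⟨ P.distribʳ (sub Y) (const (X 0)) (shift (h ⊗ sub (tl X))) (suc m) ⟨
      ((const (X 0) ⊕ shift (h ⊗ sub (tl X))) ⊗ sub Y) (suc m)
        ≈⟨ ⊗-cong (sub-unfold X) (λ _ → refl) (suc m) ⟨
      (sub X ⊗ sub Y) (suc m)
        ∎
      where
      step : sub ((λ k → X 0 * Y (suc k)) ⊕ (tl X ⊗ Y)) ≋[ n ] (const (X 0) ⊗ sub (tl Y) ⊕ sub (tl X) ⊗ sub Y)
      step j j≤n = begin
        sub ((λ k → X 0 * Y (suc k)) ⊕ (tl X ⊗ Y)) j
          ≈⟨ sub-⊕ _ _ j ⟩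
        sub (λ k → X 0 * Y (suc k)) j + sub (tl X ⊗ Y) j
          ≈⟨ +-cong (sub-scale (X 0) (tl Y) j) (up-to n (tl X) Y j j≤n) ⟩
        X 0 * sub (tl Y) j + (sub (tl X) ⊗ sub Y) j
          ≈⟨ +-congʳ (const-⊗ (X 0) _ j) ⟨
        (const (X 0) ⊗ sub (tl Y)) j + (sub (tl X) ⊗ sub Y) j
          ∎

  -- With Q the series of coefficients q, these are the coefficients C(d + j, d) q (d + j) of the
  -- d-th derivative of Q divided by d!. Pascal's recursion is taken as the definition because the
  -- recursion on the first child needs this form.
  bin : ℕ → (ℕ → Carrier) → Series
  bin zero    q j       = q j
  bin (suc d) q zero    = bin d (tl q) zero
  bin (suc d) q (suc j) = bin d (tl q) (suc j) + bin (suc d) (tl q) j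

  bin-binomial : ∀ d q j → bin d q j ≈ binomial d j · q (d ℕ.+ j)
  bin-binomial zero    q j       = sym (×-homo-1 _)
  bin-binomial (suc d) q zero    = bin-binomial d (tl q) zero
  bin-binomial (suc d) q (suc j) = begin
    bin d (tl q) (suc j) + bin (suc d) (tl q) j
      ≈⟨ +-cong (bin-binomial d (tl q) (suc j)) (bin-binomial (suc d) (tl q) j) ⟩
    binomial d (suc j) · q (suc (d ℕ.+ suc j)) + binomial (suc d) j · q (suc (suc (d ℕ.+ j)))
      ≈⟨ +-congˡ (×-congʳ (binomial (suc d) j) (reflexive (≡.cong (λ k → q (suc k)) (≡.sym (ℕ.+-suc d j))))) ⟩
    binomial d (suc j) · q (suc (d ℕ.+ suc j)) + binomial (suc d) j · q (suc (d ℕ.+ suc j))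
      ≈⟨ ×-homo-+ _ (binomial d (suc j)) (binomial (suc d) j) ⟨
    (binomial d (suc j) ℕ.+ binomial (suc d) j) · q (suc (d ℕ.+ suc j))
      ∎

  -- The total weight of a vertex with d kept children and any number of cut ones, each cut child
  -- contributing t h: j of them can be interleaved with the kept ones in C(d + j, d) ways.
  binSub : ℕ → (ℕ → Carrier) → Series
  binSub d q = sub (bin d q)

  binSub-zero : ∀ q → binSub 0 q ≋ const (q 0) ⊕ shift (h ⊗ binSub 0 (tl q))
  binSub-zero q = sub-unfold q

  -- Pascal's rule read off from the first child: either it is kept, leaving d further kept ones, or
  -- it is cut and contributes t h.
  binSub-suc : ∀ d q → binSub (suc d) q ≋ binSub d (tl q) ⊕ shift (h ⊗ binSub (suc d) (tl q))
  binSub-suc d q n = begin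
    sub (bin (suc d) q) n
      ≈⟨ sub-unfold (bin (suc d) q) n ⟩
    const (bin d (tl q) 0) n + shift (h ⊗ sub (tl (bin d (tl q)) ⊕ bin (suc d) (tl q))) n
      ≈⟨ +-congˡ (shift-cong (⊗-cong (λ _ → refl) (sub-⊕ _ _)) n) ⟩
    const (bin d (tl q) 0) n + shift (h ⊗ (sub (tl (bin d (tl q))) ⊕ sub (bin (suc d) (tl q)))) n
      ≈⟨ +-congˡ (shift-cong (⊗-distribˡ h _ _) n) ⟩
    const (bin d (tl q) 0) n + shift (h ⊗ sub (tl (bin d (tl q))) ⊕ h ⊗ sub (bin (suc d) (tl q))) n
      ≈⟨ +-congˡ (shift-⊕ _ _ n) ⟩
    const (bin d (tl q) 0) n + (shift (h ⊗ sub (tl (bin d (tl q)))) n + shift (h ⊗ sub (bin (suc d) (tl q))) n)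
      ≈⟨ +-assoc _ _ _ ⟨
    (const (bin d (tl q) 0) n + shift (h ⊗ sub (tl (bin d (tl q)))) n) + shift (h ⊗ sub (bin (suc d) (tl q))) n
      ≈⟨ +-congʳ (sub-unfold (bin d (tl q)) n) ⟨
    sub (bin d (tl q)) n + shift (h ⊗ sub (bin (suc d) (tl q))) n
      ∎

module Derivation {c ℓ} (R : CommutativeRing c ℓ) where
  open CommutativeRing R hiding (zero)
  open Sums R
  open PowerSeries R
  open SetoidReasoning setoid
  open import Algebra.Properties.Monoid.Mult +-monoid using (×-homo-+; ×-congʳ; ×-congˡ) renaming (_×_ to _·_)
  open import Algebra.Properties.Semiring.Mult semiring using (×-assoc-*; ×-comm-*)
  open import Algebra.Properties.CommutativeMonoid.Mult +-commutativeMonoid using (×-distrib-+)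

  -- The formal derivative, written with integer multiples so that it makes sense over any ring and
  -- serves both for g and for the Taylor variable.
  ∂ : Series → Series
  ∂ F n = suc n · F (suc n)

  ∂-cong : ∀ {F G} → F ≋ G → ∂ F ≋ ∂ G
  ∂-cong p n = ×-congʳ (suc n) (p (suc n))

  ∂-⊕ : ∀ F G → ∂ (F ⊕ G) ≋ ∂ F ⊕ ∂ G
  ∂-⊕ F G n = ×-distrib-+ _ _ (suc n)

  ∂-scale : ∀ a F → ∂ (λ n → a * F n) ≋ λ n → a * ∂ F n
  ∂-scale a F n = sym (×-comm-* (suc n) a _)

  ×-tri : ∀ m n f → m · tri n f ≈ tri n (λ i j → m · f i j)
  ×-tri m zero    f = refl
  ×-tri m (suc n) f = trans (×-distrib-+ _ _ m) (+-congˡ (×-tri m n _))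

  -- On the term with i + j = n + 1 the multiplier splits into i and j, one for each factor. The
  -- terms with multiplier 0 drop out, which shifts the indices as `∂` requires.
  ∂-⊗ : ∀ F G → ∂ (F ⊗ G) ≋ ∂ F ⊗ G ⊕ F ⊗ ∂ G
  ∂-⊗ F G n = begin
    suc n · tri (suc n) (λ i j → F i * G j)
      ≈⟨ ×-tri (suc n) (suc n) (λ i j → F i * G j) ⟩
    tri (suc n) (λ i j → suc n · (F i * G j))
      ≈⟨ tri-cong-≡ (suc n) split ⟩
    tri (suc n) (λ i j → (i · F i) * G j + F i * (j · G j))
      ≈⟨ tri-+ (suc n) (λ i j → (i · F i) * G j) (λ i j → F i * (j · G j)) ⟩
    tri (suc n) (λ i j → (i · F i) * G j) + tri (suc n) (λ i j → F i * (j · G j))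
      ≈⟨ +-cong (trans (+-congʳ (zeroˡ _)) (+-identityˡ _))
                (trans (tri-last n (λ i j → F i * (j · G j))) (trans (+-congʳ (zeroʳ _)) (+-identityˡ _))) ⟩
    tri n (λ i j → ∂ F i * G j) + tri n (λ i j → F i * ∂ G j)
      ∎
    where
    split : ∀ i j → i ℕ.+ j ≡ suc n → suc n · (F i * G j) ≈ (i · F i) * G j + F i * (j · G j)
    split i j eq = begin
      suc n · (F i * G j)                     ≈⟨ ×-congˡ eq ⟨
      (i ℕ.+ j) · (F i * G j)                 ≈⟨ ×-homo-+ _ i j ⟩
      i · (F i * G j) + j · (F i * G j)       ≈⟨ +-cong (×-assoc-* i _ _) (×-comm-* j _ _) ⟨
      (i · F i) * G j + F i * (j · G j)       ∎

module Taylor {c ℓ} (R : CommutativeRing c ℓ) (recip : ℕ → CommutativeRing.Carrier R)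
  (inverse : ∀ n → CommutativeRing._≈_ R
     (CommutativeRing._*_ R (WithRing.natR R recip (suc n)) (recip (suc n))) (CommutativeRing.1# R)) where
  open CommutativeRing R hiding (zero)
  open WithRing R recip
  open Sums R
  open PowerSeries R
  open Derivation R
  open SetoidReasoning setoid
  open import Algebra.Properties.Monoid.Mult +-monoid using (×-congʳ; ×-assocˡ) renaming (_×_ to _·_)
  open import Algebra.Properties.Semiring.Mult semiring using (×-comm-*)
  private
    module S = CommutativeRing seriesRing
    module SS = Sums seriesRing
    module PS = PowerSeries seriesRing
    module DS = Derivation seriesRing
  open import Algebra.Properties.Monoid.Mult S.+-monoid using () renaming (_×_ to _·ₛ_) public

  ×-series : ∀ n F m → (n ·ₛ F) m ≡ n · F m
  ×-series zero    F m = ≡.refl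
  ×-series (suc n) F m = ≡.cong (F m +_) (×-series n F m)

  natR-× : ∀ n x → natR n * x ≈ n · x
  natR-× zero    x = zeroˡ x
  natR-× (suc n) x = trans (distribʳ x 1# (natR n)) (+-cong (*-identityˡ x) (natR-× n x))

  deriv-∂ : ∀ F → deriv F ≋ ∂ F
  deriv-∂ F m = natR-× (suc m) _

  recip-× : ∀ n x → suc n · (recip (suc n) * x) ≈ x
  recip-× n x = begin
    suc n · (recip (suc n) * x)           ≈⟨ natR-× (suc n) _ ⟨
    natR (suc n) * (recip (suc n) * x)    ≈⟨ *-assoc _ _ _ ⟨
    natR (suc n) * recip (suc n) * x      ≈⟨ *-congʳ (inverse n) ⟩
    1# * x                                ≈⟨ *-identityˡ x ⟩
    x                                     ∎

  -- Division by a positive integer through `recip`; the uniqueness of Taylor expansions rests on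
  -- it.
  ×-cancel : ∀ n {x y} → suc n · x ≈ suc n · y → x ≈ y
  ×-cancel n {x} {y} p = begin
    x                             ≈⟨ recip-× n x ⟨
    suc n · (recip (suc n) * x)   ≈⟨ ×-comm-* (suc n) _ _ ⟨
    recip (suc n) * (suc n · x)   ≈⟨ *-congˡ p ⟩
    recip (suc n) * (suc n · y)   ≈⟨ ×-comm-* (suc n) _ _ ⟩
    suc n · (recip (suc n) * y)   ≈⟨ recip-× n y ⟩
    y                             ∎

  invFact-× : ∀ n x → (n !) · (invFact n * x) ≈ x
  invFact-× zero    x = trans (+-identityʳ _) (*-identityˡ x)
  invFact-× (suc n) x = begin
    (suc n ℕ.* n !) · (recip (suc n) * invFact n * x)     ≈⟨ ×-assocˡ _ (suc n) (n !) ⟨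
    suc n · ((n !) · (recip (suc n) * invFact n * x))       ≈⟨ ×-congʳ (suc n) (×-congʳ (n !) (*-assoc _ _ _)) ⟩
    suc n · ((n !) · (recip (suc n) * (invFact n * x)))     ≈⟨ ×-congʳ (suc n) (×-comm-* (n !) _ _) ⟨
    suc n · (recip (suc n) * ((n !) · (invFact n * x)))     ≈⟨ recip-× n _ ⟩
    (n !) · (invFact n * x)                                 ≈⟨ invFact-× n x ⟩
    x                                                     ∎

  -- taylor φ is the expansion of φ(g + s) in powers of s.
  taylor : Series → PS.Series
  taylor φ k m = invFact k * derivIter k φ m

  taylor-zero : ∀ φ → taylor φ 0 ≋ φ
  taylor-zero φ m = *-identityˡ _

  derivIter-cong : ∀ k {φ ψ} → φ ≋ ψ → derivIter k φ ≋ derivIter k ψ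
  derivIter-cong zero    p m = p m
  derivIter-cong (suc k) p m = *-congˡ (derivIter-cong k p (suc m))

  derivIter-scale : ∀ k a φ → derivIter k (λ m → a * φ m) ≋ λ m → a * derivIter k φ m
  derivIter-scale zero    a φ m = refl
  derivIter-scale (suc k) a φ m =
    trans (*-congˡ (derivIter-scale k a φ (suc m)))
          (*-swapˡ _ _ _)

  derivIter-⊕ : ∀ k φ ψ → derivIter k (φ ⊕ ψ) ≋ derivIter k φ ⊕ derivIter k ψ
  derivIter-⊕ zero    φ ψ m = refl
  derivIter-⊕ (suc k) φ ψ m = trans (*-congˡ (derivIter-⊕ k φ ψ (suc m))) (distribˡ _ _ _)

  derivIter-∘ : ∀ j d φ → derivIter j (derivIter d φ) ≡ derivIter (j ℕ.+ d) φ
  derivIter-∘ zero    d φ = ≡.refl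
  derivIter-∘ (suc j) d φ = ≡.cong deriv (derivIter-∘ j d φ)

  taylor-cong : ∀ {φ ψ} → φ ≋ ψ → taylor φ PS.≋ taylor ψ
  taylor-cong p k m = *-congˡ (derivIter-cong k p m)

  taylor-⊕ : ∀ φ ψ → taylor (φ ⊕ ψ) PS.≋ taylor φ PS.⊕ taylor ψ
  taylor-⊕ φ ψ k m = trans (*-congˡ (derivIter-⊕ k φ ψ m)) (distribˡ _ _ _)

  taylor-scale : ∀ a φ → taylor (λ m → a * φ m) PS.≋ λ k m → a * taylor φ k m
  taylor-scale a φ k m =
    trans (*-congˡ (derivIter-scale k a φ m)) (*-swapˡ _ _ _)

  -- d/ds and d/dg agree on functions of g + s.
  Translation : PS.Series → Set ℓ
  Translation Z = ∀ k → DS.∂ Z k ≋ ∂ (Z k)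

  taylor-translation : ∀ φ → Translation (taylor φ)
  taylor-translation φ k m = begin
    (suc k ·ₛ taylor φ (suc k)) m
      ≈⟨ reflexive (×-series (suc k) (taylor φ (suc k)) m) ⟩
    suc k · (recip (suc k) * invFact k * derivIter (suc k) φ m)
      ≈⟨ ×-congʳ (suc k) (*-assoc _ _ _) ⟩
    suc k · (recip (suc k) * (invFact k * derivIter (suc k) φ m))
      ≈⟨ recip-× k _ ⟩
    invFact k * deriv (derivIter k φ) m
      ≈⟨ *-congˡ (deriv-∂ (derivIter k φ) m) ⟩
    invFact k * ∂ (derivIter k φ) m
      ≈⟨ ∂-scale (invFact k) (derivIter k φ) m ⟨
    ∂ (taylor φ k) m
      ∎

  -- The equation determines k + 1 times the coefficient of index k + 1 from the previous
  -- coefficient, and k + 1 can be cancelled.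
  translation-unique : ∀ {Y Z} → Translation Y → Translation Z → Y 0 ≋ Z 0 → Y PS.≋ Z
  translation-unique         y z p zero    m = p m
  translation-unique {Y} {Z} y z p (suc k) m = ×-cancel k (begin
    suc k · Y (suc k) m        ≈⟨ reflexive (×-series (suc k) (Y (suc k)) m) ⟨
    (suc k ·ₛ Y (suc k)) m     ≈⟨ y k m ⟩
    ∂ (Y k) m                  ≈⟨ ∂-cong (translation-unique {Y} {Z} y z p k) m ⟩
    ∂ (Z k) m                  ≈⟨ z k m ⟨
    (suc k ·ₛ Z (suc k)) m     ≈⟨ reflexive (×-series (suc k) (Z (suc k)) m) ⟩
    suc k · Z (suc k) m        ∎)

  ∂-tri : ∀ n (f : ℕ → ℕ → Series) → ∂ (SS.tri n f) ≋ SS.tri n (λ i j → ∂ (f i j))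
  ∂-tri zero    f m = refl
  ∂-tri (suc n) f m = trans (∂-⊕ (f 0 (suc n)) (SS.tri n (λ i → f (suc i))) m) (+-congˡ (∂-tri n (λ i → f (suc i)) m))

  -- Both derivations obey the product rule, so the two sides split in the same way.
  translation-⊗ : ∀ {Y Z} → Translation Y → Translation Z → Translation (Y PS.⊗ Z)
  translation-⊗ {Y} {Z} y z k m = begin
    DS.∂ (Y PS.⊗ Z) k m
      ≈⟨ DS.∂-⊗ Y Z k m ⟩
    SS.tri k (λ i j → DS.∂ Y i ⊗ Z j) m + SS.tri k (λ i j → Y i ⊗ DS.∂ Z j) m
      ≈⟨ SS.tri-+ k _ _ m ⟨
    SS.tri k (λ i j → DS.∂ Y i ⊗ Z j ⊕ Y i ⊗ DS.∂ Z j) m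
      ≈⟨ SS.tri-cong k (λ i j → S.+-cong (S.*-congʳ {Z j} (y i)) (S.*-congˡ {Y i} (z j))) m ⟩
    SS.tri k (λ i j → ∂ (Y i) ⊗ Z j ⊕ Y i ⊗ ∂ (Z j)) m
      ≈⟨ SS.tri-cong k (λ i j → ∂-⊗ (Y i) (Z j)) m ⟨
    SS.tri k (λ i j → ∂ (Y i ⊗ Z j)) m
      ≈⟨ ∂-tri k _ m ⟨
    ∂ ((Y PS.⊗ Z) k) m
      ∎

  -- This replaces the general Leibniz formula: both sides satisfy the translation equation and have
  -- constant term φ ⊗ ψ in the Taylor variable, so they agree.
  taylor-⊗ : ∀ φ ψ → taylor (φ ⊗ ψ) PS.≋ taylor φ PS.⊗ taylor ψ
  taylor-⊗ φ ψ = translation-unique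
    (taylor-translation (φ ⊗ ψ)) (translation-⊗ (taylor-translation φ) (taylor-translation ψ))
    (S.trans (taylor-zero (φ ⊗ ψ)) (S.sym (S.*-cong (taylor-zero φ) (taylor-zero ψ))))

-- Composition of series as substitution of g + t h for g

module Composition {c ℓ} (R : CommutativeRing c ℓ) (recip : ℕ → CommutativeRing.Carrier R)
  (inverse : ∀ n → CommutativeRing._≈_ R
     (CommutativeRing._*_ R (WithRing.natR R recip (suc n)) (recip (suc n))) (CommutativeRing.1# R)) where
  open CommutativeRing R hiding (zero)
  open WithRing R recip
  open Sums R
  open PowerSeries R
  open Taylor R recip inverse
  open SetoidReasoning setoid
  open import Algebra.Properties.Ring ring using (-0#≈0#)
  open import Algebra.Properties.Monoid.Mult +-monoid using (×-congʳ; ×-congˡ; ×-assocˡ) renaming (_×_ to _·_)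
  open import Algebra.Properties.Semiring.Mult semiring using (×-comm-*)
  private
    module S = CommutativeRing seriesRing
    module SS = Sums seriesRing
    module PS = PowerSeries seriesRing

  sumL-map : ∀ {A : Set} (f : A → Carrier) xs → sumL (map f xs) ≡ sum xs f
  sumL-map f []       = ≡.refl
  sumL-map f (x ∷ xs) = ≡.cong (f x +_) (sumL-map f xs)

  sumTo-tri : ∀ n f → sumTo n f ≈ tri n (λ i _ → f i)
  sumTo-tri n f = go n id
    where
    go : ∀ n g → sumL (map f (applyUpTo g (suc n))) ≈ tri n (λ i _ → f (g i))
    go zero    g = +-identityʳ _
    go (suc n) g = +-congˡ (go n (λ i → g (suc i)))

  sumTo-∸ : ∀ n (f : ℕ → ℕ → Carrier) → sumTo n (λ i → f i (n ∸ i)) ≈ tri n f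
  sumTo-∸ n f = trans (sumTo-tri n _) (tri-cong-≡ n λ i j eq →
    reflexive (≡.cong (f i) (≡.trans (≡.cong (_∸ i) (≡.sym eq)) (ℕ.m+n∸m≡n i j))))

  ⊛-⊗ : ∀ F G → F ⊛ G ≋ F ⊗ G
  ⊛-⊗ F G n = sumTo-∸ n (λ i j → F i * G j)

  tri-series : ∀ n (f : ℕ → ℕ → Series) m → SS.tri n f m ≡ tri n (λ i j → f i j m)
  tri-series zero    f m = ≡.refl
  tri-series (suc n) f m = ≡.cong (f 0 (suc n) m +_) (tri-series n (λ i → f (suc i)) m)

  sum-series : ∀ {A : Set} (xs : List A) (f : A → Series) m → SS.sum xs f m ≡ sum xs (λ x → f x m)
  sum-series []       f m = ≡.refl
  sum-series (x ∷ xs) f m = ≡.cong (f x m +_) (sum-series xs f m)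

  ⊛₂-⊗ : ∀ F G → F ⊛₂ G PS.≋ F PS.⊗ G
  ⊛₂-⊗ F G n m = begin
    sumTo n (λ i → (F i ⊛ G (n ∸ i)) m)     ≈⟨ sumTo-∸ n (λ i j → (F i ⊛ G j) m) ⟩
    tri n (λ i j → (F i ⊛ G j) m)           ≈⟨ tri-cong n (λ i j → ⊛-⊗ (F i) (G j) m) ⟩
    tri n (λ i j → (F i ⊗ G j) m)           ≡⟨ tri-series n (λ i j → F i ⊗ G j) m ⟨
    SS.tri n (λ i j → F i ⊗ G j) m          ∎

  oneS-const : oneS ≋ const 1#
  oneS-const zero    = refl
  oneS-const (suc m) = refl

  one2-const : one2 PS.≋ PS.const S.1#
  one2-const zero    m = oneS-const m
  one2-const (suc n) m = refl

  ⊗-scaleˡ : ∀ a F G → (λ i → a * F i) ⊗ G ≋ λ i → a * (F ⊗ G) i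
  ⊗-scaleˡ a F G n = trans (tri-cong n (λ i j → *-assoc _ _ _)) (sym (*-distribˡ-tri n a _))

  ⊗-scaleʳ : ∀ a F G → F ⊗ (λ i → a * G i) ≋ λ i → a * (F ⊗ G) i
  ⊗-scaleʳ a F G n =
    trans (tri-cong n (λ i j → *-swapˡ _ _ _)) (sym (*-distribˡ-tri n a _))

  scaledDeriv : PS → ℕ → PS
  scaledDeriv β d m = invFact d * derivIter d β m

  module _ (h : PS2) where
    open Substitution seriesRing h

    -- compose φ = φ(g + t h(t, g))
    compose : PS → PS2
    compose φ = sub (taylor φ)

    compose-cong : ∀ {φ ψ} → φ ≋ ψ → compose φ PS.≋ compose ψ
    compose-cong p = sub-cong (taylor-cong p)

    compose-⊕ : ∀ φ ψ → compose (φ ⊕ ψ) PS.≋ compose φ PS.⊕ compose ψ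
    compose-⊕ φ ψ = λ n → S.trans (sub-cong (taylor-⊕ φ ψ) n) (sub-⊕ (taylor φ) (taylor ψ) n)

    compose-⊗ : ∀ φ ψ → compose (φ ⊗ ψ) PS.≋ compose φ PS.⊗ compose ψ
    compose-⊗ φ ψ = λ n → S.trans (sub-cong (taylor-⊗ φ ψ) n) (sub-⊗ (taylor φ) (taylor ψ) n)

    compose-scale : ∀ a φ → compose (λ m → a * φ m) PS.≋ λ n m → a * compose φ n m
    compose-scale a φ n m = begin
      sub (taylor (λ m → a * φ m)) n m
        ≈⟨ sub-cong (taylor-scale a φ) n m ⟩
      SS.tri n (λ k j → pow k j ⊗ (λ m → a * taylor φ k m)) m
        ≈⟨ SS.tri-cong n (λ k j → ⊗-scaleʳ a (pow k j) (taylor φ k)) m ⟩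
      SS.tri n (λ k j m → a * (pow k j ⊗ taylor φ k) m) m
        ≡⟨ tri-series n (λ k j m → a * (pow k j ⊗ taylor φ k) m) m ⟩
      tri n (λ k j → a * (pow k j ⊗ taylor φ k) m)
        ≈⟨ *-distribˡ-tri n a _ ⟨
      a * tri n (λ k j → (pow k j ⊗ taylor φ k) m)
        ≡⟨ ≡.cong (a *_) (tri-series n (λ k j → pow k j ⊗ taylor φ k) m) ⟨
      a * sub (taylor φ) n m
        ∎

    taylor-0 : taylor (λ _ → 0#) PS.≋ λ _ _ → 0#
    taylor-0 k m = trans (taylor-cong {φ = λ _ → 0#} {ψ = λ _ → 0# * 0#} (λ _ → sym (zeroˡ _)) k m)
                         (trans (taylor-scale 0# (λ _ → 0#) k m) (zeroˡ _))

    compose-0 : compose (λ _ → 0#) PS.≋ λ _ _ → 0#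
    compose-0 n m = begin
      sub (taylor (λ _ → 0#)) n m                   ≈⟨ sub-cong taylor-0 n m ⟩
      SS.tri n (λ k j → pow k j ⊗ (λ _ → 0#)) m     ≈⟨ SS.tri-cong n (λ k j → S.zeroʳ (pow k j)) m ⟩
      SS.tri n (λ k j _ → 0#) m                     ≈⟨ SS.tri-zero n m ⟩
      0#                                            ∎

    compose-sum : ∀ {A : Set} (xs : List A) (f : A → PS) n m →
                  compose (SS.sum xs f) n m ≈ sum xs (λ x → compose (f x) n m)
    compose-sum []       f n m = compose-0 n m
    compose-sum (x ∷ xs) f n m = trans (compose-⊕ (f x) (SS.sum xs f) n m) (+-congˡ (compose-sum xs f n m))

    -- C(d + j, d) / (d + j)! = 1 / (d! j!) without quotients of integers: x is rewritten as d! j!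
    -- times the right-hand side, and `binomial-!` collects the integers to (d + j)!.
    binomial-invFact : ∀ d j x → binomial d j · (invFact (d ℕ.+ j) * x) ≈ invFact j * (invFact d * x)
    binomial-invFact d j x = begin
      binomial d j · (invFact (d ℕ.+ j) * x)
        ≈⟨ ×-congʳ (binomial d j) (*-congˡ unfold) ⟨
      binomial d j · (invFact (d ℕ.+ j) * ((d ! ℕ.* j !) · y))
        ≈⟨ ×-congʳ (binomial d j) (×-comm-* (d ! ℕ.* j !) _ _) ⟩
      binomial d j · ((d ! ℕ.* j !) · (invFact (d ℕ.+ j) * y))
        ≈⟨ ×-assocˡ _ (binomial d j) (d ! ℕ.* j !) ⟩
      (binomial d j ℕ.* (d ! ℕ.* j !)) · (invFact (d ℕ.+ j) * y)
        ≈⟨ ×-congˡ (binomial-! d j) ⟩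
      ((d ℕ.+ j) !) · (invFact (d ℕ.+ j) * y)
        ≈⟨ invFact-× (d ℕ.+ j) y ⟩
      y
        ∎
      where
      y = invFact j * (invFact d * x)
      unfold : (d ! ℕ.* j !) · y ≈ x
      unfold = begin
        (d ! ℕ.* j !) · (invFact j * (invFact d * x))     ≈⟨ ×-assocˡ _ (d !) (j !) ⟨
        (d !) · ((j !) · (invFact j * (invFact d * x)))   ≈⟨ ×-congʳ (d !) (invFact-× j _) ⟩
        (d !) · (invFact d * x)                           ≈⟨ invFact-× d x ⟩
        x                                                 ∎

    -- The Taylor coefficient of index j of β^(d)/d! is β^(d+j)/(d! j!), which equals C(d + j, d)
    -- β^(d+j)/(d + j)!. So all derivatives of β enter through the one sequence `scaledDeriv β`.
    compose-scaledDeriv : ∀ β d → compose (scaledDeriv β d) PS.≋ binSub d (scaledDeriv β)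
    compose-scaledDeriv β d = sub-cong {taylor (scaledDeriv β d)} {bin d (scaledDeriv β)} λ j m → sym (begin
      bin d (scaledDeriv β) j m
        ≈⟨ bin-binomial d (scaledDeriv β) j m ⟩
      (binomial d j ·ₛ scaledDeriv β (d ℕ.+ j)) m
        ≡⟨ ×-series (binomial d j) (scaledDeriv β (d ℕ.+ j)) m ⟩
      binomial d j · (invFact (d ℕ.+ j) * derivIter (d ℕ.+ j) β m)
        ≈⟨ binomial-invFact d j _ ⟩
      invFact j * (invFact d * derivIter (d ℕ.+ j) β m)
        ≡⟨ ≡.cong (λ k → invFact j * (invFact d * derivIter k β m)) (ℕ.+-comm d j) ⟩
      invFact j * (invFact d * derivIter (j ℕ.+ d) β m)
        ≡⟨ ≡.cong (λ ψ → invFact j * (invFact d * ψ m)) (derivIter-∘ j d β) ⟨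
      invFact j * (invFact d * derivIter j (derivIter d β) m)
        ≈⟨ *-congˡ (derivIter-scale j (invFact d) (derivIter d β) m) ⟨
      invFact j * derivIter j (scaledDeriv β d) m
        ∎)

    compose-zero : ∀ φ → compose φ 0 ≋ φ
    compose-zero φ m = trans (sub-zero (taylor φ) m) (taylor-zero φ m)

    compose-one : compose (const 1#) PS.≋ PS.const S.1#
    compose-one zero    m = compose-zero (const 1#) m
    compose-one (suc n) m = begin
      sub (taylor (const 1#)) (suc n) m
        ≈⟨ sub-suc (taylor (const 1#)) n m ⟩
      (h PS.⊗ sub (PS.tl (taylor (const 1#)))) n m
        ≈⟨ PS.⊗-cong {h} {h} (λ _ _ → refl) (sub-cong (λ k m → trans (*-congˡ (higher k m)) (zeroʳ _))) n m ⟩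
      (h PS.⊗ sub (λ _ _ → 0#)) n m
        ≈⟨ PS.⊗-cong {h} {h} (λ _ _ → refl) (λ n m → trans (SS.tri-cong n (λ k j → S.zeroʳ (pow k j)) m) (SS.tri-zero n m)) n m ⟩
      (h PS.⊗ (λ _ _ → 0#)) n m
        ≈⟨ CommutativeRing.zeroʳ PS.seriesRing h n m ⟩
      0#
        ∎
      where
      higher : ∀ k → derivIter (suc k) (const 1#) ≋ λ _ → 0#
      higher zero    m = zeroʳ _
      higher (suc k) m = trans (*-congˡ (higher k (suc m))) (zeroʳ _)

    deriv-gS : deriv gS ≋ oneS
    deriv-gS zero    = trans (*-identityʳ _) (+-identityʳ _)
    deriv-gS (suc m) = zeroʳ _

    -- The series g becomes g + t h, since its derivatives of order two and higher vanish.
    compose-gS-suc : ∀ n → compose gS (suc n) ≋ h n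
    compose-gS-suc n m = begin
      sub (taylor gS) (suc n) m                   ≈⟨ sub-suc (taylor gS) n m ⟩
      (h PS.⊗ sub (PS.tl (taylor gS))) n m        ≈⟨ PS.⊗-cong {h} {h} (λ _ _ → refl) sub-one n m ⟩
      (h PS.⊗ PS.const S.1#) n m                  ≈⟨ P.*-identityʳ h n m ⟩
      h n m                                       ∎
      where
      module P = CommutativeRing PS.seriesRing
      taylor-one : ∀ k → taylor gS (suc (suc k)) ≋ λ _ → 0#
      taylor-one k m = trans (*-congˡ (higher k m)) (zeroʳ _)
        where
        higher : ∀ k → derivIter (suc (suc k)) gS ≋ λ _ → 0#
        higher zero    m = trans (*-congˡ (deriv-gS (suc m))) (zeroʳ _)
        higher (suc k) m = trans (*-congˡ (higher k (suc m))) (zeroʳ _)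
      tail : sub (PS.tl (PS.tl (taylor gS))) PS.≋ λ _ _ → 0#
      tail n m = trans (SS.tri-cong n (λ k j → S.trans (S.*-congˡ {pow k j} (taylor-one k)) (S.zeroʳ (pow k j))) m)
                       (SS.tri-zero n m)
      head : taylor gS 1 ≋ oneS
      head m = trans (*-congˡ (deriv-gS m)) (trans (*-assoc _ _ _)
                 (trans (sym (+-identityʳ _)) (trans (recip-× 0 (1# * oneS m)) (*-identityˡ _))))
      sub-one : sub (PS.tl (taylor gS)) PS.≋ PS.const S.1#
      sub-one zero    m = trans (sub-zero (PS.tl (taylor gS)) m) (trans (head m) (oneS-const m))
      sub-one (suc n) m = trans (sub-suc (PS.tl (taylor gS)) n m)
        (trans (PS.⊗-cong {h} {h} (λ _ _ → refl) tail n m) (P.zeroʳ h n m))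

    shiftBy : ℕ → PS2 → PS2
    shiftBy zero    F = F
    shiftBy (suc k) F = PS.shift (shiftBy k F)

    shiftBy-+ : ∀ k F j → shiftBy k F (k ℕ.+ j) ≡ F j
    shiftBy-+ zero    F j = ≡.refl
    shiftBy-+ (suc k) F j = shiftBy-+ k F j

    shiftBy-⊗ : ∀ k F G → shiftBy k F PS.⊗ G PS.≋ shiftBy k (F PS.⊗ G)
    shiftBy-⊗ zero    F G n = S.refl
    shiftBy-⊗ (suc k) F G n = S.trans (PS.shift-⊗ (shiftBy k F) G n)
                                      (PS.shift-cong (shiftBy-⊗ k F G) n)

    shiftBy-cong : ∀ k {F G} → F PS.≋ G → shiftBy k F PS.≋ shiftBy k G
    shiftBy-cong zero    p = p
    shiftBy-cong (suc k) p = PS.shift-cong (shiftBy-cong k p)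

    -- Here H = t h, and the k factors t can be moved to the front.
    pow2-pow : ∀ H → H PS.≋ PS.shift h → ∀ k → pow2 H k PS.≋ shiftBy k (pow k)
    pow2-pow H p zero    n = one2-const n
    pow2-pow H p (suc k) n = S.trans (⊛₂-⊗ H (pow2 H k) n)
      (S.trans (PS.⊗-cong p (pow2-pow H p k) n)
      (S.trans (PS.shift-⊗ h (shiftBy k (pow k)) n)
      (PS.shift-cong (λ j →
        S.trans (PS.⊗-comm h (shiftBy k (pow k)) j)
        (S.trans (shiftBy-⊗ k (pow k) h j) (shiftBy-cong k (PS.⊗-comm (pow k) h) j))) n)))

    -- Both sides expand F in powers of t and each coefficient by Taylor's formula; they differ in
    -- the order of the sums over the Taylor index k and the t-degree i, and in whether 1/k! stands
    -- outside or inside the product.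
    composeTaylor-compose : ∀ F G → G 0 ≋ gS → (∀ n → G (suc n) ≋ h n) → ∀ n m →
      composeTaylor F G n m ≈ tri n (λ i j → compose (F i) j m)
    composeTaylor-compose F G p q n m = begin
      sumTo n (λ k → invFact k * (pow2 H k ⊛₂ dgIter k F) n m)
        ≈⟨ sumTo-tri n _ ⟩
      tri n (λ k _ → invFact k * (pow2 H k ⊛₂ dgIter k F) n m)
        ≈⟨ tri-cong-≡ n term ⟩
      tri n (λ k l → (pow k PS.⊗ (λ i → taylor (F i) k)) l m)
        ≡⟨ tri-series n (λ k l → (pow k PS.⊗ (λ i → taylor (F i) k)) l) m ⟨
      SS.tri n (λ k l → SS.tri l (λ j i → pow k j ⊗ taylor (F i) k)) m
        ≈⟨ SS.tri-assoc n (λ k j i → pow k j ⊗ taylor (F i) k) m ⟨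
      SS.tri n (λ j i → SS.tri j (λ k l → pow k l ⊗ taylor (F i) k)) m
        ≈⟨ SS.tri-comm n _ m ⟩
      SS.tri n (λ i j → compose (F i) j) m
        ≡⟨ tri-series n (λ i j → compose (F i) j) m ⟩
      tri n (λ i j → compose (F i) j m)
        ∎
      where
      H : PS2
      H i j = G i j - g2 i j

      H-shift : H PS.≋ PS.shift h
      H-shift zero    m = trans (+-congʳ (p m)) (-‿inverseʳ _)
      H-shift (suc n) m = trans (+-cong (q n m) -0#≈0#) (+-identityʳ _)

      term : ∀ k l → k ℕ.+ l ≡ n →
        invFact k * (pow2 H k ⊛₂ dgIter k F) n m ≈ (pow k PS.⊗ (λ i → taylor (F i) k)) l m
      term k l ≡.refl = begin
        invFact k * (pow2 H k ⊛₂ dgIter k F) n m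
          ≈⟨ *-congˡ (⊛₂-⊗ (pow2 H k) (dgIter k F) n m) ⟩
        invFact k * (pow2 H k PS.⊗ dgIter k F) n m
          ≈⟨ *-congˡ (PS.⊗-cong {G = dgIter k F} (pow2-pow H H-shift k) (λ _ _ → refl) n m) ⟩
        invFact k * (shiftBy k (pow k) PS.⊗ dgIter k F) n m
          ≈⟨ *-congˡ (shiftBy-⊗ k (pow k) (dgIter k F) n m) ⟩
        invFact k * shiftBy k (pow k PS.⊗ dgIter k F) (k ℕ.+ l) m
          ≡⟨ ≡.cong (λ A → invFact k * A m) (shiftBy-+ k (pow k PS.⊗ dgIter k F) l) ⟩
        invFact k * (pow k PS.⊗ dgIter k F) l m
          ≡⟨ ≡.cong (invFact k *_) (tri-series l (λ i j → pow k i ⊗ dgIter k F j) m) ⟩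
        invFact k * tri l (λ i j → (pow k i ⊗ dgIter k F j) m)
          ≈⟨ *-distribˡ-tri l _ _ ⟩
        tri l (λ i j → invFact k * (pow k i ⊗ dgIter k F j) m)
          ≈⟨ tri-cong l (λ i j → ⊗-scaleʳ (invFact k) (pow k i) (dgIter k F j) m) ⟨
        tri l (λ i j → (pow k i ⊗ taylor (F j) k) m)
          ≡⟨ tri-series l (λ i j → pow k i ⊗ taylor (F j) k) m ⟨
        (pow k PS.⊗ (λ i → taylor (F i) k)) l m
          ∎

-- Plane forests and their prunings

module _ where
  open ≡ using (refl; sym; trans)
  open import Data.Nat using (_+_)

  sizeF : List Tree → ℕ
  sizeF []             = 0
  sizeF (node us ∷ ts) = suc (sizeF us + sizeF ts)

  sizeT : Tree → ℕ
  sizeT (node ts) = suc (sizeF ts)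

  triL : {A : Set} → ℕ → (ℕ → ℕ → List A) → List A
  triL zero    f = f 0 0
  triL (suc n) f = f 0 (suc n) ++ triL n (λ i → f (suc i))

  module _ {A : Set} where

    triL-cong : ∀ n {f g : ℕ → ℕ → List A} → (∀ i j → i + j ≡ n → f i j ≡ g i j) → triL n f ≡ triL n g
    triL-cong zero    h = h 0 0 refl
    triL-cong (suc n) h = cong₂ _++_ (h 0 (suc n) refl) (triL-cong n (λ i j eq → h (suc i) j (cong suc eq)))

    ∈-triL⁺ : ∀ {x} i j (f : ℕ → ℕ → List A) → x ∈ f i j → x ∈ triL (i + j) f
    ∈-triL⁺ zero    zero    f x∈ = x∈
    ∈-triL⁺ zero    (suc j) f x∈ = ∈-++⁺ˡ x∈
    ∈-triL⁺ (suc i) j       f x∈ = ∈-++⁺ʳ (f 0 (suc (i + j))) (∈-triL⁺ i j (λ i → f (suc i)) x∈)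

    ∈-triL⁻ : ∀ {x} n (f : ℕ → ℕ → List A) → x ∈ triL n f → ∃₂ λ i j → i + j ≡ n × x ∈ f i j
    ∈-triL⁻ zero    f x∈ = 0 , 0 , refl , x∈
    ∈-triL⁻ (suc n) f x∈ with ∈-++⁻ (f 0 (suc n)) x∈
    ... | inj₁ x∈₁ = 0 , suc n , refl , x∈₁
    ... | inj₂ x∈₂ with i , j , eq , x∈f ← ∈-triL⁻ n (λ i → f (suc i)) x∈₂ = suc i , j , cong suc eq , x∈f

    triL-unique : ∀ n (f : ℕ → ℕ → List A) → (∀ i j → Unique (f i j)) →
                  (∀ {x i j k l} → x ∈ f i j → x ∈ f k l → i ≡ k) → Unique (triL n f)
    triL-unique zero    f u d = u 0 0
    triL-unique (suc n) f u d =
      Unique.++⁺ (u 0 (suc n))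
        (triL-unique n (λ i → f (suc i)) (λ i → u (suc i)) (λ p q → ℕ.suc-injective (d p q)))
        disjoint
      where
      disjoint : ∀ {x} → x ∈ f 0 (suc n) × x ∈ triL n (λ i → f (suc i)) → ⊥
      disjoint (p , q) with i , j , _ , x∈ ← ∈-triL⁻ n (λ i → f (suc i)) q with () ← d p x∈

  graft : List Tree → List Tree → List Tree
  graft us ts = node us ∷ ts

  -- The sizes i and j of the two subforests are not structurally smaller than `suc n`, so the
  -- recursion is on fuel; fuel n suffices for size n.
  forestsFuel : ℕ → ℕ → List (List Tree)
  forestsFuel f       zero    = [ [] ]
  forestsFuel zero    (suc n) = []
  forestsFuel (suc f) (suc n) = triL n (λ i j → cartesianProductWith graft (forestsFuel f i) (forestsFuel f j))

  -- the plane forests with n vertices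
  forests : ℕ → List (List Tree)
  forests n = forestsFuel n n

  trees : ℕ → List Tree
  trees zero    = []
  trees (suc n) = map node (forests n)

  summand-≤ˡ : ∀ i j {n} → i + j ≡ n → i ≤ n
  summand-≤ˡ i j refl = ℕ.m≤m+n i j

  summand-≤ʳ : ∀ i j {n} → i + j ≡ n → j ≤ n
  summand-≤ʳ i j refl = ℕ.m≤n+m j i

  -- Fuel beyond the size changes nothing, which gives `forests` a recursion that does not mention
  -- fuel.
  forestsFuel-stable : ∀ f g n → n ≤ f → n ≤ g → forestsFuel f n ≡ forestsFuel g n
  forestsFuel-stable f       g       zero    _         _         = refl
  forestsFuel-stable (suc f) (suc g) (suc n) (s≤s n≤f) (s≤s n≤g) = triL-cong n λ i j eq →
    cong₂ (cartesianProductWith graft)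
      (forestsFuel-stable f g i (ℕ.≤-trans (summand-≤ˡ i j eq) n≤f) (ℕ.≤-trans (summand-≤ˡ i j eq) n≤g))
      (forestsFuel-stable f g j (ℕ.≤-trans (summand-≤ʳ i j eq) n≤f) (ℕ.≤-trans (summand-≤ʳ i j eq) n≤g))

  forests-suc : ∀ n → forests (suc n) ≡ triL n (λ i j → cartesianProductWith graft (forests i) (forests j))
  forests-suc n = triL-cong n λ i j eq → cong₂ (cartesianProductWith graft)
    (forestsFuel-stable n i i (summand-≤ˡ i j eq) ℕ.≤-refl)
    (forestsFuel-stable n j j (summand-≤ʳ i j eq) ℕ.≤-refl)

  ∈-forestsFuel⁺ : ∀ f ts → sizeF ts ≤ f → ts ∈ forestsFuel f (sizeF ts)
  ∈-forestsFuel⁺ f       []             _       = here refl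
  ∈-forestsFuel⁺ (suc f) (node us ∷ ts) (s≤s p) =
    ∈-triL⁺ (sizeF us) (sizeF ts) _ (∈-cartesianProductWith⁺ graft
      (∈-forestsFuel⁺ f us (ℕ.≤-trans (ℕ.m≤m+n _ _) p))
      (∈-forestsFuel⁺ f ts (ℕ.≤-trans (ℕ.m≤n+m _ _) p)))

  ∈-forestsFuel⁻ : ∀ f n {ts} → ts ∈ forestsFuel f n → sizeF ts ≡ n
  ∈-forestsFuel⁻ f       zero    (here refl) = refl
  ∈-forestsFuel⁻ (suc f) (suc n) ts∈
    with i , j , eq , ts∈′ ← ∈-triL⁻ n _ ts∈
    with us , vs , us∈ , vs∈ , refl ← ∈-cartesianProductWith⁻ graft (forestsFuel f i) (forestsFuel f j) ts∈′
    = cong suc (trans (cong₂ _+_ (∈-forestsFuel⁻ f i us∈) (∈-forestsFuel⁻ f j vs∈)) eq)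

  forestsFuel-unique : ∀ f n → Unique (forestsFuel f n)
  forestsFuel-unique f       zero    = [] ∷ []
  forestsFuel-unique zero    (suc n) = []
  forestsFuel-unique (suc f) (suc n) = triL-unique n _
    (λ i j → Unique.cartesianProductWith⁺ graft (λ { refl → refl , refl })
               (forestsFuel-unique f i) (forestsFuel-unique f j))
    (λ {ts} {i} {j} {k} {l} → first-size {ts} {i} {j} {k} {l})
    where
    first-size : ∀ {ts i j k l} → ts ∈ cartesianProductWith graft (forestsFuel f i) (forestsFuel f j) →
                 ts ∈ cartesianProductWith graft (forestsFuel f k) (forestsFuel f l) → i ≡ k
    first-size {_} {i} {j} {k} {l} p q
      with us , vs , us∈ , _ , refl ← ∈-cartesianProductWith⁻ graft (forestsFuel f i) (forestsFuel f j) p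
      with _ , _ , us∈′ , _ , refl ← ∈-cartesianProductWith⁻ graft (forestsFuel f k) (forestsFuel f l) q
      = trans (sym (∈-forestsFuel⁻ f i us∈)) (∈-forestsFuel⁻ f k us∈′)

  ∈-trees⁺ : ∀ t {n} → sizeT t ≡ n → t ∈ trees n
  ∈-trees⁺ (node ts) refl = ∈-map⁺ node (∈-forestsFuel⁺ (sizeF ts) ts ℕ.≤-refl)

  ∈-trees⁻ : ∀ {t} n → t ∈ trees n → sizeT t ≡ n
  ∈-trees⁻ (suc n) t∈ with ts , ts∈ , refl ← ∈-map⁻ node t∈ = cong suc (∈-forestsFuel⁻ n n ts∈)

  trees-unique : ∀ n → Unique (trees n)
  trees-unique zero    = []
  trees-unique (suc n) = Unique.map⁺ (λ { refl → refl }) (forestsFuel-unique n n)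

module Cut {c ℓ} (R : CommutativeRing c ℓ) (α : Tree → CommutativeRing.Carrier R) where
  open CommutativeRing R hiding (zero)
  open Sums R
  open SetoidReasoning setoid
  open import Algebra.Solver.Ring.NaturalCoefficients.Default commutativeSemiring using (solve; _:=_; _:+_; _:*_)

  -- cutSum ts B sums B(kept) Π α(cut) over the ways to prune the forest ts.
  cutSum : List Tree → (List Tree → Carrier) → Carrier
  cutSum []             B = B []
  cutSum (node us ∷ ts) B = α (node us) * cutSum ts B + cutSum us (λ ls → cutSum ts (λ ks → B (node ls ∷ ks)))

  cutSum-cong : ∀ ts {B C} → (∀ ks → B ks ≈ C ks) → cutSum ts B ≈ cutSum ts C
  cutSum-cong []             h = h []
  cutSum-cong (node us ∷ ts) h =
    +-cong (*-congˡ (cutSum-cong ts h)) (cutSum-cong us (λ ls → cutSum-cong ts (λ ks → h (node ls ∷ ks))))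

  cutSum-0 : ∀ ts → cutSum ts (λ _ → 0#) ≈ 0#
  cutSum-0 []             = refl
  cutSum-0 (node us ∷ ts) = begin
    α (node us) * cutSum ts (λ _ → 0#) + cutSum us (λ ls → cutSum ts (λ _ → 0#))
      ≈⟨ +-cong (*-congˡ (cutSum-0 ts)) (cutSum-cong us (λ _ → cutSum-0 ts)) ⟩
    α (node us) * 0# + cutSum us (λ _ → 0#)
      ≈⟨ +-cong (zeroʳ _) (cutSum-0 us) ⟩
    0# + 0#
      ≈⟨ +-identityˡ 0# ⟩
    0# ∎

  cutSum-+ : ∀ ts B C → cutSum ts (λ ks → B ks + C ks) ≈ cutSum ts B + cutSum ts C
  cutSum-+ []             B C = refl
  cutSum-+ (node us ∷ ts) B C = begin
    a * cutSum ts (λ ks → B ks + C ks) + cutSum us (λ ls → cutSum ts (λ ks → B (node ls ∷ ks) + C (node ls ∷ ks)))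
      ≈⟨ +-cong (*-congˡ (cutSum-+ ts B C)) (trans (cutSum-cong us (λ ls → cutSum-+ ts _ _)) (cutSum-+ us _ _)) ⟩
    a * (cutSum ts B + cutSum ts C) + (cutSum us (λ ls → cutSum ts (λ ks → B (node ls ∷ ks)))
      + cutSum us (λ ls → cutSum ts (λ ks → C (node ls ∷ ks))))
      ≈⟨ solve 5 (λ a x y z w → a :* (x :+ y) :+ (z :+ w) := (a :* x :+ z) :+ (a :* y :+ w)) refl _ _ _ _ _ ⟩
    cutSum (node us ∷ ts) B + cutSum (node us ∷ ts) C ∎
    where a = α (node us)

  cutSum-scale : ∀ ts a B → cutSum ts (λ ks → a * B ks) ≈ a * cutSum ts B
  cutSum-scale []             a B = refl
  cutSum-scale (node us ∷ ts) a B = begin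
    α (node us) * cutSum ts (λ ks → a * B ks) + cutSum us (λ ls → cutSum ts (λ ks → a * B (node ls ∷ ks)))
      ≈⟨ +-cong (*-congˡ (cutSum-scale ts a B)) (trans (cutSum-cong us (λ ls → cutSum-scale ts a _)) (cutSum-scale us a _)) ⟩
    α (node us) * (a * cutSum ts B) + a * cutSum us (λ ls → cutSum ts (λ ks → B (node ls ∷ ks)))
      ≈⟨ solve 4 (λ b a x y → b :* (a :* x) :+ a :* y := a :* (b :* x :+ y)) refl _ _ _ _ ⟩
    a * cutSum (node us ∷ ts) B ∎

  cutSum-sum : ∀ {A : Set} us (xs : List A) (f : A → List Tree → Carrier) →
               cutSum us (λ ls → sum xs (λ x → f x ls)) ≈ sum xs (λ x → cutSum us (f x))
  cutSum-sum us []       f = cutSum-0 us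
  cutSum-sum us (x ∷ xs) f = trans (cutSum-+ us _ _) (+-congˡ (cutSum-sum us xs f))

  cutSum-tri : ∀ us n (f : ℕ → ℕ → List Tree → Carrier) →
               cutSum us (λ ls → tri n (λ i j → f i j ls)) ≈ tri n (λ i j → cutSum us (f i j))
  cutSum-tri us zero    f = refl
  cutSum-tri us (suc n) f = trans (cutSum-+ us _ _) (+-congˡ (cutSum-tri us n _))

-- Generating series over plane forests and their common recursion

module ForestSeries {c ℓ} (S : CommutativeRing c ℓ) where
  open CommutativeRing S hiding (zero)
  open Sums S
  open PowerSeries S
  open SetoidReasoning setoid

  sum-triL : ∀ {A : Set} n (g : ℕ → ℕ → List A) f → sum (triL n g) f ≈ tri n (λ i j → sum (g i j) f)
  sum-triL zero    g f = refl
  sum-triL (suc n) g f = trans (sum-++ (g 0 (suc n)) _ f) (+-congˡ (sum-triL n _ f))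

  sum-forests-suc : ∀ n (f : List Tree → Carrier) → sum (forests (suc n)) f ≈
    tri n (λ i j → sum (forests i) (λ us → sum (forests j) (λ ts → f (node us ∷ ts))))
  sum-forests-suc n f = begin
    sum (forests (suc n)) f
      ≡⟨ ≡.cong (λ xs → sum xs f) (forests-suc n) ⟩
    sum (triL n (λ i j → cartesianProductWith graft (forests i) (forests j))) f
      ≈⟨ sum-triL n _ f ⟩
    tri n (λ i j → sum (cartesianProductWith graft (forests i) (forests j)) f)
      ≈⟨ tri-cong n (λ i j → sum-cartesianProductWith graft (forests i) (forests j) f) ⟩
    tri n (λ i j → sum (forests i) (λ us → sum (forests j) (λ ts → f (node us ∷ ts))))
      ∎

  -- gen Y = Σ_ts t^|ts| Y(ts)
  gen : (List Tree → Series) → Series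
  gen Y n = tri n (λ i j → sum (forests i) (λ ts → Y ts j))

  -- A forest is empty or consists of a root, the forest `us` below it and the remaining forest
  -- `ts`; the root accounts for the shift.
  gen-unfold : ∀ Y → gen Y ≋ Y [] ⊕ shift (gen (λ us → gen (λ ts → Y (node us ∷ ts))))
  gen-unfold Y zero    = refl
  gen-unfold Y (suc n) = begin
    (Y [] (suc n) + 0#) + tri n (λ k l → sum (forests (suc k)) (λ ts → Y ts l))
      ≈⟨ +-cong (+-identityʳ _) (tri-cong n (λ k l → sum-forests-suc k _)) ⟩
    Y [] (suc n) + tri n (λ k l → tri k (λ i j → sum (forests i) (λ us → sum (forests j) (λ ts → Y (node us ∷ ts) l))))
      ≈⟨ +-congˡ (tri-assoc n _) ⟩
    Y [] (suc n) + tri n (λ i m → tri m (λ j l → sum (forests i) (λ us → sum (forests j) (λ ts → Y (node us ∷ ts) l))))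
      ≈⟨ +-congˡ (tri-cong n (λ i m → tri-sum m (forests i) _)) ⟩
    Y [] (suc n) + gen (λ us → gen (λ ts → Y (node us ∷ ts))) n
      ∎

  gen-cong-≤ : ∀ {Y Z n} → (∀ ts → Y ts ≋[ n ] Z ts) → gen Y ≋[ n ] gen Z
  gen-cong-≤ h m m≤n = tri-cong-≡ m λ i j eq →
    sum-cong (forests i) (λ ts → h ts j (ℕ.≤-trans (summand-≤ʳ i j eq) m≤n))

  gen-cong : ∀ {Y Z} → (∀ ts → Y ts ≋ Z ts) → gen Y ≋ gen Z
  gen-cong h n = tri-cong n (λ i j → sum-cong (forests i) (λ ts → h ts j))

  gen-⊕ : ∀ Y Z → gen (λ ts → Y ts ⊕ Z ts) ≋ gen Y ⊕ gen Z
  gen-⊕ Y Z n = trans (tri-cong n (λ i j → sum-+ (forests i) _ _)) (tri-+ n _ _)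

  gen-⊗ : ∀ F Y → gen (λ ts → F ⊗ Y ts) ≋ F ⊗ gen Y
  gen-⊗ F Y n = begin
    tri n (λ i m → sum (forests i) (λ ts → tri m (λ a j → F a * Y ts j)))
      ≈⟨ tri-cong n (λ i m → tri-sum m (forests i) _) ⟨
    tri n (λ i m → tri m (λ a j → sum (forests i) (λ ts → F a * Y ts j)))
      ≈⟨ tri-assoc n _ ⟨
    tri n (λ k j → tri k (λ i a → sum (forests i) (λ ts → F a * Y ts j)))
      ≈⟨ tri-cong n (λ k j → tri-comm k _) ⟩
    tri n (λ k j → tri k (λ a i → sum (forests i) (λ ts → F a * Y ts j)))
      ≈⟨ tri-assoc n (λ a i j → sum (forests i) (λ ts → F a * Y ts j)) ⟩
    tri n (λ a m → tri m (λ i j → sum (forests i) (λ ts → F a * Y ts j)))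
      ≈⟨ tri-cong n (λ a m → tri-cong m (λ i j → *-distribˡ-sum (forests i) (F a) _)) ⟨
    tri n (λ a m → tri m (λ i j → F a * sum (forests i) (λ ts → Y ts j)))
      ≈⟨ tri-cong n (λ a m → *-distribˡ-tri m (F a) _) ⟨
    tri n (λ a m → F a * gen Y m)
      ∎

  gen-scaled : ∀ (s : List Tree → Carrier) F →
               gen (λ ts n → s ts * F n) ≋ (λ n → sum (forests n) s) ⊗ F
  gen-scaled s F n = tri-cong n (λ i j → sym (*-distribʳ-sum (forests i) (F j) s))

module PrunedForests {c ℓ} (S : CommutativeRing c ℓ)
  (α : Tree → CommutativeRing.Carrier S) (q̂ : ℕ → CommutativeRing.Carrier S) where
  open CommutativeRing S hiding (zero)
  open Sums S
  open PowerSeries S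
  open ForestSeries S
  open Cut S α
  open SetoidReasoning setoid
  private
    module P = CommutativeRing seriesRing
  open import Algebra.Solver.Ring.NaturalCoefficients.Default commutativeSemiring using (solve; _:=_; _:+_; _:*_)
  open import Algebra.Solver.Ring.NaturalCoefficients.Default P.commutativeSemiring using ()
    renaming (solve to solveₚ; _:=_ to _:=ₚ_; _:+_ to _:+ₚ_; _:*_ to _:*ₚ_)

  weight : List Tree → Carrier
  weight []             = 1#
  weight (node us ∷ ts) = (q̂ (length us) * weight us) * weight ts

  -- The coefficient of index n sums over the plane trees with n + 1 vertices: the power of t
  -- belonging to the root is left out, so that the substituted argument is g + t h.
  h : Series
  h n = sum (forests n) (λ us → α (node us) * (q̂ (length us) * weight us))

  open Substitution S h

  -- Only kept vertices are seen; `binSub` sums over all ways of attaching cut children to each of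
  -- them.
  composedWeight : List Tree → Series
  composedWeight []             = const 1#
  composedWeight (node us ∷ ts) = (binSub (length us) q̂ ⊗ composedWeight us) ⊗ composedWeight ts

  -- The forest is read as the children of a virtual parent weighted by `q`: in `pruned` at its full
  -- degree, in `composed` at its kept degree together with all possible cut children.
  pruned composed : (List Tree → Series) → (ℕ → Carrier) → Series
  pruned   B q = gen (λ ts n → (q (length ts) * weight ts) * cutSum ts (λ ks → B ks n))
  composed B q = gen (λ ks → (B ks ⊗ binSub (length ks) q) ⊗ composedWeight ks)

  -- Both sums solve Z = step Z, according to whether the first tree is cut, kept or absent.
  step : ((List Tree → Series) → (ℕ → Carrier) → Series) → (List Tree → Series) → (ℕ → Carrier) → Series
  step Z B q = const (q 0) ⊗ B [] ⊕ shift (h ⊗ Z B (tl q) ⊕ Z (λ ls → Z (λ ks → B (node ls ∷ ks)) (tl q)) q̂)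

  -- The first tree has weight `c′ us`. If it is cut, α times this weight sums to h; if it is kept,
  -- the prunings of `us` form an outer sum in which its root is weighted by `q̂`. Either way one
  -- child of the parent is used up, so `q` becomes `tl q`.
  pruned-step : ∀ B q → pruned B q ≋ step pruned B q
  pruned-step B q n = begin
    pruned B q n
      ≈⟨ gen-unfold _ n ⟩
    (q 0 * 1#) * B [] n + shift (gen (λ us → gen (λ ts → Y us ts))) n
      ≈⟨ +-cong (*-congʳ (*-identityʳ _)) (shift-cong rest n) ⟩
    q 0 * B [] n + shift (h ⊗ pruned B (tl q) ⊕ pruned (λ ls → pruned (λ ks → B (node ls ∷ ks)) (tl q)) q̂) n
      ≈⟨ +-congʳ (const-⊗ (q 0) (B []) n) ⟨
    step pruned B q n
      ∎
    where
    c′ : List Tree → Carrier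
    c′ us = q̂ (length us) * weight us

    Y : List Tree → List Tree → Series
    Y us ts n = (q (suc (length ts)) * (c′ us * weight ts)) *
                (α (node us) * cutSum ts (λ ks → B ks n) + cutSum us (λ ls → cutSum ts (λ ks → B (node ls ∷ ks) n)))

    cutPart keptPart : List Tree → List Tree → Series
    cutPart  us ts n = (tl q (length ts) * weight ts) * cutSum ts (λ ks → B ks n)
    keptPart us ts n = (tl q (length ts) * weight ts) * cutSum us (λ ls → cutSum ts (λ ks → B (node ls ∷ ks) n))

    split : ∀ us ts → Y us ts ≋ const (α (node us) * c′ us) ⊗ cutPart us ts ⊕ const (c′ us) ⊗ keptPart us ts
    split us ts n = begin
      Y us ts n
        ≈⟨ solve 6 (λ q c w a x y → (q :* (c :* w)) :* (a :* x :+ y) :=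
             (a :* c) :* ((q :* w) :* x) :+ c :* ((q :* w) :* y)) refl _ _ _ _ _ _ ⟩
      (α (node us) * c′ us) * cutPart us ts n + c′ us * keptPart us ts n
        ≈⟨ +-cong (const-⊗ _ (cutPart us ts) n) (const-⊗ _ (keptPart us ts) n) ⟨
      (const (α (node us) * c′ us) ⊗ cutPart us ts) n + (const (c′ us) ⊗ keptPart us ts) n
        ∎

    -- `cutSum us` is a finite linear combination of values of its test function, so it commutes
    -- with the sum over `ts`.
    kept : ∀ us → gen (keptPart us) ≋ λ n → cutSum us (λ ls → pruned (λ ks → B (node ls ∷ ks)) (tl q) n)
    kept us n = begin
      tri n (λ i j → sum (forests i) (λ ts → (tl q (length ts) * weight ts) * cutSum us (λ ls → C ls ts j)))
        ≈⟨ tri-cong n (λ i j → sum-cong (forests i) (λ ts → cutSum-scale us _ _)) ⟨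
      tri n (λ i j → sum (forests i) (λ ts → cutSum us (λ ls → (tl q (length ts) * weight ts) * C ls ts j)))
        ≈⟨ tri-cong n (λ i j → cutSum-sum us (forests i) _) ⟨
      tri n (λ i j → cutSum us (λ ls → sum (forests i) (λ ts → (tl q (length ts) * weight ts) * C ls ts j)))
        ≈⟨ cutSum-tri us n _ ⟨
      cutSum us (λ ls → pruned (λ ks → B (node ls ∷ ks)) (tl q) n)
        ∎
      where
      C : List Tree → List Tree → Series
      C ls ts j = cutSum ts (λ ks → B (node ls ∷ ks) j)

    inner : ∀ us → gen (Y us) ≋ (λ n → (α (node us) * c′ us) * pruned B (tl q) n) ⊕
              (λ n → c′ us * cutSum us (λ ls → pruned (λ ks → B (node ls ∷ ks)) (tl q) n))
    inner us n = begin
      gen (Y us) n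
        ≈⟨ gen-cong (split us) n ⟩
      gen (λ ts → const (α (node us) * c′ us) ⊗ cutPart us ts ⊕ const (c′ us) ⊗ keptPart us ts) n
        ≈⟨ gen-⊕ _ _ n ⟩
      gen (λ ts → const (α (node us) * c′ us) ⊗ cutPart us ts) n + gen (λ ts → const (c′ us) ⊗ keptPart us ts) n
        ≈⟨ +-cong (gen-⊗ _ (cutPart us) n) (gen-⊗ _ (keptPart us) n) ⟩
      (const (α (node us) * c′ us) ⊗ pruned B (tl q)) n + (const (c′ us) ⊗ gen (keptPart us)) n
        ≈⟨ +-cong (const-⊗ _ _ n) (trans (const-⊗ _ _ n) (*-congˡ (kept us n))) ⟩
      _ ∎

    rest : gen (λ us → gen (Y us)) ≋ h ⊗ pruned B (tl q) ⊕ pruned (λ ls → pruned (λ ks → B (node ls ∷ ks)) (tl q)) q̂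
    rest n = trans (gen-cong inner n) (trans (gen-⊕ _ _ n) (+-congʳ (gen-scaled _ (pruned B (tl q)) n)))

  -- Writing `shift` as multiplication by t turns the step equation into a polynomial identity for
  -- the ring solver.
  t : Series
  t = shift (const 1#)

  shift-t : ∀ F → shift F ≋ t ⊗ F
  shift-t F n = sym (trans (shift-⊗ (const 1#) F n) (shift-cong (⊗-identityˡ F) n))

  -- Cut trees do not occur in the kept forest, so a cut first child has to be extracted from the
  -- root weight: by `binSub-zero` if the kept forest is empty, by `binSub-suc` otherwise. The terms
  -- with factor t h then recombine to `composed B (tl q)`.
  composed-step : ∀ B q → composed B q ≋ step composed B q
  composed-step B q n = begin
    composed B q n
      ≈⟨ unfolded B q n ⟩
    ((B [] ⊗ binSub 0 q) ⊕ t ⊗ deeper B q) n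
      ≈⟨ P.+-cong (P.*-congˡ {B []} (P.trans (binSub-zero q) (P.+-congˡ (shift-t _)))) (P.*-congˡ {t} deeper-step) n ⟩
    (B [] ⊗ (const (q 0) ⊕ t ⊗ (h ⊗ binSub 0 (tl q))) ⊕ t ⊗ (next ⊕ t ⊗ (h ⊗ deeper B (tl q)))) n
      ≈⟨ solveₚ 7 (λ b q t h m d z → b :*ₚ (q :+ₚ t :*ₚ (h :*ₚ m)) :+ₚ t :*ₚ (z :+ₚ t :*ₚ (h :*ₚ d)) :=ₚ
           q :*ₚ b :+ₚ t :*ₚ (h :*ₚ (b :*ₚ m :+ₚ t :*ₚ d) :+ₚ z)) (λ _ → refl)
           (B []) (const (q 0)) t h (binSub 0 (tl q)) (deeper B (tl q)) next n ⟩
    (const (q 0) ⊗ B [] ⊕ t ⊗ (h ⊗ (B [] ⊗ binSub 0 (tl q) ⊕ t ⊗ deeper B (tl q)) ⊕ next)) n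
      ≈⟨ P.+-congˡ {const (q 0) ⊗ B []} (P.*-congˡ {t} (P.+-congʳ (P.*-congˡ {h} (unfolded B (tl q))))) n ⟨
    (const (q 0) ⊗ B [] ⊕ t ⊗ (h ⊗ composed B (tl q) ⊕ next)) n
      ≈⟨ P.+-congˡ {const (q 0) ⊗ B []} (shift-t _) n ⟨
    step composed B q n
      ∎
    where
    branch : (List Tree → Series) → (ℕ → Carrier) → ℕ → List Tree → List Tree → Series
    branch B q d us ts = (B (node us ∷ ts) ⊗ binSub d q) ⊗ composedWeight (node us ∷ ts)

    -- The contribution of the nonempty kept forests, without the factor t of their first root.
    deeper : (List Tree → Series) → (ℕ → Carrier) → Series
    deeper B q = gen (λ us → gen (λ ts → branch B q (suc (length ts)) us ts))

    next : Series
    next = composed (λ ls → composed (λ ks → B (node ls ∷ ks)) (tl q)) q̂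

    unfolded : ∀ B q → composed B q ≋ B [] ⊗ binSub 0 q ⊕ t ⊗ deeper B q
    unfolded B q = P.trans (gen-unfold _) (P.+-cong (P.*-identityʳ _) (shift-t _))

    branch-suc : ∀ us ts → branch B q (suc (length ts)) us ts ≋
      (binSub (length us) q̂ ⊗ composedWeight us) ⊗ ((B (node us ∷ ts) ⊗ binSub (length ts) (tl q)) ⊗ composedWeight ts)
      ⊕ (t ⊗ h) ⊗ branch B (tl q) (suc (length ts)) us ts
    branch-suc us ts = P.trans
      (P.*-congʳ (P.*-congˡ (P.trans (binSub-suc (length ts) q) (P.+-congˡ (shift-t _)))))
      (solveₚ 7 (λ b x t h y w v → (b :*ₚ (x :+ₚ t :*ₚ (h :*ₚ y))) :*ₚ (w :*ₚ v) :=ₚ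
         w :*ₚ ((b :*ₚ x) :*ₚ v) :+ₚ (t :*ₚ h) :*ₚ ((b :*ₚ y) :*ₚ (w :*ₚ v))) (λ _ → refl)
         (B (node us ∷ ts)) (binSub (length ts) (tl q)) t h (binSub (suc (length ts)) (tl q))
         (binSub (length us) q̂ ⊗ composedWeight us) (composedWeight ts))

    deeper-step : deeper B q ≋ next ⊕ t ⊗ (h ⊗ deeper B (tl q))
    deeper-step = P.trans
      (gen-cong (λ us → P.trans (gen-cong (branch-suc us))
        (P.trans (gen-⊕ _ _) (P.+-cong (P.trans (gen-⊗ _ _) (P.trans (P.*-comm _ _) (P.sym (P.*-assoc _ _ _)))) (gen-⊗ _ _)))))
      (P.trans (gen-⊕ _ _) (P.+-cong
        (P.refl {next})
        (P.trans (gen-⊗ (t ⊗ h) _) (P.*-assoc t h _))))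

  composed-cong-≤ : ∀ {B C q n} → (∀ ks → B ks ≋[ n ] C ks) → composed B q ≋[ n ] composed C q
  composed-cong-≤ {B} {C} {q} {n} p = gen-cong-≤ λ ks m m≤n →
    trans (P.*-assoc (B ks) (binSub (length ks) q) (composedWeight ks) m)
    (trans (P.*-comm (B ks) (binSub (length ks) q ⊗ composedWeight ks) m)
    (trans (⊗-congˡ-≤ (binSub (length ks) q ⊗ composedWeight ks) (p ks) m m≤n)
    (trans (P.*-comm (binSub (length ks) q ⊗ composedWeight ks) (C ks) m)
    (sym (P.*-assoc (C ks) (binSub (length ks) q) (composedWeight ks) m)))))

  -- Both sides are fixed points of `step`, in which every recursive occurrence stands under
  -- `shift`; the induction on the order treats all `B` and `q` simultaneously.
  pruned-composed : ∀ B q → pruned B q ≋ composed B q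
  pruned-composed B q n = up-to n B q n ℕ.≤-refl
    where
    up-to : ∀ n B q → pruned B q ≋[ n ] composed B q
    -- The case of an absent first child is the same on both sides. The part under `shift` vanishes
    -- at order 0 and otherwise needs agreement to order n - 1.
    up-to n B q m m≤n = trans (pruned-step B q m) (trans (+-congˡ (tail n m m≤n)) (sym (composed-step B q m)))
      where
      rest : ((List Tree → Series) → (ℕ → Carrier) → Series) → Series
      rest Z = h ⊗ Z B (tl q) ⊕ Z (λ ls → Z (λ ks → B (node ls ∷ ks)) (tl q)) q̂

      tail : ∀ n → shift (rest pruned) ≋[ n ] shift (rest composed)
      tail zero    .0 z≤n = refl
      tail (suc n) = shift-cong-≤ λ m m≤n → +-cong
        (⊗-congˡ-≤ h (up-to n B (tl q)) m m≤n)
        -- The outer sum is converted first, with a test function that still contains the inner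
        -- `pruned`; the inner one is then converted inside `composed`.
        (trans (up-to n _ q̂ m m≤n)
               (composed-cong-≤ {q = q̂} (λ ls → up-to n (λ ks → B (node ls ∷ ks)) (tl q)) m m≤n))

-- Labelled trees and their plane orderings

module _ where
  open ≡ using (refl; sym; trans)
  open import Data.Nat using (_+_; _*_; _<_)

  ∈-concatMap⁺′ : ∀ {A B : Set} (f : A → List B) {x y xs} → x ∈ xs → y ∈ f x → y ∈ concatMap f xs
  ∈-concatMap⁺′ f x∈ y∈ = ∈-concatMap⁺ f (lose x∈ y∈)

  ∈-concatMap⁻′ : ∀ {A B : Set} (f : A → List B) xs {y} → y ∈ concatMap f xs → ∃ λ x → x ∈ xs × y ∈ f x
  ∈-concatMap⁻′ f xs y∈ = find (∈-concatMap⁻ f {xs} y∈)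

  ∉⇒All≢ : ∀ {A : Set} {x : A} xs → x ∉ xs → All (x ≢_) xs
  ∉⇒All≢ xs x∉ = All.tabulate (λ { y∈ refl → x∉ y∈ })

  module _ {A : Set} where

    unique-↭ : ∀ {xs ys : List A} → xs ↭ ys → Unique xs → Unique ys
    unique-↭ Perm.refl         u                       = u
    unique-↭ (Perm.prep x p)   (x≢ ∷ u)                = All-resp-↭ p x≢ ∷ unique-↭ p u
    unique-↭ (Perm.swap x y p) ((x≢y ∷ x≢) ∷ y≢ ∷ u)   =
      ((λ eq → x≢y (sym eq)) ∷ All-resp-↭ p y≢) ∷ All-resp-↭ p x≢ ∷ unique-↭ p u
    unique-↭ (Perm.trans p q)  u                       = unique-↭ q (unique-↭ p u)

    -- The tool for the bijective counts below: to exchange two enumerations it suffices that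
    -- neither repeats an entry and that membership agrees.
    unique⇒↭ : ∀ {xs ys : List A} → Unique xs → Unique ys →
               (∀ {z} → z ∈ xs → z ∈ ys) → (∀ {z} → z ∈ ys → z ∈ xs) → xs ↭ ys
    unique⇒↭ {[]}     {[]}     u v f g = ↭-refl
    unique⇒↭ {[]}     {y ∷ ys} u v f g with () ← g (here refl)
    unique⇒↭ {x ∷ xs} {ys}     u@(_ ∷ u′) v f g with as , bs , refl ← ∈-∃++ (f (here refl)) =
      ↭-trans (prep x (unique⇒↭ u′ (tail v′) f′ g′)) (↭-sym (Perm.shift x as bs))
      where
      v′ : Unique (x ∷ as ++ bs)
      v′ = unique-↭ (Perm.shift x as bs) v

      tail : ∀ {z zs} → Unique {A = A} (z ∷ zs) → Unique zs
      tail (_ ∷ w) = w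

      f′ : ∀ {z} → z ∈ xs → z ∈ as ++ bs
      f′ z∈ with ∈-resp-↭ (Perm.shift x as bs) (f (there z∈))
      ... | here refl = ⊥-elim (Unique.Unique[x∷xs]⇒x∉xs u z∈)
      ... | there z∈′ = z∈′

      g′ : ∀ {z} → z ∈ as ++ bs → z ∈ xs
      g′ z∈ with g (∈-resp-↭ (↭-sym (Perm.shift x as bs)) (there z∈))
      ... | here refl = ⊥-elim (Unique.Unique[x∷xs]⇒x∉xs v′ z∈)
      ... | there z∈′ = z∈′

  unique-++⁻ : ∀ {A : Set} (as : List A) {bs} → Unique (as ++ bs) →
               Unique as × Unique bs × (∀ {x} → x ∈ as → x ∉ bs)
  unique-++⁻ []       v = [] , v , λ ()
  unique-++⁻ (a ∷ as) v@(_ ∷ v′) with u , w , d ← unique-++⁻ as v′ =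
    ∉⇒All≢ as (λ a∈ → a∉ (∈-++⁺ˡ a∈)) ∷ u , w ,
    λ { (here refl) x∈ → a∉ (∈-++⁺ʳ as x∈) ; (there x∈) → d x∈ }
    where a∉ = Unique.Unique[x∷xs]⇒x∉xs v

  module _ {A B : Set} where

    unique-map-∈ : ∀ {f : A → B} {xs} → Unique xs →
                   (∀ {x y} → x ∈ xs → y ∈ xs → f x ≡ f y → x ≡ y) → Unique (map f xs)
    unique-map-∈ []       inj = []
    unique-map-∈ {f} {x ∷ xs} u@(x≢ ∷ u′) inj =
      ∉⇒All≢ _ (λ fx∈ → let y , y∈ , eq = ∈-map⁻ f fx∈ in
        Unique.Unique[x∷xs]⇒x∉xs u (subst (_∈ xs) (sym (inj (here refl) (there y∈) eq)) y∈))
      ∷ unique-map-∈ u′ (λ p q → inj (there p) (there q))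

    unique-concatMap : ∀ {f : A → List B} {xs} → Unique xs → (∀ {x} → x ∈ xs → Unique (f x)) →
                       (∀ {x y z} → x ∈ xs → y ∈ xs → z ∈ f x → z ∈ f y → x ≡ y) → Unique (concatMap f xs)
    unique-concatMap []       v d = []
    unique-concatMap {f} {x ∷ xs} u@(x≢ ∷ u′) v d =
      Unique.++⁺ (v (here refl)) (unique-concatMap u′ (λ p → v (there p)) (λ p q → d (there p) (there q)))
        λ { (z∈ , z∈′) → let y , y∈ , z∈fy = ∈-concatMap⁻′ f xs z∈′ in
          Unique.Unique[x∷xs]⇒x∉xs u (subst (_∈ xs) (sym (d (here refl) (there y∈) z∈ z∈fy)) y∈) }

    length-concatMap : ∀ (f : A → List B) xs {k} → (∀ {x} → x ∈ xs → length (f x) ≡ k) →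
                       length (concatMap f xs) ≡ length xs * k
    length-concatMap f []       h = refl
    length-concatMap f (x ∷ xs) h =
      trans (length-++ (f x)) (cong₂ _+_ (h (here refl)) (length-concatMap f xs (λ x∈ → h (there x∈))))

  module _ {A : Set} where

    insertions : A → List A → List (List A)
    insertions x []       = [ [ x ] ]
    insertions x (y ∷ ys) = (x ∷ y ∷ ys) ∷ map (y ∷_) (insertions x ys)

    perms : List A → List (List A)
    perms []       = [ [] ]
    perms (x ∷ xs) = concatMap (insertions x) (perms xs)

    ∈-insertions⁺ : ∀ x as bs → as ++ x ∷ bs ∈ insertions x (as ++ bs)
    ∈-insertions⁺ x []       []       = here refl
    ∈-insertions⁺ x []       (b ∷ bs) = here refl
    ∈-insertions⁺ x (a ∷ as) bs       = there (∈-map⁺ (a ∷_) (∈-insertions⁺ x as bs))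

    ∈-insertions⁻ : ∀ x ys {zs} → zs ∈ insertions x ys → zs ↭ x ∷ ys
    ∈-insertions⁻ x []       (here refl) = ↭-refl
    ∈-insertions⁻ x (y ∷ ys) (here refl) = ↭-refl
    ∈-insertions⁻ x (y ∷ ys) (there zs∈) with ws , ws∈ , refl ← ∈-map⁻ (y ∷_) zs∈ =
      ↭-trans (prep y (∈-insertions⁻ x ys ws∈)) (Perm.swap y x ↭-refl)

    ∈-perms⁺ : ∀ xs {ys} → ys ↭ xs → ys ∈ perms xs
    ∈-perms⁺ []       p with refl ← ↭-empty-inv p = here refl
    ∈-perms⁺ (x ∷ xs) p with as , bs , refl ← ∈-∃++ (∈-resp-↭ (↭-sym p) (here refl)) =
      ∈-concatMap⁺′ (insertions x) (∈-perms⁺ xs (drop-∷ (↭-trans (↭-sym (Perm.shift x as bs)) p))) (∈-insertions⁺ x as bs)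

    ∈-perms⁻ : ∀ xs {ys} → ys ∈ perms xs → ys ↭ xs
    ∈-perms⁻ []       (here refl) = ↭-refl
    ∈-perms⁻ (x ∷ xs) ys∈ with zs , zs∈ , ys∈′ ← ∈-concatMap⁻′ (insertions x) (perms xs) ys∈ =
      ↭-trans (∈-insertions⁻ x zs ys∈′) (prep x (∈-perms⁻ xs zs∈))

    length-insertions : ∀ x ys → length (insertions x ys) ≡ suc (length ys)
    length-insertions x []       = refl
    length-insertions x (y ∷ ys) = cong suc (trans (length-map (y ∷_) (insertions x ys)) (length-insertions x ys))

    length-perms : ∀ xs → length (perms xs) ≡ length xs !
    length-perms []       = refl
    length-perms (x ∷ xs) = trans
      (length-concatMap (insertions x) (perms xs) (λ {ys} ys∈ →
        trans (length-insertions x ys) (cong suc (↭-length (∈-perms⁻ xs ys∈)))))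
      (trans (cong (_* suc (length xs)) (length-perms xs)) (ℕ.*-comm (length xs !) _))

    insertions-unique : ∀ x ys → x ∉ ys → Unique (insertions x ys)
    insertions-unique x []       x∉ = [] ∷ []
    insertions-unique x (y ∷ ys) x∉ =
      ∉⇒All≢ _ (λ p → x∉ (head∈ p)) ∷ Unique.map⁺ ∷-injectiveʳ (insertions-unique x ys (λ p → x∉ (there p)))
      where
      head∈ : x ∷ y ∷ ys ∈ map (y ∷_) (insertions x ys) → x ∈ y ∷ ys
      head∈ p with _ , _ , refl ← ∈-map⁻ (y ∷_) p = here refl

    insertions-disjoint : ∀ x ys {ys′ zs} → x ∉ ys → x ∉ ys′ →
                          zs ∈ insertions x ys → zs ∈ insertions x ys′ → ys ≡ ys′
    insertions-disjoint x []       {[]}      p q r s = refl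
    insertions-disjoint x []       {y ∷ ys′} p q (here refl) (there s)
      with _ , _ , refl ← ∈-map⁻ (y ∷_) s = ⊥-elim (q (here refl))
    insertions-disjoint x (y ∷ ys) {[]}      p q (there r) (here refl)
      with _ , _ , refl ← ∈-map⁻ (y ∷_) r = ⊥-elim (p (here refl))
    insertions-disjoint x (y ∷ ys) {z ∷ zs}  p q (here refl) (here refl) = refl
    insertions-disjoint x (y ∷ ys) {z ∷ zs}  p q (here refl) (there s)
      with _ , _ , refl ← ∈-map⁻ (z ∷_) s = ⊥-elim (q (here refl))
    insertions-disjoint x (y ∷ ys) {z ∷ zs}  p q (there r) (here refl)
      with _ , _ , refl ← ∈-map⁻ (y ∷_) r = ⊥-elim (p (here refl))
    insertions-disjoint x (y ∷ ys) {z ∷ zs}  p q (there r) (there s)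
      with vs , r′ , refl ← ∈-map⁻ (y ∷_) r
      with _ , s′ , refl ← ∈-map⁻ (z ∷_) s
      = cong (y ∷_) (insertions-disjoint x ys (λ x∈ → p (there x∈)) (λ x∈ → q (there x∈)) r′ s′)

    perms-unique : ∀ {xs} → Unique xs → Unique (perms xs)
    perms-unique {[]}     u = [] ∷ []
    perms-unique {x ∷ xs} u@(_ ∷ u′) = unique-concatMap (perms-unique u′)
      (λ {ys} ys∈ → insertions-unique x ys (x∉ ys∈))
      (λ p q → insertions-disjoint x _ (x∉ p) (x∉ q))
      where
      x∉ : ∀ {ys} → ys ∈ perms xs → x ∉ ys
      x∉ ys∈ x∈ = Unique.Unique[x∷xs]⇒x∉xs u (∈-resp-↭ (∈-perms⁻ xs ys∈) x∈)

  module _ {n : ℕ} {B : Set} where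

    assoc : List (Fin n × B) → Fin n → Maybe B
    assoc []             k = nothing
    assoc ((i , b) ∷ xs) k with i Fin.≟ k
    ... | yes _ = just b
    ... | no  _ = assoc xs k

    assoc-∈ : ∀ xs {k b} → assoc xs k ≡ just b → (k , b) ∈ xs
    assoc-∈ ((i , b) ∷ xs) {k} eq with i Fin.≟ k
    ... | yes refl with refl ← eq = here refl
    ... | no  _    = there (assoc-∈ xs eq)

    ∈-assoc : ∀ xs {k b} → Unique (map proj₁ xs) → (k , b) ∈ xs → assoc xs k ≡ just b
    ∈-assoc ((i , b) ∷ xs) {k} u@(_ ∷ u′) k∈ with i Fin.≟ k | k∈
    ... | yes refl | here refl = refl
    ... | yes refl | there k∈′ = ⊥-elim (Unique.Unique[x∷xs]⇒x∉xs u (∈-map⁺ proj₁ k∈′))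
    ... | no  i≢k  | here refl = ⊥-elim (i≢k refl)
    ... | no  _    | there k∈′ = ∈-assoc xs u′ k∈′

  data Plane (A : Set) : Set where
    branch : A → List (Plane A) → Plane A

  module _ {A : Set} where

    rootOf : Plane A → A
    rootOf (branch l _) = l

    roots : List (Plane A) → List A
    roots = map rootOf

    labelsF : List (Plane A) → List A
    labelsF []                 = []
    labelsF (branch l xs ∷ ys) = (l ∷ labelsF xs) ++ labelsF ys

    labels : Plane A → List A
    labels (branch l xs) = l ∷ labelsF xs

    shapeF : List (Plane A) → List Tree
    shapeF []                 = []
    shapeF (branch l xs ∷ ys) = node (shapeF xs) ∷ shapeF ys

    shape : Plane A → Tree
    shape (branch l xs) = node (shapeF xs)

    length-labelsF : ∀ xs → length (labelsF xs) ≡ sizeF (shapeF xs)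
    length-labelsF []                 = refl
    length-labelsF (branch l xs ∷ ys) = cong suc
      (trans (length-++ (labelsF xs)) (cong₂ _+_ (length-labelsF xs) (length-labelsF ys)))

    length-labels : ∀ x → length (labels x) ≡ sizeT (shape x)
    length-labels (branch l xs) = cong suc (length-labelsF xs)

    length-shapeF : ∀ xs → length (shapeF xs) ≡ length xs
    length-shapeF []                 = refl
    length-shapeF (branch l xs ∷ ys) = cong suc (length-shapeF ys)

    -- Labels are assigned in preorder; lists that are too short give junk.
    fillF : List Tree → List A → List (Plane A)
    fillF []             ls       = []
    fillF (node us ∷ ts) []       = []
    fillF (node us ∷ ts) (l ∷ ls) = branch l (fillF us (take (sizeF us) ls)) ∷ fillF ts (drop (sizeF us) ls)

    -- The label `d` is a placeholder for an empty list of labels, which does not occur when the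
    -- length matches the size.
    fill : A → Tree → List A → Plane A
    fill d (node us) []       = branch d []
    fill d (node us) (l ∷ ls) = branch l (fillF us ls)

    length-take-+ : ∀ m {n} (ls : List A) → length ls ≡ m + n → length (take m ls) ≡ m
    length-take-+ m ls eq = trans (length-take m ls) (ℕ.m≤n⇒m⊓n≡m (ℕ.≤-trans (ℕ.m≤m+n m _) (ℕ.≤-reflexive (sym eq))))

    length-drop-+ : ∀ m {n} (ls : List A) → length ls ≡ m + n → length (drop m ls) ≡ n
    length-drop-+ m {n} ls eq = trans (length-drop m ls) (trans (cong (Data.Nat._∸ m) eq) (ℕ.m+n∸m≡n m n))

    shapeF-fillF : ∀ ts ls → length ls ≡ sizeF ts → shapeF (fillF ts ls) ≡ ts
    shapeF-fillF []             ls       eq = refl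
    shapeF-fillF (node us ∷ ts) (l ∷ ls) eq = cong₂ (λ vs ws → node vs ∷ ws)
      (shapeF-fillF us (take (sizeF us) ls) (length-take-+ (sizeF us) ls (ℕ.suc-injective eq)))
      (shapeF-fillF ts (drop (sizeF us) ls) (length-drop-+ (sizeF us) ls (ℕ.suc-injective eq)))

    labelsF-fillF : ∀ ts ls → length ls ≡ sizeF ts → labelsF (fillF ts ls) ≡ ls
    labelsF-fillF []             []       eq = refl
    labelsF-fillF (node us ∷ ts) (l ∷ ls) eq = cong (l ∷_) (trans
      (cong₂ _++_
        (labelsF-fillF us (take (sizeF us) ls) (length-take-+ (sizeF us) ls (ℕ.suc-injective eq)))
        (labelsF-fillF ts (drop (sizeF us) ls) (length-drop-+ (sizeF us) ls (ℕ.suc-injective eq))))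
      (take++drop≡id (sizeF us) ls))

    take-length-++ : ∀ (xs ys : List A) → take (length xs) (xs ++ ys) ≡ xs
    take-length-++ []       ys = refl
    take-length-++ (x ∷ xs) ys = cong (x ∷_) (take-length-++ xs ys)

    drop-length-++ : ∀ (xs ys : List A) → drop (length xs) (xs ++ ys) ≡ ys
    drop-length-++ []       ys = refl
    drop-length-++ (x ∷ xs) ys = drop-length-++ xs ys

    fillF-shapeF : ∀ xs → fillF (shapeF xs) (labelsF xs) ≡ xs
    fillF-shapeF []                 = refl
    fillF-shapeF (branch l xs ∷ ys) rewrite sym (length-labelsF xs) = cong₂ (λ vs ws → branch l vs ∷ ws)
      (trans (cong (fillF (shapeF xs)) (take-length-++ (labelsF xs) (labelsF ys))) (fillF-shapeF xs))
      (trans (cong (fillF (shapeF ys)) (drop-length-++ (labelsF xs) (labelsF ys))) (fillF-shapeF ys))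

    fill-shape : ∀ d x → fill d (shape x) (labels x) ≡ x
    fill-shape d (branch l xs) = cong (branch l) (fillF-shapeF xs)

    shape-fill : ∀ d t ls → length ls ≡ sizeT t → shape (fill d t ls) ≡ t
    shape-fill d (node us) (l ∷ ls) eq = cong node (shapeF-fillF us ls (ℕ.suc-injective eq))

    labels-fill : ∀ d t ls → length ls ≡ sizeT t → labels (fill d t ls) ≡ ls
    labels-fill d (node us) (l ∷ ls) eq = cong (l ∷_) (labelsF-fillF us ls (ℕ.suc-injective eq))

    roots⊆labelsF : ∀ {l} xs → l ∈ roots xs → l ∈ labelsF xs
    roots⊆labelsF (branch _ xs ∷ ys) (here refl) = here refl
    roots⊆labelsF (branch _ xs ∷ ys) (there l∈)  = ∈-++⁺ʳ (_ ∷ labelsF xs) (roots⊆labelsF ys l∈)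

  unique-length-≤ : ∀ {n} {xs : List (Fin n)} → Unique xs → length xs ≤ n
  unique-length-≤ {n} {xs} u = begin
    length xs                            ≡⟨ ↭-length (unique⇒↭ (Unique.filter⁺ (_∈? xs) (Unique.allFin⁺ n)) u
                                              (λ z∈ → proj₂ (∈-filter⁻ (_∈? xs) {xs = allFin n} z∈))
                                              (λ z∈ → ∈-filter⁺ (_∈? xs) (∈-allFin _) z∈)) ⟨
    length (filter (_∈? xs) (allFin n))  ≤⟨ length-filter (_∈? xs) (allFin n) ⟩
    length (allFin n)                    ≡⟨ length-tabulate (λ i → i) ⟩
    n                                    ∎
    where
    open ℕ.≤-Reasoning
    open DecMembership (Fin._≟_ {n}) using (_∈?_)

  module _ {n : ℕ} (p : Parent n) where

    children : Fin n → List (Fin n)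
    children j = filter (λ i → lookup p i ≟M just j) (allFin n)

    ∈-children⁺ : ∀ {j k} → lookup p k ≡ just j → k ∈ children j
    ∈-children⁺ {j} eq = ∈-filter⁺ (λ i → lookup p i ≟M just j) (∈-allFin _) eq

    ∈-children⁻ : ∀ {j k} → k ∈ children j → lookup p k ≡ just j
    ∈-children⁻ {j} k∈ = proj₂ (∈-filter⁻ (λ i → lookup p i ≟M just j) {xs = allFin n} k∈)

    children-unique : ∀ j → Unique (children j)
    children-unique j = Unique.filter⁺ (λ i → lookup p i ≟M just j) (Unique.allFin⁺ n)

    -- The forest consists of full subtrees of p, with the children of each vertex in some order.
    data Real : List (Plane (Fin n)) → Set where
      []   : Real []
      cons : ∀ {l xs ys} → roots xs ↭ children l → Real xs → Real ys → Real (branch l xs ∷ ys)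

    data Depth (r : Fin n) : ℕ → Fin n → Set where
      zero : Depth r 0 r
      suc  : ∀ {d j k} → lookup p k ≡ just j → Depth r d j → Depth r (suc d) k

    depth-trans : ∀ {r d k e i} → Depth r d k → Depth k e i → Depth r (e + d) i
    depth-trans D zero       = D
    depth-trans D (suc eq E) = suc eq (depth-trans D E)

    ancestor-unique : ∀ {k k′ e i} → Depth k e i → Depth k′ e i → k ≡ k′
    ancestor-unique zero       zero        = refl
    ancestor-unique (suc eq D) (suc eq′ E) with refl ← just-injective (trans (sym eq) eq′) = ancestor-unique D E

    depth-labels : ∀ {xs i} → Real xs → i ∈ labelsF xs → ∃ λ k → k ∈ roots xs × ∃ λ e → Depth k e i
    depth-labels (cons {l} {xs} c R S) i∈ with ∈-++⁻ (l ∷ labelsF xs) i∈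
    ... | inj₁ (here refl) = l , here refl , 0 , zero
    ... | inj₁ (there i∈′) with k , k∈ , e , D ← depth-labels R i∈′ =
      l , here refl , e + 1 , depth-trans (suc (∈-children⁻ (∈-resp-↭ c k∈)) zero) D
    ... | inj₂ i∈′ with k , k∈ , e , D ← depth-labels S i∈′ = k , there k∈ , e , D

    labels-closed : ∀ {xs j k} → Real xs → j ∈ labelsF xs → lookup p k ≡ just j → k ∈ labelsF xs
    labels-closed (cons {l} {xs} c R S) j∈ eq with ∈-++⁻ (l ∷ labelsF xs) j∈
    ... | inj₁ (here refl) = ∈-++⁺ˡ (there (roots⊆labelsF xs (∈-resp-↭ (↭-sym c) (∈-children⁺ eq))))
    ... | inj₁ (there j∈′) = ∈-++⁺ˡ (there (labels-closed R j∈′ eq))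
    ... | inj₂ j∈′         = ∈-++⁺ʳ (l ∷ labelsF xs) (labels-closed S j∈′ eq)

    labels-complete : ∀ {l xs i d} → Real (branch l xs ∷ []) → Depth l d i → i ∈ labelsF (branch l xs ∷ [])
    labels-complete R zero       = here refl
    labels-complete R (suc eq D) = labels-closed R (labels-complete R D) eq

    module _ {r : Fin n} (root : lookup p r ≡ nothing) where

      depth-unique : ∀ {d e i} → Depth r d i → Depth r e i → d ≡ e
      depth-unique zero       zero        = refl
      depth-unique zero       (suc eq E)  with () ← trans (sym root) eq
      depth-unique (suc eq D) zero        with () ← trans (sym root) eq
      depth-unique (suc eq D) (suc eq′ E) with refl ← just-injective (trans (sym eq) eq′) = cong suc (depth-unique D E)

      -- All roots lie at the same depth d. A label repeated below itself would have two depths; a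
      -- label shared by two trees would have both roots as ancestors at the same distance, so the
      -- roots would coincide.
      labels-unique : ∀ {d xs} → Real xs → Unique (roots xs) → (∀ {k} → k ∈ roots xs → Depth r d k) → Unique (labelsF xs)
      labels-unique []                        u       D = []
      labels-unique {d} (cons {l} {xs} {ys} c R S) u@(_ ∷ u′) D =
        Unique.++⁺ (∉⇒All≢ _ l∉ ∷ labels-unique R (unique-↭ (↭-sym c) (children-unique l)) (λ k∈ → suc (parent-of k∈) (D (here refl))))
                   (labels-unique S u′ (λ k∈ → D (there k∈)))
                   λ { (i∈ , i∈′) → disjoint i∈ i∈′ }
        where
        parent-of : ∀ {k} → k ∈ roots xs → lookup p k ≡ just l
        parent-of k∈ = ∈-children⁻ (∈-resp-↭ c k∈)

        l∉ : l ∉ labelsF xs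
        l∉ l∈ with k , k∈ , e , E ← depth-labels R l∈ =
          ℕ.m≢1+n+m d (trans (depth-unique (D (here refl)) (depth-trans (suc (parent-of k∈) (D (here refl))) E)) (ℕ.+-suc e d))

        disjoint : ∀ {i} → i ∈ l ∷ labelsF xs → i ∈ labelsF ys → ⊥
        disjoint i∈ i∈′
          with k , here refl , e , E ← depth-labels (cons {ys = []} c R []) (∈-++⁺ˡ i∈)
          with k′ , k′∈ , e′ , E′ ← depth-labels S i∈′
          with refl ← ℕ.+-cancelʳ-≡ d e e′ (depth-unique (depth-trans (D (here refl)) E) (depth-trans (D (there k′∈)) E′))
          with refl ← ancestor-unique E E′
          = Unique.Unique[x∷xs]⇒x∉xs u k′∈

    open DecMembership (Fin._≟_ {n}) using (_∈?_)

    module _ {r : Fin n} (acyclic : Acyclic p r) where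

      -- Since no nonempty set avoiding r is closed, a set containing r that is not everything
      -- has a child outside of it, and can be enlarged.
      explore : ∀ s (V : List (Fin n)) → r ∈ V → Unique V → length V + s ≡ n →
                (∀ {i} → i ∈ V → ∃ λ d → d < length V × Depth r d i) → ∀ i → ∃ λ d → d < n × Depth r d i
      explore s V r∈V u eq D i with all? (_∈? V)
      ... | yes all = let d , d< , E = D (all i) in
        d , ℕ.<-≤-trans d< (ℕ.≤-trans (ℕ.m≤m+n _ s) (ℕ.≤-reflexive eq)) , E
      ... | no ¬all with any? (λ k → ¬? (k ∈? V) ×-dec any? (λ j → (lookup p k ≟M just j) ×-dec (j ∈? V)))
      ...   | no ¬boundary = ⊥-elim (acyclic (S , nonempty , r∉S , closed))
        where
        S : Subset.Subset n
        S = tabulate (λ k → does (¬? (k ∈? V)))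

        ∈S⁻ : ∀ {k} → k Subset.∈ S → k ∉ V
        ∈S⁻ {k} k∈S with k ∈? V | trans (sym (lookup∘tabulate (λ k → does (¬? (k ∈? V))) k)) ([]=⇒lookup k∈S)
        ... | no k∉V | _ = k∉V

        ∈S⁺ : ∀ {k} → k ∉ V → k Subset.∈ S
        ∈S⁺ {k} k∉V = lookup⇒[]= k S (trans (lookup∘tabulate _ k) does-true)
          where
          does-true : does (¬? (k ∈? V)) ≡ Subset.inside
          does-true with k ∈? V
          ... | yes k∈V = ⊥-elim (k∉V k∈V)
          ... | no  _   = refl

        nonempty : Subset.Nonempty S
        nonempty with k , k∉V ← Fin.¬∀⟶∃¬ n (_∈ V) (_∈? V) ¬all = k , ∈S⁺ k∉V

        r∉S : r Subset.∉ S
        r∉S r∈S = ∈S⁻ r∈S r∈V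

        closed : ClosedUnder p S
        closed k k∈S j eq = ∈S⁺ (λ j∈V → ¬boundary (k , ∈S⁻ k∈S , j , eq , j∈V))
      -- The argument `s` counts the vertices not yet in V; with none left, `k ∷ V` would consist of
      -- n + 1 distinct elements of `Fin n`.
      explore zero    V r∈V u eq D i | no _ | yes (k , k∉V , _) =
        ⊥-elim (ℕ.<-irrefl (trans (sym (ℕ.+-identityʳ _)) eq) (unique-length-≤ (∉⇒All≢ V k∉V ∷ u)))
      explore (suc s) V r∈V u eq D i | no _ | yes (k , k∉V , j , k→j , j∈V) =
        explore s (k ∷ V) (there r∈V) (∉⇒All≢ V k∉V ∷ u) (trans (sym (ℕ.+-suc _ s)) eq) D′ i
        where
        D′ : ∀ {i} → i ∈ k ∷ V → ∃ λ d → d < suc (length V) × Depth r d i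
        D′ (here refl) = let d , d< , E = D j∈V in suc d , s≤s d< , suc k→j E
        D′ (there i∈)  = let d , d< , E = D i∈ in d , ℕ.m<n⇒m<1+n d< , E

      -- The strict bound by n is what makes fuel n sufficient for `orders`.
      bounded-depth : ∀ i → ∃ λ d → d < n × Depth r d i
      bounded-depth i = explore (n ℕ.∸ 1) (r ∷ []) (here refl) ([] ∷ []) (pos r)
        (λ { (here refl) → 0 , s≤s z≤n , zero }) i
        where
        pos : ∀ {m} → Fin m → 1 + (m ℕ.∸ 1) ≡ m
        pos {suc m} _ = refl

  lookup-ext : ∀ {A : Set} {n} {v w : Vec A n} → (∀ i → lookup v i ≡ lookup w i) → v ≡ w
  lookup-ext {v = v} {w} h = trans (sym (tabulate∘lookup v)) (trans (tabulate-cong h) (tabulate∘lookup w))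

  module _ {n : ℕ} (p : Parent n) where

    sequence : (Fin n → List (Plane (Fin n))) → List (Fin n) → List (List (Plane (Fin n)))
    sequence f []       = [ [] ]
    sequence f (k ∷ ks) = cartesianProductWith _∷_ (f k) (sequence f ks)

    -- the plane orderings of the subtree of p at j
    orders : ℕ → Fin n → List (Plane (Fin n))
    orders zero    j = []
    orders (suc f) j = map (branch j) (concatMap (sequence (orders f)) (perms (children p j)))

    ∈-orders⁻ : ∀ f {j x} → x ∈ orders f j → rootOf x ≡ j × Real p [ x ]
    ∈-sequence⁻ : ∀ f ks {xs} → xs ∈ sequence (orders f) ks → roots xs ≡ ks × Real p xs

    ∈-orders⁻ (suc f) {j} x∈
      with xs , xs∈ , refl ← ∈-map⁻ (branch j) x∈
      with ks , ks∈ , xs∈′ ← ∈-concatMap⁻′ (sequence (orders f)) (perms (children p j)) xs∈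
      with refl , R ← ∈-sequence⁻ f ks xs∈′
      = refl , cons (∈-perms⁻ (children p j) ks∈) R []

    ∈-sequence⁻ f []       (here refl) = refl , []
    ∈-sequence⁻ f (k ∷ ks) xs∈
      with x , xs , x∈ , xs∈′ , refl ← ∈-cartesianProductWith⁻ _∷_ (orders f k) (sequence (orders f) ks) xs∈
      with ∈-orders⁻ f x∈ | ∈-sequence⁻ f ks xs∈′
    ... | refl , cons c R [] | refl , S = refl , cons c R S

    ∈-orders⁺ : ∀ f {l xs} → roots xs ↭ children p l → Real p xs → suc (sizeF (shapeF xs)) ≤ f → branch l xs ∈ orders f l
    ∈-sequence⁺ : ∀ f {xs} → Real p xs → sizeF (shapeF xs) ≤ f → xs ∈ sequence (orders f) (roots xs)

    ∈-orders⁺ (suc f) {l} c R (s≤s p≤) = ∈-map⁺ (branch l)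
      (∈-concatMap⁺′ (sequence (orders f)) (∈-perms⁺ (children p l) c) (∈-sequence⁺ f R p≤))

    ∈-sequence⁺ f []           p≤ = here refl
    ∈-sequence⁺ f (cons c R S) p≤ = ∈-cartesianProductWith⁺ _∷_
      (∈-orders⁺ f c R (ℕ.≤-trans (s≤s (ℕ.m≤m+n _ _)) p≤))
      (∈-sequence⁺ f S (ℕ.≤-trans (ℕ.m≤n+m _ _) p≤))

    orders-unique : ∀ f j → Unique (orders f j)
    sequence-unique : ∀ f ks → Unique (sequence (orders f) ks)

    orders-unique zero    j = []
    orders-unique (suc f) j = Unique.map⁺ (λ { refl → refl })
      (unique-concatMap (perms-unique (children-unique p j)) (λ {ks} _ → sequence-unique f ks)
        (λ {ks} {ls} _ _ z∈ z∈′ → trans (sym (proj₁ (∈-sequence⁻ f ks z∈))) (proj₁ (∈-sequence⁻ f ls z∈′))))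

    sequence-unique f []       = [] ∷ []
    sequence-unique f (k ∷ ks) = Unique.cartesianProductWith⁺ _∷_ ∷-injective (orders-unique f k) (sequence-unique f ks)

    -- All descending chains from j have fewer than f steps, so `orders f j` does not run out of
    -- fuel and lose orderings.
    data Below : ℕ → Fin n → Set where
      below : ∀ {f j} → (∀ k → lookup p k ≡ just j → Below f k) → Below (suc f) j

    -- Depth plus remaining fuel is n throughout; fuel 0 would mean a vertex of depth n, against the
    -- bound on depths.
    depth-below : ∀ {r} → lookup p r ≡ nothing → (∀ i → ∃ λ d → d < n × Depth p r d i) →
                  ∀ f {d j} → Depth p r d j → d + f ≡ n → Below f j
    depth-below root h zero {j = j} D eq with e , e<n , E ← h j
      with refl ← depth-unique p root D E = ⊥-elim (ℕ.<-irrefl (trans (sym (ℕ.+-identityʳ _)) eq) e<n)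
    depth-below root h (suc f) {d} D eq =
      below λ k k→j → depth-below root h f (suc k→j D) (trans (sym (ℕ.+-suc d f)) eq)

    tree-below : ∀ {r} → IsLTree p r → Below n r
    tree-below ((root , _) , acyclic) = depth-below root (bounded-depth p acyclic) n zero refl

    -- Every vertex reaches the root by finitely many parent steps and the labels are closed under
    -- taking children, so none is missing; comparing depths excludes repetitions.
    real-labels : ∀ {x r} → IsLTree p r → rootOf x ≡ r → Real p [ x ] → labels x ↭ allFin n
    real-labels {branch r xs} ((root , _) , acyclic) refl R@(cons c S []) =
      unique⇒↭ unique (Unique.allFin⁺ n) (λ _ → ∈-allFin _)
        (λ {i} _ → label i)
      where
      label : ∀ i → i ∈ r ∷ labelsF xs
      label i with d , _ , D ← bounded-depth p acyclic i with ∈-++⁻ (r ∷ labelsF xs) (labels-complete p R D)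
      ... | inj₁ i∈ = i∈

      unique : Unique (r ∷ labelsF xs)
      unique = subst Unique (List.++-identityʳ (r ∷ labelsF xs))
        (labels-unique p root {d = 0} R ([] ∷ []) (λ { (here refl) → zero }))

  module _ {n : ℕ} where

    -- (child, parent) pairs of the forest whose roots are children of l
    edgesF : Fin n → List (Plane (Fin n)) → List (Fin n × Fin n)
    edgesF l []                 = []
    edgesF l (branch k zs ∷ ys) = (k , l) ∷ edgesF k zs ++ edgesF l ys

    edges-children : ∀ l ys → map proj₁ (edgesF l ys) ≡ labelsF ys
    edges-children l []                 = refl
    edges-children l (branch k zs ∷ ys) = cong (k ∷_)
      (trans (map-++ proj₁ (edgesF k zs) (edgesF l ys)) (cong₂ _++_ (edges-children k zs) (edges-children l ys)))

    edge-parent : ∀ {l k j} ys → (k , j) ∈ edgesF l ys → j ≡ l ⊎ j ∈ labelsF ys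
    edge-parent (branch k zs ∷ ys) (here refl) = inj₁ refl
    edge-parent (branch k zs ∷ ys) (there e) with ∈-++⁻ (edgesF k zs) e
    ... | inj₁ e′ with edge-parent zs e′
    ...   | inj₁ refl = inj₂ (here refl)
    ...   | inj₂ j∈   = inj₂ (there (∈-++⁺ˡ j∈))
    edge-parent (branch k zs ∷ ys) (there e) | inj₂ e′ with edge-parent ys e′
    ...   | inj₁ eq = inj₁ eq
    ...   | inj₂ j∈ = inj₂ (∈-++⁺ʳ (k ∷ labelsF zs) j∈)

    edge-root : ∀ {l k} ys → l ∉ labelsF ys → (k , l) ∈ edgesF l ys → k ∈ roots ys
    edge-root (branch a bs ∷ ys) l∉ (here refl) = here refl
    edge-root (branch a bs ∷ ys) l∉ (there e) with ∈-++⁻ (edgesF a bs) e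
    ... | inj₂ e′ = there (edge-root ys (λ l∈ → l∉ (∈-++⁺ʳ (a ∷ labelsF bs) l∈)) e′)
    ... | inj₁ e′ with edge-parent bs e′
    ...   | inj₁ refl = ⊥-elim (l∉ (here refl))
    ...   | inj₂ l∈   = ⊥-elim (l∉ (there (∈-++⁺ˡ l∈)))

    root-edge : ∀ {l k} ys → k ∈ roots ys → (k , l) ∈ edgesF l ys
    root-edge (branch a bs ∷ ys) (here refl) = here refl
    root-edge (branch a bs ∷ ys) (there k∈)  = there (∈-++⁺ʳ (edgesF a bs) (root-edge ys k∈))

    label-edge : ∀ {l k} ys → k ∈ labelsF ys → ∃ λ j → (k , j) ∈ edgesF l ys
    label-edge {l} ys k∈ with (k , j) , e , refl ← ∈-map⁻ proj₁ (subst (_ ∈_) (sym (edges-children l ys)) k∈) = j , e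

    real-edge : ∀ (p : Parent n) {l ys} → Real p ys → (∀ {k} → k ∈ roots ys → lookup p k ≡ just l) →
                ∀ {k j} → (k , j) ∈ edgesF l ys → lookup p k ≡ just j
    real-edge p (cons {k} {zs} c R S) h (here refl) = h (here refl)
    real-edge p (cons {k} {zs} c R S) h (there e) with ∈-++⁻ (edgesF k zs) e
    ... | inj₁ e′ = real-edge p R (λ k∈ → ∈-children⁻ p (∈-resp-↭ c k∈)) e′
    ... | inj₂ e′ = real-edge p S (λ k∈ → h (there k∈)) e′

    -- A closed set passes from a vertex to its parent, so its complement passes from a vertex to
    -- its children. This serves both the acyclicity of `parentOf` and the parts cut off by a rooted
    -- subtree.
    parents-outside : ∀ (p : Parent n) {S} → ClosedUnder p S → ∀ {l ys} → Real p ys → l Subset.∉ S →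
                      (∀ {k} → k ∈ roots ys → lookup p k ≡ just l) →
                      ∀ {i} → i ∈ labelsF ys → ∃ λ j → lookup p i ≡ just j × j Subset.∉ S
    parents-outside p cl {l} (cons {a} {zs} c R T) l∉ h i∈ with ∈-++⁻ (a ∷ labelsF zs) i∈
    ... | inj₁ (here refl) = l , h (here refl) , l∉
    ... | inj₁ (there i∈′) = parents-outside p cl R (λ a∈ → l∉ (cl a a∈ l (h (here refl))))
                               (λ k∈ → ∈-children⁻ p (∈-resp-↭ c k∈)) i∈′
    ... | inj₂ i∈′         = parents-outside p cl T l∉ (λ k∈ → h (there k∈)) i∈′

    parent-determined : ∀ (p p′ : Parent n) {x} → labels x ↭ allFin n →
                        lookup p (rootOf x) ≡ nothing → lookup p′ (rootOf x) ≡ nothing →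
                        Real p [ x ] → Real p′ [ x ] → p ≡ p′
    parent-determined p p′ {branch r xs} L root root′ (cons c R []) (cons c′ R′ []) = lookup-ext same
      where
      same : ∀ i → lookup p i ≡ lookup p′ i
      same i with ∈-resp-↭ (↭-sym L) (∈-allFin i)
      ... | here refl = trans root (sym root′)
      ... | there i∈ with j , e ← label-edge {r} xs i∈ =
        trans (real-edge p R (λ k∈ → ∈-children⁻ p (∈-resp-↭ c k∈)) e)
              (sym (real-edge p′ R′ (λ k∈ → ∈-children⁻ p′ (∈-resp-↭ c′ k∈)) e))

    roots-unique : ∀ xs → Unique (labelsF {A = Fin n} xs) → Unique (roots xs)
    roots-unique []                 u = []
    roots-unique (branch l xs ∷ ys) u@(_ ∷ u′) =
      ∉⇒All≢ _ (λ l∈ → Unique.Unique[x∷xs]⇒x∉xs u (∈-++⁺ʳ (labelsF xs) (roots⊆labelsF ys l∈))) ∷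
      roots-unique ys (proj₁ (proj₂ (unique-++⁻ (labelsF xs) u′)))

    module _ (p : Parent n) where

      roots-children : ∀ {l} ys → Unique (l ∷ labelsF ys) →
        (∀ {k} → lookup p k ≡ just l → (k , l) ∈ edgesF l ys) →
        (∀ {k j} → (k , j) ∈ edgesF l ys → lookup p k ≡ just j) → roots ys ↭ children p l
      roots-children {l} ys u@(_ ∷ u′) f g = unique⇒↭ (roots-unique ys u′) (children-unique p l)
        (λ k∈ → ∈-children⁺ p (g (root-edge ys k∈)))
        (λ k∈ → edge-root ys (Unique.Unique[x∷xs]⇒x∉xs u) (f (∈-children⁻ p k∈)))

      edges-real : ∀ {l} ys → Unique (l ∷ labelsF ys) →
        (∀ {k j} → j ∈ labelsF ys → lookup p k ≡ just j → (k , j) ∈ edgesF l ys) →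
        (∀ {k j} → (k , j) ∈ edgesF l ys → lookup p k ≡ just j) → Real p ys
      edges-real     []                 u f g = []
      edges-real {l} (branch a zs ∷ ys) u@(_ ∷ u′) f g = cons
        (roots-children zs ua (λ eq → left (here refl) (f (here refl) eq)) (λ e → g (there (∈-++⁺ˡ e))))
        (edges-real zs ua (λ j∈ eq → left (there j∈) (f (∈-++⁺ˡ (there j∈)) eq)) (λ e → g (there (∈-++⁺ˡ e))))
        (edges-real ys ul (λ j∈ eq → right j∈ (f (∈-++⁺ʳ (a ∷ labelsF zs) j∈) eq)) (λ e → g (there (∈-++⁺ʳ (edgesF a zs) e))))
        where
        split = unique-++⁻ (a ∷ labelsF zs) u′
        ua = proj₁ split
        d  = proj₂ (proj₂ split)

        l∉ : l ∉ (a ∷ labelsF zs) ++ labelsF ys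
        l∉ = Unique.Unique[x∷xs]⇒x∉xs u

        ul : Unique (l ∷ labelsF ys)
        ul = ∉⇒All≢ _ (λ l∈ → l∉ (∈-++⁺ʳ (a ∷ labelsF zs) l∈)) ∷ proj₁ (proj₂ split)

        left : ∀ {k j} → j ∈ a ∷ labelsF zs → (k , j) ∈ edgesF l (branch a zs ∷ ys) → (k , j) ∈ edgesF a zs
        left j∈ (here refl) = ⊥-elim (l∉ (∈-++⁺ˡ j∈))
        left j∈ (there e) with ∈-++⁻ (edgesF a zs) e
        ... | inj₁ e′ = e′
        ... | inj₂ e′ with edge-parent ys e′
        ...   | inj₁ refl = ⊥-elim (l∉ (∈-++⁺ˡ j∈))
        ...   | inj₂ j∈′  = ⊥-elim (d j∈ j∈′)

        right : ∀ {k j} → j ∈ labelsF ys → (k , j) ∈ edgesF l (branch a zs ∷ ys) → (k , j) ∈ edgesF l ys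
        right j∈ (here refl) = ⊥-elim (l∉ (∈-++⁺ʳ (a ∷ labelsF zs) j∈))
        right j∈ (there e) with ∈-++⁻ (edgesF a zs) e
        ... | inj₂ e′ = e′
        ... | inj₁ e′ with edge-parent zs e′
        ...   | inj₁ refl = ⊥-elim (d (here refl) j∈)
        ...   | inj₂ j∈′  = ⊥-elim (d (there j∈′) j∈)

    -- The inverse of choosing a plane ordering. If the labels are distinct, the root is not a key
    -- of the edge list and its entry is `nothing`.
    parentOf : Plane (Fin n) → Parent n
    parentOf (branch r xs) = tabulate (assoc (edgesF r xs))

    module _ {r : Fin n} {xs : List (Plane (Fin n))} (L : r ∷ labelsF xs ↭ allFin n) where
      private
        p = parentOf (branch r xs)

        unique : Unique (r ∷ labelsF xs)
        unique = unique-↭ (↭-sym L) (Unique.allFin⁺ n)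

        unique-keys : Unique (map proj₁ (edgesF r xs))
        unique-keys with _ ∷ u ← unique = subst Unique (sym (edges-children r xs)) u

        edge⇒parent : ∀ {k j} → (k , j) ∈ edgesF r xs → lookup p k ≡ just j
        edge⇒parent {k} e = trans (lookup∘tabulate (assoc (edgesF r xs)) k) (∈-assoc (edgesF r xs) unique-keys e)

        parent⇒edge : ∀ {k j} → lookup p k ≡ just j → (k , j) ∈ edgesF r xs
        parent⇒edge {k} eq = assoc-∈ (edgesF r xs) (trans (sym (lookup∘tabulate (assoc (edgesF r xs)) k)) eq)

      parentOf-children : roots xs ↭ children p r
      parentOf-children = roots-children p xs unique parent⇒edge edge⇒parent

      parentOf-real : Real p xs
      parentOf-real = edges-real p xs unique (λ _ → parent⇒edge) edge⇒parent

      parentOf-tree : IsLTree p r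
      parentOf-tree = (orphan , only) , acyclic
        where
        orphan : lookup p r ≡ nothing
        orphan with lookup p r in eq
        ... | nothing = refl
        ... | just j  = ⊥-elim (Unique.Unique[x∷xs]⇒x∉xs unique
          (subst (r ∈_) (edges-children r xs) (∈-map⁺ proj₁ (parent⇒edge eq))))

        only : ∀ i → lookup p i ≡ nothing → i ≡ r
        only i eq with ∈-resp-↭ (↭-sym L) (∈-allFin i)
        ... | here refl = refl
        ... | there i∈ with j , e ← label-edge {r} xs i∈ with () ← trans (sym eq) (edge⇒parent e)

        acyclic : Acyclic p r
        -- A closed set avoiding the root contains no descendant of the root, and every other vertex
        -- is one.
        acyclic (S , (i , i∈S) , r∉S , cl) with ∈-resp-↭ (↭-sym L) (∈-allFin i)
        ... | here refl = r∉S i∈S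
        ... | there i∈ with j , eq , j∉S ← parents-outside p cl parentOf-real r∉S (λ k∈ → ∈-children⁻ p (∈-resp-↭ parentOf-children k∈)) i∈ =
          j∉S (cl i i∈S j eq)

  module _ {A B : Set} (f : A → Maybe B) where

    ∈-mapMaybe⁺ : ∀ {x y xs} → x ∈ xs → f x ≡ just y → y ∈ mapMaybe f xs
    ∈-mapMaybe⁺ {x} (here refl) eq rewrite eq = here refl
    ∈-mapMaybe⁺ {xs = z ∷ xs} (there x∈) eq with f z
    ... | just _  = there (∈-mapMaybe⁺ x∈ eq)
    ... | nothing = ∈-mapMaybe⁺ x∈ eq

    ∈-mapMaybe⁻ : ∀ xs {y} → y ∈ mapMaybe f xs → ∃ λ x → x ∈ xs × f x ≡ just y
    ∈-mapMaybe⁻ (x ∷ xs) y∈ with f x in eq | y∈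
    ... | just _  | here refl = x , here refl , eq
    ... | just _  | there y∈′ with z , z∈ , eq′ ← ∈-mapMaybe⁻ xs y∈′ = z , there z∈ , eq′
    ... | nothing | y∈′       with z , z∈ , eq′ ← ∈-mapMaybe⁻ xs y∈′ = z , there z∈ , eq′

    mapMaybe-unique : ∀ {xs} → Unique xs → (∀ {x x′ y} → f x ≡ just y → f x′ ≡ just y → x ≡ x′) → Unique (mapMaybe f xs)
    mapMaybe-unique []       inj = []
    mapMaybe-unique {x ∷ xs} u@(_ ∷ u′) inj with f x in eq
    ... | nothing = mapMaybe-unique u′ inj
    ... | just y  = ∉⇒All≢ _ (λ y∈ → let z , z∈ , eq′ = ∈-mapMaybe⁻ xs y∈ in
        Unique.Unique[x∷xs]⇒x∉xs u (subst (_∈ xs) (inj eq′ eq) z∈)) ∷ mapMaybe-unique u′ inj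

  module _ {A : Set} {xs : List A} where

    ∈-allVecs : ∀ {n} (v : Vec A n) → (∀ i → lookup v i ∈ xs) → v ∈ allVecs n xs
    ∈-allVecs []      h = here refl
    ∈-allVecs (x ∷ v) h = ∈-concatMap⁺′ (λ x → map (x ∷_) (allVecs _ xs)) (h Fin.zero)
      (∈-map⁺ (x ∷_) (∈-allVecs v (λ i → h (Fin.suc i))))

    allVecs-unique : Unique xs → ∀ n → Unique (allVecs n xs)
    allVecs-unique u zero    = [] ∷ []
    allVecs-unique u (suc n) = unique-concatMap u
      (λ _ → Unique.map⁺ (λ { refl → refl }) (allVecs-unique u n)) disjoint
      where
      disjoint : ∀ {x y z} → x ∈ xs → y ∈ xs → z ∈ map (x ∷_) (allVecs n xs) → z ∈ map (y ∷_) (allVecs n xs) → x ≡ y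
      disjoint _ _ p q with _ , _ , refl ← ∈-map⁻ _ p with _ , _ , refl ← ∈-map⁻ _ q = refl

  module _ {n : ℕ} where

    ∈-allMaybeFin : ∀ (m : Maybe (Fin n)) → m ∈ allMaybeFin n
    ∈-allMaybeFin nothing  = here refl
    ∈-allMaybeFin (just i) = there (∈-map⁺ just (∈-allFin i))

    allMaybeFin-unique : Unique (allMaybeFin n)
    allMaybeFin-unique = ∉⇒All≢ _ no-nothing ∷ Unique.map⁺ just-injective (Unique.allFin⁺ n)
      where
      no-nothing : nothing ∉ map just (allFin n)
      no-nothing p with _ , _ , () ← ∈-map⁻ just p

    mkTree?-parent : ∀ p r {T : LTree n} → mkTree? p r ≡ just T → parent T ≡ p
    mkTree?-parent p r eq with isLTree? p r
    mkTree?-parent p r refl | yes _ = refl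

    mkTree?-root : ∀ p r {T : LTree n} → mkTree? p r ≡ just T → root T ≡ r
    mkTree?-root p r eq with isLTree? p r
    mkTree?-root p r refl | yes _ = refl

    mkTree?-yes : ∀ p r → IsLTree p r → ∃ λ (T : LTree n) → mkTree? p r ≡ just T
    mkTree?-yes p r t with isLTree? p r
    ... | yes t′ = ltree p r t′ , refl
    ... | no ¬t  = ⊥-elim (¬t t)

    ∈-labeledTrees⁻ : ∀ {T : LTree n} → T ∈ labeledTrees n → mkTree? (parent T) (root T) ≡ just T
    ∈-labeledTrees⁻ T∈
      with p , _ , T∈′ ← ∈-concatMap⁻′ (λ p → mapMaybe (mkTree? p) (allFin n)) (allVecs n (allMaybeFin n)) T∈
      with r , _ , eq ← ∈-mapMaybe⁻ (mkTree? p) (allFin n) T∈′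
      with refl ← mkTree?-parent p r eq
      with refl ← mkTree?-root p r eq
      = eq

    ∈-labeledTrees⁺ : ∀ p r → IsLTree p r → ∃ λ (T : LTree n) → T ∈ labeledTrees n × parent T ≡ p × root T ≡ r
    ∈-labeledTrees⁺ p r t with T , eq ← mkTree?-yes p r t =
      T , ∈-concatMap⁺′ (λ p → mapMaybe (mkTree? p) (allFin n)) (∈-allVecs p (λ i → ∈-allMaybeFin (lookup p i)))
            (∈-mapMaybe⁺ (mkTree? p) (∈-allFin r) eq) ,
      mkTree?-parent p r eq , mkTree?-root p r eq

    labeledTrees-unique : Unique (labeledTrees n)
    labeledTrees-unique = unique-concatMap (allVecs-unique allMaybeFin-unique n)
      (λ {p} _ → mapMaybe-unique (mkTree? p) (Unique.allFin⁺ n)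
        (λ {r} {r′} eq eq′ → trans (sym (mkTree?-root p r eq)) (mkTree?-root p r′ eq′)))
      (λ {p} {p′} _ _ T∈ T∈′ → trans (sym (parent-∈ p T∈)) (parent-∈ p′ T∈′))
      where
      parent-∈ : ∀ p {T : LTree n} → T ∈ mapMaybe (mkTree? p) (allFin n) → parent T ≡ p
      parent-∈ p T∈ with r , _ , eq ← ∈-mapMaybe⁻ (mkTree? p) (allFin n) T∈ = mkTree?-parent p r eq

    -- The fields `isTree` agree too, because in a listed tree this is the proof that `mkTree?`
    -- computes from parent and root.
    labeledTree-ext : ∀ {T T′ : LTree n} → T ∈ labeledTrees n → T′ ∈ labeledTrees n →
                      parent T ≡ parent T′ → root T ≡ root T′ → T ≡ T′
    labeledTree-ext T∈ T∈′ p r = just-injective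
      (trans (sym (∈-labeledTrees⁻ T∈)) (trans (cong₂ mkTree? p r) (∈-labeledTrees⁻ T∈′)))

  -- Two enumerations of the plane trees with label set Fin (suc k).
  module _ (k : ℕ) where
    private n = suc k

    byTree byShape : List (Plane (Fin n))
    byTree  = concatMap (λ T → orders (parent T) n (root T)) (labeledTrees n)
    byShape = concatMap (λ t → map (fill Fin.zero t) (perms (allFin n))) (trees n)

    perm-length : ∀ {ls} → ls ∈ perms (allFin n) → length ls ≡ n
    perm-length ls∈ = trans (↭-length (∈-perms⁻ (allFin n) ls∈)) (length-tabulate id)

    fits : ∀ {t ls} → t ∈ trees n → ls ∈ perms (allFin n) → length ls ≡ sizeT t
    fits t∈ ls∈ = trans (perm-length ls∈) (sym (∈-trees⁻ n t∈))

    ∈-byShape⁺ : ∀ {x} → labels x ↭ allFin n → x ∈ byShape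
    ∈-byShape⁺ {x} L = ∈-concatMap⁺′ (λ t → map (fill Fin.zero t) (perms (allFin n)))
      (∈-trees⁺ (shape x) (trans (sym (length-labels x)) (perm-length (∈-perms⁺ (allFin n) L))))
      (subst (_∈ map (fill Fin.zero (shape x)) (perms (allFin n))) (fill-shape Fin.zero x)
        (∈-map⁺ (fill Fin.zero (shape x)) (∈-perms⁺ (allFin n) L)))

    ∈-byShape⁻ : ∀ {x} → x ∈ byShape → labels x ↭ allFin n
    ∈-byShape⁻ x∈
      with t , t∈ , x∈′ ← ∈-concatMap⁻′ (λ t → map (fill Fin.zero t) (perms (allFin n))) (trees n) x∈
      with ls , ls∈ , refl ← ∈-map⁻ (fill Fin.zero t) x∈′
      rewrite labels-fill Fin.zero t ls (fits t∈ ls∈) = ∈-perms⁻ (allFin n) ls∈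

    byShape-unique : Unique byShape
    byShape-unique = unique-concatMap (trees-unique n)
      (λ {t} t∈ → unique-map-∈ (perms-unique (Unique.allFin⁺ n)) (λ {ls} {ls′} ls∈ ls∈′ eq →
        trans (sym (labels-fill Fin.zero t ls (fits t∈ ls∈)))
          (trans (cong labels eq) (labels-fill Fin.zero t ls′ (fits t∈ ls∈′)))))
      (λ t∈ t∈′ x∈ x∈′ → trans (sym (shape-∈ t∈ x∈)) (shape-∈ t∈′ x∈′))
      where
      shape-∈ : ∀ {t x} → t ∈ trees n → x ∈ map (fill Fin.zero t) (perms (allFin n)) → shape x ≡ t
      shape-∈ {t} t∈ x∈ with ls , ls∈ , refl ← ∈-map⁻ (fill Fin.zero t) x∈ = shape-fill Fin.zero t ls (fits t∈ ls∈)

    orders-labels : ∀ (T : LTree n) {x} → x ∈ orders (parent T) n (root T) → labels x ↭ allFin n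
    orders-labels T x∈ with eq , R ← ∈-orders⁻ (parent T) n x∈ = real-labels (parent T) (isTree T) eq R

    ∈-byTree⁻ : ∀ {x} → x ∈ byTree → labels x ↭ allFin n
    ∈-byTree⁻ x∈ with T , _ , x∈′ ← ∈-concatMap⁻′ (λ T → orders (parent T) n (root T)) (labeledTrees n) x∈ = orders-labels T x∈′

    ∈-byTree⁺ : ∀ {x} → labels x ↭ allFin n → x ∈ byTree
    ∈-byTree⁺ {branch r xs} L
      with T , T∈ , refl , refl ← ∈-labeledTrees⁺ (parentOf (branch r xs)) r (parentOf-tree {xs = xs} L)
      = ∈-concatMap⁺′ (λ T → orders (parent T) n (root T)) T∈
          (∈-orders⁺ (parentOf (branch r xs)) n (parentOf-children L) (parentOf-real L)
            (ℕ.≤-reflexive (trans (sym (length-labels (branch r xs))) (perm-length (∈-perms⁺ (allFin n) L)))))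

    byTree-unique : Unique byTree
    byTree-unique = unique-concatMap labeledTrees-unique
      (λ {T} _ → orders-unique (parent T) n (root T)) same-tree
      where
      same-tree : ∀ {T T′ x} → T ∈ labeledTrees n → T′ ∈ labeledTrees n →
                  x ∈ orders (parent T) n (root T) → x ∈ orders (parent T′) n (root T′) → T ≡ T′
      same-tree {T} {T′} T∈ T∈′ x∈ x∈′
        with eq , R ← ∈-orders⁻ (parent T) n x∈
        with eq′ , R′ ← ∈-orders⁻ (parent T′) n x∈′
        = labeledTree-ext T∈ T∈′
            (parent-determined (parent T) (parent T′) (orders-labels T x∈)
              (subst (λ r → lookup (parent T) r ≡ nothing) (sym eq) (proj₁ (proj₁ (isTree T))))
              (subst (λ r → lookup (parent T′) r ≡ nothing) (sym eq′) (proj₁ (proj₁ (isTree T′)))) R R′)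
            (trans (sym eq) eq′)

    -- Both lists contain exactly the plane trees whose labels are a permutation of `Fin n`, once
    -- each: grouped by labelled tree they are the plane orderings, grouped by shape the labellings.
    byTree-byShape : byTree ↭ byShape
    byTree-byShape = unique⇒↭ byTree-unique byShape-unique
      (λ x∈ → ∈-byShape⁺ (∈-byTree⁻ x∈)) (λ x∈ → ∈-byTree⁺ (∈-byShape⁻ x∈))

  -- Rooted subtrees as markings of a plane ordering

  module _ {A : Set} where

    -- Decorated forests: true marks the vertices of a rooted subtree, false those that are cut off.
    keptF : List (Plane (A × Bool)) → List Tree
    keptF []                           = []
    keptF (branch (l , true)  xs ∷ ys) = node (keptF xs) ∷ keptF ys
    keptF (branch (l , false) xs ∷ ys) = keptF ys

    eraseF : List (Plane (A × Bool)) → List (Plane A)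
    eraseF []                       = []
    eraseF (branch (l , b) xs ∷ ys) = branch l (eraseF xs) ∷ eraseF ys

    offF : List (Plane A) → List (Plane (A × Bool))
    offF []                 = []
    offF (branch l xs ∷ ys) = branch (l , false) (offF xs) ∷ offF ys

    -- Below a cut vertex the whole subtree is marked `false`, so that a rooted subtree corresponds
    -- to exactly one marking.
    prunings : List (Plane A) → List (List (Plane (A × Bool)))
    prunings []                 = [ [] ]
    prunings (branch l xs ∷ ys) =
      cartesianProductWith _∷_ (branch (l , false) (offF xs) ∷ map (branch (l , true)) (prunings xs)) (prunings ys)

    shapeF-offF : ∀ xs → shapeF (offF xs) ≡ shapeF xs
    shapeF-offF []                 = refl
    shapeF-offF (branch l xs ∷ ys) = cong₂ (λ us ts → node us ∷ ts) (shapeF-offF xs) (shapeF-offF ys)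

    eraseF-offF : ∀ xs → eraseF (offF xs) ≡ xs
    eraseF-offF []                 = refl
    eraseF-offF (branch l xs ∷ ys) = cong₂ (λ us ts → branch l us ∷ ts) (eraseF-offF xs) (eraseF-offF ys)

    labelsF-eraseF : ∀ D → labelsF (eraseF D) ≡ map proj₁ (labelsF D)
    labelsF-eraseF []                       = refl
    labelsF-eraseF (branch (l , b) xs ∷ ys) = cong (l ∷_)
      (trans (cong₂ _++_ (labelsF-eraseF xs) (labelsF-eraseF ys)) (sym (map-++ proj₁ (labelsF xs) (labelsF ys))))

    eraseF-prunings : ∀ xs {D} → D ∈ prunings xs → eraseF D ≡ xs
    eraseF-prunings []                 (here refl) = refl
    eraseF-prunings (branch l xs ∷ ys) D∈
      with ∈-cartesianProductWith⁻ _∷_ (branch (l , false) (offF xs) ∷ map (branch (l , true)) (prunings xs)) (prunings ys) D∈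
    ... | _ , _ , here refl , D∈′ , refl = cong₂ (λ us ts → branch l us ∷ ts) (eraseF-offF xs) (eraseF-prunings ys D∈′)
    ... | _ , _ , there d∈ , D∈′ , refl with E , E∈ , refl ← ∈-map⁻ (branch (l , true)) d∈ =
      cong₂ (λ us ts → branch l us ∷ ts) (eraseF-prunings xs E∈) (eraseF-prunings ys D∈′)

    prunings-unique : ∀ xs → Unique (prunings xs)
    prunings-unique []                 = [] ∷ []
    prunings-unique (branch l xs ∷ ys) = Unique.cartesianProductWith⁺ _∷_ ∷-injective
      (∉⇒All≢ _ not-kept ∷ Unique.map⁺ (λ { refl → refl }) (prunings-unique xs)) (prunings-unique ys)
      where
      not-kept : branch (l , false) (offF xs) ∉ map (branch (l , true)) (prunings xs)
      not-kept d∈ with _ , _ , () ← ∈-map⁻ (branch (l , true)) d∈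

  module _ {n : ℕ} where

    decorate : Subset n → List (Plane (Fin n)) → List (Plane (Fin n × Bool))
    decorate U []                 = []
    decorate U (branch l xs ∷ ys) = branch (l , lookup U l) (decorate U xs) ∷ decorate U ys

    shapeF-decorate : ∀ U ys → shapeF (decorate U ys) ≡ shapeF ys
    shapeF-decorate U []                 = refl
    shapeF-decorate U (branch l xs ∷ ys) = cong₂ (λ us ts → node us ∷ ts) (shapeF-decorate U xs) (shapeF-decorate U ys)

    decorate-eraseF : ∀ U D → (∀ {i b} → (i , b) ∈ labelsF D → lookup U i ≡ b) → decorate U (eraseF D) ≡ D
    decorate-eraseF U []                       h = refl
    decorate-eraseF U (branch (l , b) xs ∷ ys) h
      rewrite h (here refl)
      = cong₂ (λ us ts → branch (l , b) us ∷ ts)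
          (decorate-eraseF U xs (λ p → h (there (∈-++⁺ˡ p))))
          (decorate-eraseF U ys (λ p → h (there (∈-++⁺ʳ (labelsF xs) p))))

    decorate-off : ∀ U ys → (∀ {i} → i ∈ labelsF ys → lookup U i ≡ outside) → decorate U ys ≡ offF ys
    decorate-off U []                 h = refl
    decorate-off U (branch l xs ∷ ys) h
      rewrite h (here refl)
      = cong₂ (λ us ts → branch (l , false) us ∷ ts)
          (decorate-off U xs (λ p → h (there (∈-++⁺ˡ p))))
          (decorate-off U ys (λ p → h (there (∈-++⁺ʳ (labelsF xs) p))))

    subforest : Plane (Fin n × Bool) → List (Plane (Fin n × Bool))
    subforest (branch _ xs) = xs

    decorate-injective : ∀ {U V} ys → decorate U ys ≡ decorate V ys → ∀ {i} → i ∈ labelsF ys → lookup U i ≡ lookup V i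
    decorate-injective (branch l xs ∷ ys) eq i∈ with ∈-++⁻ (l ∷ labelsF xs) i∈
    ... | inj₁ (here refl) = cong (λ x → proj₂ (rootOf x)) (∷-injectiveˡ eq)
    ... | inj₁ (there i∈′) = decorate-injective xs (cong subforest (∷-injectiveˡ eq)) i∈′
    ... | inj₂ i∈′         = decorate-injective ys (∷-injectiveʳ eq) i∈′

    offF-outside : ∀ {U} ys → decorate U ys ≡ offF ys → ∀ {i} → i ∈ labelsF ys → lookup U i ≡ outside
    -- `offF` is the marking by the empty subset, so the injectivity of marking applies.
    offF-outside {U} ys eq {i} i∈ = trans
      (decorate-injective {U} {Subset.⊥} ys (trans eq (sym (decorate-off Subset.⊥ ys (λ _ → lookup-⊥ _)))) i∈) (lookup-⊥ i)
      where
      lookup-⊥ : ∀ i → lookup (Subset.⊥ {n}) i ≡ outside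
      lookup-⊥ i = Vec.lookup-replicate i outside

    ∉⇒outside : ∀ {U : Subset n} {i} → i Subset.∉ U → lookup U i ≡ outside
    ∉⇒outside {U} {i} i∉ with lookup U i in eq
    ... | true  = ⊥-elim (i∉ (lookup⇒[]= i U eq))
    ... | false = refl

    outside⇒∉ : ∀ {U : Subset n} {i} → lookup U i ≡ outside → i Subset.∉ U
    outside⇒∉ eq i∈ with () ← trans (sym eq) ([]=⇒lookup i∈)

    keptTree : Subset n → Plane (Fin n) → Tree
    keptTree U (branch l xs) = node (keptF (decorate U xs))

    rootsIn : Subset n → List (Plane (Fin n)) → List (Plane (Fin n))
    rootsIn U []       = []
    rootsIn U (x ∷ xs) with lookup U (rootOf x)
    ... | true  = x ∷ rootsIn U xs
    ... | false = rootsIn U xs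

    keptF-rootsIn : ∀ U xs → keptF (decorate U xs) ≡ map (keptTree U) (rootsIn U xs)
    keptF-rootsIn U []                 = refl
    keptF-rootsIn U (branch l xs ∷ ys) with lookup U l
    ... | true  = cong (_ ∷_) (keptF-rootsIn U ys)
    ... | false = keptF-rootsIn U ys

    ∈-rootsIn⁻ : ∀ U xs {x} → x ∈ rootsIn U xs → x ∈ xs × lookup U (rootOf x) ≡ inside
    ∈-rootsIn⁻ U (y ∷ xs) x∈ with lookup U (rootOf y) in eq | x∈
    ... | true  | here refl = here refl , eq
    ... | true  | there x∈′ = let p , q = ∈-rootsIn⁻ U xs x∈′ in there p , q
    ... | false | x∈′       = let p , q = ∈-rootsIn⁻ U xs x∈′ in there p , q

    ∈-rootsIn⁺ : ∀ U xs {x} → x ∈ xs → lookup U (rootOf x) ≡ inside → x ∈ rootsIn U xs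
    ∈-rootsIn⁺ U (y ∷ xs) x∈ eq with lookup U (rootOf y) in eq′ | x∈
    ... | true  | here refl = here refl
    ... | true  | there x∈′ = there (∈-rootsIn⁺ U xs x∈′ eq)
    ... | false | here refl with () ← trans (sym eq) eq′
    ... | false | there x∈′ = ∈-rootsIn⁺ U xs x∈′ eq

    rootsIn-unique : ∀ U xs → Unique (roots xs) → Unique (roots (rootsIn U xs))
    rootsIn-unique U []       u = []
    rootsIn-unique U (x ∷ xs) u@(_ ∷ u′) with lookup U (rootOf x)
    ... | false = rootsIn-unique U xs u′
    ... | true  = ∉⇒All≢ _ (λ x∈ → let y , y∈ , eq = ∈-map⁻ rootOf x∈ in
      Unique.Unique[x∷xs]⇒x∉xs u (subst (_∈ roots xs) (sym eq) (∈-map⁺ rootOf (proj₁ (∈-rootsIn⁻ U xs y∈)))))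
      ∷ rootsIn-unique U xs u′

    keptF-⊤ : ∀ xs → keptF (decorate ⊤ xs) ≡ shapeF xs
    keptF-⊤ []                 = refl
    keptF-⊤ (branch l xs ∷ ys) rewrite []=⇒lookup (∈⊤ {x = l}) =
      cong₂ (λ us ts → node us ∷ ts) (keptF-⊤ xs) (keptF-⊤ ys)

    module _ (p : Parent n) where

      real-∈ : ∀ {xs l zs} → Real p xs → branch l zs ∈ xs →
               roots zs ↭ children p l × Real p zs × suc (sizeF (shapeF zs)) ≤ sizeF (shapeF xs)
      real-∈ (cons c R S) (here refl) = c , R , s≤s (ℕ.m≤m+n _ _)
      real-∈ (cons c R S) (there x∈)  = let c′ , R′ , p≤ = real-∈ S x∈ in c′ , R′ , ℕ.≤-trans p≤ (ℕ.m≤n+m _ _)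

      rootsIn-children : ∀ U {l xs} → roots xs ↭ children p l →
        roots (rootsIn U xs) ↭ filter (λ k → (k Subset.∈? U) ×-dec (lookup p k ≟M just l)) (allFin n)
      rootsIn-children U {l} {xs} c = unique⇒↭ (rootsIn-unique U xs (unique-↭ (↭-sym c) (children-unique p l)))
        (Unique.filter⁺ P? (Unique.allFin⁺ n)) to from
        where
        P? = λ k → (k Subset.∈? U) ×-dec (lookup p k ≟M just l)

        to : ∀ {k} → k ∈ roots (rootsIn U xs) → k ∈ filter P? (allFin n)
        to k∈ with x , x∈ , refl ← ∈-map⁻ rootOf k∈ with x∈′ , eq ← ∈-rootsIn⁻ U xs x∈ =
          ∈-filter⁺ P? (∈-allFin _) (lookup⇒[]= _ U eq , ∈-children⁻ p (∈-resp-↭ c (∈-map⁺ rootOf x∈′)))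

        from : ∀ {k} → k ∈ filter P? (allFin n) → k ∈ roots (rootsIn U xs)
        from k∈ with _ , k∈U , eq ← ∈-filter⁻ P? {xs = allFin n} k∈
          with x , x∈ , refl ← ∈-map⁻ rootOf (∈-resp-↭ (↭-sym c) (∈-children⁺ p eq)) =
          ∈-map⁺ rootOf (∈-rootsIn⁺ U xs x∈ ([]=⇒lookup k∈U))

      -- `shapeIn` lists the children inside U in the order of `Fin n`, the plane ordering in its
      -- own. The two lists are permutations of each other, hence an equivalence and not an equality
      -- of trees.
      shapeIn-kept : ∀ U f {l xs} → roots xs ↭ children p l → Real p xs → suc (sizeF (shapeF xs)) ≤ f →
                     shapeIn p U f l ≃ᵀ node (keptF (decorate U xs))
      shapeIn-kept U (suc f) {l} {xs} c R (s≤s p≤)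
        with zs , eq , q ← ↭-map-inv rootOf (rootsIn-children U {xs = xs} c)
        rewrite eq | keptF-rootsIn U xs
        = node (pointwise zs (λ z∈ → proj₁ (∈-rootsIn⁻ U xs (∈-resp-↭ (↭-sym q) z∈)))) (Perm.map⁺ (keptTree U) (↭-sym q))
        where
        pointwise : ∀ zs → (∀ {z} → z ∈ zs → z ∈ xs) →
                    Pointwise _≃ᵀ_ (map (shapeIn p U f) (map rootOf zs)) (map (keptTree U) zs)
        pointwise []                 h = []
        pointwise (branch k ws ∷ zs) h with c′ , R′ , q≤ ← real-∈ R (h (here refl)) =
          shapeIn-kept U f c′ R′ (ℕ.≤-trans q≤ p≤) ∷ pointwise zs (λ z∈ → h (there z∈))

      shapeIn-⊤ : ∀ f {l xs} → roots xs ↭ children p l → Real p xs → suc (sizeF (shapeF xs)) ≤ f →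
                  shapeIn p ⊤ f l ≃ᵀ node (shapeF xs)
      shapeIn-⊤ f {l} {xs} c R p≤ = subst (λ ts → shapeIn p ⊤ f l ≃ᵀ node ts) (keptF-⊤ xs) (shapeIn-kept ⊤ f c R p≤)

      decorate-∈ : ∀ {U} → ClosedUnder p U → ∀ {ys} → Real p ys → decorate U ys ∈ prunings ys
      decorate-∈ {U} cl []                       = here refl
      decorate-∈ {U} cl (cons {l} {xs} {ys} c R S) = ∈-cartesianProductWith⁺ _∷_ first (decorate-∈ cl S)
        where
        first : branch (l , lookup U l) (decorate U xs) ∈ branch (l , false) (offF xs) ∷ map (branch (l , true)) (prunings xs)
        first with lookup U l in eq
        ... | true  = there (∈-map⁺ (branch (l , true)) (decorate-∈ cl R))
        ... | false = here (cong (branch (l , false)) (decorate-off U xs λ {i} i∈ →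
          let j , i→j , j∉ = parents-outside p cl R (outside⇒∉ eq) (λ k∈ → ∈-children⁻ p (∈-resp-↭ c k∈)) i∈ in
          ∉⇒outside (λ i∈U → j∉ (cl i i∈U j i→j))))

      -- The converse of `decorate-∈`: nothing below a cut vertex is marked as kept, so a kept
      -- vertex has a kept parent.
      pruning-closed : ∀ {U ys l} → Real p ys → decorate U ys ∈ prunings ys →
        (∀ {k} → k ∈ roots ys → lookup p k ≡ just l) → l Subset.∈ U →
        ∀ {i j} → i ∈ labelsF ys → i Subset.∈ U → lookup p i ≡ just j → j Subset.∈ U
      pruning-closed {U} (cons {a} {zs} {ys} c R S) D∈ h l∈U i∈ i∈U i→j
        with ∈-cartesianProductWith⁻ _∷_ (branch (a , false) (offF zs) ∷ map (branch (a , true)) (prunings zs)) (prunings ys) D∈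
           | ∈-++⁻ (a ∷ labelsF zs) i∈
      ... | _ , _ , _ , D∈′ , refl | inj₂ i∈′ = pruning-closed S D∈′ (λ k∈ → h (there k∈)) l∈U i∈′ i∈U i→j
      ... | _ , _ , _ , _ , refl | inj₁ (here refl) with refl ← just-injective (trans (sym (h (here refl))) i→j) = l∈U
      ... | _ , _ , here eq , _ , refl | inj₁ (there i∈′) =
        ⊥-elim (outside⇒∉ (offF-outside {U} zs (cong subforest eq) i∈′) i∈U)
      ... | _ , _ , there d∈ , _ , refl | inj₁ (there i∈′) with E , E∈ , eq ← ∈-map⁻ (branch (a , true)) d∈ =
        pruning-closed R (subst (_∈ prunings zs) (sym (cong subforest eq)) E∈) (λ k∈ → ∈-children⁻ p (∈-resp-↭ c k∈))
          (lookup⇒[]= a U (cong (λ x → proj₂ (rootOf x)) eq)) i∈′ i∈U i→j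

    module _ (T : LTree n) {xs : List (Plane (Fin n))} (c : roots xs ↭ children (parent T) (root T))
             (R : Real (parent T) xs) (L : root T ∷ labelsF xs ↭ allFin n) where
      private
        p = parent T
        r = root T

      rooted : List (Subset n)
      rooted = filter (isRootedSubtree? T) (allSubsets n)

      ∈-rooted⁻ : ∀ {U} → U ∈ rooted → IsRootedSubtree T U
      ∈-rooted⁻ U∈ = proj₂ (∈-filter⁻ (isRootedSubtree? T) {xs = allSubsets n} U∈)

      -- The bijection between rooted subtrees and markings. The root belongs to every nonempty
      -- rooted subtree, so only the forest `xs` below it is marked.
      rooted-prunings : map (λ U → decorate U xs) rooted ↭ prunings xs
      rooted-prunings = unique⇒↭
        (unique-map-∈ (Unique.filter⁺ (isRootedSubtree? T) (allVecs-unique bools-unique n)) injective)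
        (prunings-unique xs) to from
        where
        bools-unique : Unique (inside ∷ outside ∷ [])
        bools-unique = ((λ ()) ∷ []) ∷ [] ∷ []

        injective : ∀ {U V} → U ∈ rooted → V ∈ rooted → decorate U xs ≡ decorate V xs → U ≡ V
        injective {U} {V} U∈ V∈ eq = lookup-ext same
          where
          same : ∀ i → lookup U i ≡ lookup V i
          same i with ∈-resp-↭ (↭-sym L) (∈-allFin i)
          ... | here refl = trans ([]=⇒lookup (proj₁ (∈-rooted⁻ U∈))) (sym ([]=⇒lookup (proj₁ (∈-rooted⁻ V∈))))
          ... | there i∈  = decorate-injective xs eq i∈

        to : ∀ {D} → D ∈ map (λ U → decorate U xs) rooted → D ∈ prunings xs
        to D∈ with U , U∈ , refl ← ∈-map⁻ _ D∈ = decorate-∈ p (proj₂ (∈-rooted⁻ U∈)) R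

        from : ∀ {D} → D ∈ prunings xs → D ∈ map (λ U → decorate U xs) rooted
        from {D} D∈ = subst (_∈ map (λ U → decorate U xs) rooted) U-D
          (∈-map⁺ (λ U → decorate U xs) (∈-filter⁺ (isRootedSubtree? T)
            (∈-allVecs U (λ i → bool∈ (lookup U i))) (r∈U , closed)))
          where
          marks : List (Fin n × Bool)
          marks = (r , true) ∷ labelsF D

          U : Subset n
          -- The default `false` is never reached, since every vertex is a key of `marks`.
          U = tabulate (λ i → fromMaybe false (assoc marks i))

          bool∈ : ∀ b → b ∈ inside ∷ outside ∷ []
          bool∈ true  = here refl
          bool∈ false = there (here refl)

          keys : map proj₁ marks ≡ r ∷ labelsF xs
          keys = cong (r ∷_) (trans (sym (labelsF-eraseF D)) (cong labelsF (eraseF-prunings xs D∈)))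

          U-marks : ∀ {i b} → (i , b) ∈ marks → lookup U i ≡ b
          U-marks {i} ib∈ = trans (lookup∘tabulate (λ i → fromMaybe false (assoc marks i)) i)
            (cong (fromMaybe false) (∈-assoc marks (subst Unique (sym keys) (unique-↭ (↭-sym L) (Unique.allFin⁺ n))) ib∈))

          U-D : decorate U xs ≡ D
          U-D = trans (cong (decorate U) (sym (eraseF-prunings xs D∈))) (decorate-eraseF U D (λ ib∈ → U-marks (there ib∈)))

          r∈U : r Subset.∈ U
          r∈U = lookup⇒[]= r U (U-marks (here refl))

          closed : ClosedUnder p U
          closed i i∈U j i→j with ∈-resp-↭ (↭-sym L) (∈-allFin i)
          ... | here refl with () ← trans (sym (proj₁ (proj₁ (isTree T)))) i→j
          ... | there i∈ = pruning-closed p R (subst (_∈ prunings xs) (sym U-D) D∈)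
            (λ k∈ → ∈-children⁻ p (∈-resp-↭ c k∈)) r∈U i∈ i∈U i→j

-- Reduction of the labelled sums to plane trees

module Labelled {c ℓ} (R : CommutativeRing c ℓ) (recip : ℕ → CommutativeRing.Carrier R)
  (inverse : ∀ n → CommutativeRing._≈_ R
     (CommutativeRing._*_ R (WithRing.natR R recip (suc n)) (recip (suc n))) (CommutativeRing.1# R)) where
  open CommutativeRing R hiding (zero)
  open WithRing R recip
  open Sums R
  open Taylor R recip inverse using (invFact-×)
  open SetoidReasoning setoid
  open import Algebra.Properties.Monoid.Mult +-monoid using (×-congˡ; ×-congʳ) renaming (_×_ to _·_)
  open import Algebra.Properties.Semiring.Mult semiring using (×-comm-*)

  symWeightF : List Tree → Carrier
  symWeightF []             = 1#
  symWeightF (node us ∷ ts) = (invFact (length us) * symWeightF us) * symWeightF ts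

  symWeight : Tree → Carrier
  symWeight (node ts) = invFact (length ts) * symWeightF ts

  sum-const : ∀ {A : Set} (xs : List A) a → sum xs (λ _ → a) ≈ length xs · a
  sum-const []       a = refl
  sum-const (x ∷ xs) a = +-congˡ (sum-const xs a)

  module _ {n : ℕ} (p : Parent n) where

    -- The d children of a vertex can be ordered in d! ways, each weighted by 1/d!, and the choices
    -- at different vertices are independent.
    orders-weight : ∀ f {j} → Below p f j → sum (orders p f j) (λ x → symWeight (shape x)) ≈ 1#
    sequence-weight : ∀ f ks → (∀ {k} → k ∈ ks → Below p f k) →
                      sum (sequence p (orders p f) ks) (λ xs → symWeightF (shapeF xs)) ≈ 1#

    orders-weight (suc f) {j} (below B) = begin
      sum (map (branch j) seqs) (λ x → symWeight (shape x))
        ≡⟨ sum-map (branch j) seqs _ ⟩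
      sum seqs (λ xs → invFact (length (shapeF xs)) * symWeightF (shapeF xs))
        ≈⟨ sum-concatMap (sequence p (orders p f)) (perms (children p j)) _ ⟩
      sum (perms (children p j)) (λ ks → sum (sequence p (orders p f) ks)
        (λ xs → invFact (length (shapeF xs)) * symWeightF (shapeF xs)))
        ≈⟨ sum-cong-∈ (perms (children p j)) inner ⟩
      sum (perms (children p j)) (λ _ → invFact d)
        ≈⟨ sum-const (perms (children p j)) _ ⟩
      length (perms (children p j)) · invFact d
        ≈⟨ ×-congˡ (length-perms (children p j)) ⟩
      (d !) · invFact d
        ≈⟨ ×-congʳ (d !) (*-identityʳ _) ⟨
      (d !) · (invFact d * 1#)
        ≈⟨ invFact-× d 1# ⟩
      1#
        ∎
      where
      d = length (children p j)
      seqs = concatMap (sequence p (orders p f)) (perms (children p j))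

      inner : ∀ {ks} → ks ∈ perms (children p j) → sum (sequence p (orders p f) ks)
        (λ xs → invFact (length (shapeF xs)) * symWeightF (shapeF xs)) ≈ invFact d
      inner {ks} ks∈ = begin
        sum (sequence p (orders p f) ks) (λ xs → invFact (length (shapeF xs)) * symWeightF (shapeF xs))
          ≈⟨ sum-cong-∈ (sequence p (orders p f) ks) (λ {xs} xs∈ → *-congʳ (reflexive (cong invFact (len xs∈)))) ⟩
        sum (sequence p (orders p f) ks) (λ xs → invFact d * symWeightF (shapeF xs))
          ≈⟨ *-distribˡ-sum (sequence p (orders p f) ks) (invFact d) _ ⟨
        invFact d * sum (sequence p (orders p f) ks) (λ xs → symWeightF (shapeF xs))
          ≈⟨ *-congˡ (sequence-weight f ks (λ k∈ → B _ (∈-children⁻ p (∈-resp-↭ ks↭ k∈)))) ⟩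
        invFact d * 1#
          ≈⟨ *-identityʳ _ ⟩
        invFact d
          ∎
        where
        ks↭ = ∈-perms⁻ (children p j) ks∈

        len : ∀ {xs} → xs ∈ sequence p (orders p f) ks → length (shapeF xs) ≡ d
        len {xs} xs∈ = ≡.trans (length-shapeF xs) (≡.trans (≡.sym (List.length-map rootOf xs))
          (≡.trans (cong length (proj₁ (∈-sequence⁻ p f ks xs∈))) (↭-length ks↭)))

    sequence-weight f []       B = +-identityʳ _
    sequence-weight f (k ∷ ks) B = begin
      sum (cartesianProductWith _∷_ (orders p f k) (sequence p (orders p f) ks)) (λ xs → symWeightF (shapeF xs))
        ≈⟨ sum-cartesianProductWith _∷_ (orders p f k) (sequence p (orders p f) ks) _ ⟩
      sum (orders p f k) (λ x → sum (sequence p (orders p f) ks) (λ xs → symWeightF (shapeF (x ∷ xs))))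
        ≈⟨ sum-cong (orders p f k) (λ { (branch l zs) → sym (*-distribˡ-sum (sequence p (orders p f) ks) _ _) }) ⟩
      sum (orders p f k) (λ x → symWeight (shape x) * sum (sequence p (orders p f) ks) (λ xs → symWeightF (shapeF xs)))
        ≈⟨ sum-cong (orders p f k) (λ x → trans (*-congˡ (sequence-weight f ks (λ k∈ → B (there k∈)))) (*-identityʳ _)) ⟩
      sum (orders p f k) (λ x → symWeight (shape x))
        ≈⟨ orders-weight f (B (here ≡.refl)) ⟩
      1#
        ∎

  -- Each T is replaced by its plane orderings, of total weight 1. Regrouped by shape, every shape
  -- occurs n! times, which cancels 1/n!. The hypothesis says that Φ can be computed from the shape
  -- of any ordering.
  sum-labeledTrees : ∀ k (Φ : LTree (suc k) → Carrier) (Ψ : Tree → Carrier) →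
    (∀ T x → rootOf x ≡ root T → Real (parent T) [ x ] → labels x ↭ allFin (suc k) → Φ T ≈ Ψ (shape x)) →
    invFact (suc k) * sum (labeledTrees (suc k)) Φ ≈ sum (trees (suc k)) (λ t → symWeight t * Ψ t)
  sum-labeledTrees k Φ Ψ h = begin
    invFact n * sum (labeledTrees n) Φ
      ≈⟨ *-congˡ (sum-cong (labeledTrees n) per-tree) ⟩
    invFact n * sum (labeledTrees n) (λ T → sum (orders (parent T) n (root T)) (λ x → weighted (shape x)))
      ≈⟨ *-congˡ (sum-concatMap (λ T → orders (parent T) n (root T)) (labeledTrees n) _) ⟨
    invFact n * sum (byTree k) (λ x → weighted (shape x))
      ≈⟨ *-congˡ (sum-↭ _ (byTree-byShape k)) ⟩
    invFact n * sum (byShape k) (λ x → weighted (shape x))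
      ≈⟨ *-congˡ (sum-concatMap (λ t → map (fill Fin.zero t) (perms (allFin n))) (trees n) _) ⟩
    invFact n * sum (trees n) (λ t → sum (map (fill Fin.zero t) (perms (allFin n))) (λ x → weighted (shape x)))
      ≈⟨ *-congˡ (sum-cong-∈ (trees n) per-shape) ⟩
    invFact n * sum (trees n) (λ t → (n !) · weighted t)
      ≈⟨ *-distribˡ-sum (trees n) _ _ ⟩
    sum (trees n) (λ t → invFact n * ((n !) · weighted t))
      ≈⟨ sum-cong (trees n) (λ t → trans (×-comm-* (n !) _ _) (invFact-× n (weighted t))) ⟩
    sum (trees n) weighted
      ∎
    where
    n = suc k

    weighted : Tree → Carrier
    weighted t = symWeight t * Ψ t

    per-tree : ∀ T → Φ T ≈ sum (orders (parent T) n (root T)) (λ x → weighted (shape x))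
    per-tree T = begin
      Φ T
        ≈⟨ *-identityˡ _ ⟨
      1# * Φ T
        ≈⟨ *-congʳ (orders-weight (parent T) n (tree-below (parent T) (isTree T))) ⟨
      sum (orders (parent T) n (root T)) (λ x → symWeight (shape x)) * Φ T
        ≈⟨ *-distribʳ-sum (orders (parent T) n (root T)) _ _ ⟩
      sum (orders (parent T) n (root T)) (λ x → symWeight (shape x) * Φ T)
        ≈⟨ sum-cong-∈ (orders (parent T) n (root T)) (λ {x} x∈ →
             let eq , R = ∈-orders⁻ (parent T) n x∈ in *-congˡ (h T x eq R (orders-labels k T x∈))) ⟩
      sum (orders (parent T) n (root T)) (λ x → weighted (shape x))
        ∎

    per-shape : ∀ {t} → t ∈ trees n →
                sum (map (fill Fin.zero t) (perms (allFin n))) (λ x → weighted (shape x)) ≈ (n !) · weighted t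
    per-shape {t} t∈ = begin
      sum (map (fill Fin.zero t) (perms (allFin n))) (λ x → weighted (shape x))
        ≡⟨ sum-map (fill Fin.zero t) (perms (allFin n)) _ ⟩
      sum (perms (allFin n)) (λ ls → weighted (shape (fill Fin.zero t ls)))
        ≈⟨ sum-cong-∈ (perms (allFin n)) (λ {ls} ls∈ →
             reflexive (cong weighted (shape-fill Fin.zero t ls (fits k t∈ ls∈)))) ⟩
      sum (perms (allFin n)) (λ _ → weighted t)
        ≈⟨ sum-const (perms (allFin n)) _ ⟩
      length (perms (allFin n)) · weighted t
        ≈⟨ ×-congˡ (≡.trans (length-perms (allFin n)) (cong _! (length-tabulate {n = n} id))) ⟩
      (n !) · weighted t
        ∎

-- Vertex products and the convolution on plane shapes

module Products {c ℓ} (R : CommutativeRing c ℓ) where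
  open CommutativeRing R hiding (zero)
  open Sums R using (*-swapˡ)
  open SetoidReasoning setoid

  prod : {A : Set} → List A → (A → Carrier) → Carrier
  prod []       f = 1#
  prod (x ∷ xs) f = f x * prod xs f

  -- Putting 1 for a missing factor turns a product over a filtered list into one over all vertices,
  -- which can be permuted and split along a plane ordering.
  _given_ : {P : Set} → Carrier → Dec P → Carrier
  v given (yes _) = v
  v given (no _)  = 1#

  given-yes : ∀ {P : Set} (d : Dec P) {v} → P → v given d ≈ v
  given-yes (yes _) p = refl
  given-yes (no ¬p) p = ⊥-elim (¬p p)

  given-no : ∀ {P : Set} (d : Dec P) {v} → ¬ P → v given d ≈ 1#
  given-no (yes p) ¬p = ⊥-elim (¬p p)
  given-no (no _)  ¬p = refl

  module _ {A : Set} where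

    prod-one : ∀ xs {f : A → Carrier} → (∀ {x} → x ∈ xs → f x ≈ 1#) → prod xs f ≈ 1#
    prod-one []       h = refl
    prod-one (x ∷ xs) h = trans (*-cong (h (here ≡.refl)) (prod-one xs (λ x∈ → h (there x∈)))) (*-identityˡ 1#)

    prod-++ : ∀ xs ys (f : A → Carrier) → prod (xs ++ ys) f ≈ prod xs f * prod ys f
    prod-++ []       ys f = sym (*-identityˡ _)
    prod-++ (x ∷ xs) ys f = trans (*-congˡ (prod-++ xs ys f)) (sym (*-assoc _ _ _))

    prod-↭ : ∀ {xs ys} (f : A → Carrier) → xs ↭ ys → prod xs f ≈ prod ys f
    prod-↭ f Perm.refl         = refl
    prod-↭ f (Perm.prep x p)   = *-congˡ (prod-↭ f p)
    prod-↭ f (Perm.swap x y p) = trans (*-swapˡ _ _ _) (*-congˡ (*-congˡ (prod-↭ f p)))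
    prod-↭ f (Perm.trans p q)  = trans (prod-↭ f p) (prod-↭ f q)

    prod-filter : ∀ {P : A → Set} (P? : Decidable P) xs (f : A → Carrier) →
                  prod (filter P? xs) f ≈ prod xs (λ x → f x given P? x)
    prod-filter P? []       f = refl
    prod-filter P? (x ∷ xs) f with P? x
    ... | yes _ = *-congˡ (prod-filter P? xs f)
    ... | no  _ = trans (prod-filter P? xs f) (sym (*-identityˡ _))

module PrunedSum {c ℓ} (R : CommutativeRing c ℓ) (α : Tree → CommutativeRing.Carrier R) where
  open CommutativeRing R hiding (zero)
  open Sums R
  open Cut R α
  open SetoidReasoning setoid
  open import Algebra.Solver.Ring.NaturalCoefficients.Default commutativeSemiring using (solve; _:=_; _:*_)

  -- The recursion stops at a vertex marked `false` and takes its entire subtree as one factor;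
  -- these subtrees are the trees of the difference forest.
  cutProd : {A : Set} → List (Plane (A × Bool)) → Carrier
  cutProd []                           = 1#
  cutProd (branch (l , true)  xs ∷ ys) = cutProd xs * cutProd ys
  cutProd (branch (l , false) xs ∷ ys) = α (node (shapeF xs)) * cutProd ys

  sum-prunings : ∀ {A : Set} (xs : List (Plane A)) B →
    sum (prunings xs) (λ D → B (keptF D) * cutProd D) ≈ cutSum (shapeF xs) B
  sum-prunings []                 B = trans (+-identityʳ _) (*-identityʳ _)
  sum-prunings (branch l xs ∷ ys) B = begin
    sum (prunings (branch l xs ∷ ys)) (λ D → B (keptF D) * cutProd D)
      ≈⟨ sum-cartesianProductWith _∷_ (off ∷ map on (prunings xs)) (prunings ys) _ ⟩
    sum (off ∷ map on (prunings xs)) (λ d → sum (prunings ys) (λ E → B (keptF (d ∷ E)) * cutProd (d ∷ E)))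
      ≈⟨ +-cong cut (trans (reflexive (sum-map on (prunings xs) _)) kept) ⟩
    cutSum (shapeF (branch l xs ∷ ys)) B
      ∎
    where
    off = branch (l , false) (offF xs)
    on  = branch (l , true)

    cut : sum (prunings ys) (λ E → B (keptF E) * (α (node (shapeF (offF xs))) * cutProd E))
          ≈ α (node (shapeF xs)) * cutSum (shapeF ys) B
    cut = begin
      sum (prunings ys) (λ E → B (keptF E) * (α (node (shapeF (offF xs))) * cutProd E))
        ≈⟨ sum-cong (prunings ys) (λ E → trans
             (*-swapˡ _ _ _)
             (*-congʳ (reflexive (cong (λ ts → α (node ts)) (shapeF-offF xs))))) ⟩
      sum (prunings ys) (λ E → α (node (shapeF xs)) * (B (keptF E) * cutProd E))
        ≈⟨ *-distribˡ-sum (prunings ys) _ _ ⟨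
      α (node (shapeF xs)) * sum (prunings ys) (λ E → B (keptF E) * cutProd E)
        ≈⟨ *-congˡ (sum-prunings ys B) ⟩
      α (node (shapeF xs)) * cutSum (shapeF ys) B
        ∎

    kept : sum (prunings xs) (λ D → sum (prunings ys) (λ E → B (node (keptF D) ∷ keptF E) * (cutProd D * cutProd E)))
           ≈ cutSum (shapeF xs) (λ ls → cutSum (shapeF ys) (λ ks → B (node ls ∷ ks)))
    kept = begin
      sum (prunings xs) (λ D → sum (prunings ys) (λ E → B (node (keptF D) ∷ keptF E) * (cutProd D * cutProd E)))
        ≈⟨ sum-cong (prunings xs) (λ D → sum-cong (prunings ys) (λ E →
             solve 3 (λ x y z → x :* (y :* z) := (x :* z) :* y) refl _ _ _)) ⟩
      sum (prunings xs) (λ D → sum (prunings ys) (λ E → (B (node (keptF D) ∷ keptF E) * cutProd E) * cutProd D))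
        ≈⟨ sum-cong (prunings xs) (λ D → trans (sym (*-distribʳ-sum (prunings ys) (cutProd D) _))
             (*-congʳ (sum-prunings ys (λ ks → B (node (keptF D) ∷ ks))))) ⟩
      sum (prunings xs) (λ D → cutSum (shapeF ys) (λ ks → B (node (keptF D) ∷ ks)) * cutProd D)
        ≈⟨ sum-prunings xs _ ⟩
      cutSum (shapeF xs) (λ ls → cutSum (shapeF ys) (λ ks → B (node ls ∷ ks)))
        ∎

module Shapes {c ℓ} (R : CommutativeRing c ℓ) (recip : ℕ → CommutativeRing.Carrier R)
  (inverse : ∀ n → CommutativeRing._≈_ R
     (CommutativeRing._*_ R (WithRing.natR R recip (suc n)) (recip (suc n))) (CommutativeRing.1# R)) where
  open CommutativeRing R hiding (zero)
  open WithRing R recip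
  open Sums R
  open Products R
  open PowerSeries R
  open Composition R recip inverse
  open SetoidReasoning setoid
  private
    module S = CommutativeRing seriesRing
    module SP = Products seriesRing

  prodS-prod : ∀ {A : Set} (f : A → PS) xs → prodS (map f xs) ≋ SP.prod xs f
  prodS-prod f []       m = oneS-const m
  prodS-prod f (x ∷ xs) m = trans (⊛-⊗ (f x) (prodS (map f xs)) m) (S.*-congˡ {f x} (prodS-prod f xs) m)

  prodL-prod : ∀ {A : Set} (f : A → Carrier) xs → prodL (map f xs) ≡ prod xs f
  prodL-prod f []       = ≡.refl
  prodL-prod f (x ∷ xs) = cong (f x *_) (prodL-prod f xs)

  derivWeightF : PS → List Tree → PS
  derivWeightF β []             = const 1#
  derivWeightF β (node us ∷ ts) = (derivIter (length us) β ⊗ derivWeightF β us) ⊗ derivWeightF β ts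

  derivWeight : PS → Tree → PS
  derivWeight β (node ts) = derivIter (length ts) β ⊗ derivWeightF β ts

  module _ {n : ℕ} (p : Parent n) (β : PS) where

    children-length : ∀ {l xs} → roots xs ↭ children p l → length (children p l) ≡ length (shapeF xs)
    children-length {xs = xs} c =
      ≡.trans (≡.sym (↭-length c)) (≡.trans (length-map rootOf xs) (≡.sym (length-shapeF xs)))

    prod-degrees : ∀ {xs} → Real p xs → SP.prod (labelsF xs) (λ l → derivIter (length (children p l)) β) ≋ derivWeightF β (shapeF xs)
    prod-degrees []                         = S.refl
    prod-degrees (cons {l} {xs} {ys} c R S) = S.trans (SP.prod-++ (l ∷ labelsF xs) (labelsF ys) _)
      (S.*-cong (S.*-cong (S.reflexive (cong (λ d → derivIter d β) (children-length c))) (prod-degrees R)) (prod-degrees S))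

  fT-shape : ∀ {n} β (T : LTree n) x → rootOf x ≡ root T → Real (parent T) [ x ] → labels x ↭ allFin n →
             fT β T ≋ derivWeight β (shape x)
  fT-shape {n} β T (branch r xs) ≡.refl (cons c R []) L = S.trans (prodS-prod (λ l → derivIter (degree T l) β) (allFin n))
    (S.trans (SP.prod-↭ _ (↭-sym L))
    (S.*-cong (S.reflexive (cong (λ d → derivIter d β) (children-length (parent T) β c))) (prod-degrees (parent T) β R)))

  size-bound : ∀ {n r} (xs : List (Plane (Fin n))) → r ∷ labelsF xs ↭ allFin n → suc (sizeF (shapeF xs)) ≤ n
  size-bound xs L = ℕ.≤-reflexive (≡.trans (cong suc (≡.sym (length-labelsF xs))) (≡.trans (↭-length L) (length-tabulate id)))

  onTrees-shape : ∀ {n} (a : Coef) → Invariant a → (T : LTree n) → ∀ x → rootOf x ≡ root T → Real (parent T) [ x ] →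
                  labels x ↭ allFin n → onTrees a T ≈ a (just (shape x))
  onTrees-shape {n} a inv T (branch r xs) ≡.refl (cons c R []) L = inv (shapeIn-⊤ (parent T) n c R (size-bound xs L))

  module _ (a b : Coef) (a-inv : Invariant a) (b-inv : Invariant b) where
    open Cut R (λ t → a (just t))
    open PrunedSum R (λ t → a (just t))

    -- The empty subtree has its own term because `cutSum`, applied to the children, always keeps
    -- the root.
    convShape : Tree → Carrier
    convShape (node ts) = b nothing * a (just (node ts)) + cutSum ts (λ ks → b (just (node ks)))

    module _ {n} (T : LTree n) {U : Subset n} (closed : ClosedUnder (parent T) U) where
      private
        p = parent T

      cutFactor : Fin n → Carrier
      cutFactor j = a (just (subtreeShape T j)) given inDiff? T U j

      cutFactor-inside : ∀ {j} → j Subset.∈ U → cutFactor j ≈ 1#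
      cutFactor-inside {j} j∈U = given-no (inDiff? T U j) (λ d → proj₁ d j∈U)

      cutFactor-below : ∀ {j k} → lookup p j ≡ just k → k Subset.∉ U → cutFactor j ≈ 1#
      cutFactor-below {j} eq k∉U = given-no (inDiff? T U j) λ { (_ , k′ , k′∈U , eq′) →
        k∉U (subst (Subset._∈ U) (just-injective (≡.trans (≡.sym eq′) eq)) k′∈U) }

      -- As l lies in U, a root k of the forest is a root of the difference forest exactly when it
      -- is outside U. Below such a k every parent is outside U, so all further factors are 1.
      prod-cutFactor : ∀ {l ys} → Real p ys → sizeF (shapeF ys) ≤ n → l Subset.∈ U →
        (∀ {k} → k ∈ roots ys → lookup p k ≡ just l) → prod (labelsF ys) cutFactor ≈ cutProd (decorate U ys)
      prod-cutFactor []                         p≤ l∈U h = refl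
      prod-cutFactor {l} (cons {k} {zs} {ys} c R S) p≤ l∈U h = trans (prod-++ (k ∷ labelsF zs) (labelsF ys) cutFactor) split
        where
        rest : prod (labelsF ys) cutFactor ≈ cutProd (decorate U ys)
        rest = prod-cutFactor S (ℕ.≤-trans (ℕ.m≤n+m _ _) p≤) l∈U (λ k∈ → h (there k∈))

        z≤ : suc (sizeF (shapeF zs)) ≤ n
        z≤ = ℕ.≤-trans (s≤s (ℕ.m≤m+n _ _)) p≤

        child : ∀ {j} → j ∈ roots zs → lookup p j ≡ just k
        child j∈ = ∈-children⁻ p (∈-resp-↭ c j∈)

        off-shape : shapeF (decorate U zs) ≡ shapeF zs
        off-shape = shapeF-decorate U zs

        split : prod (k ∷ labelsF zs) cutFactor * prod (labelsF ys) cutFactor ≈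
                cutProd (branch (k , lookup U k) (decorate U zs) ∷ decorate U ys)
        split with lookup U k in eq
        ... | true = *-cong
          (trans (*-congʳ (cutFactor-inside k∈U)) (trans (*-identityˡ _)
            (prod-cutFactor R (ℕ.≤-trans (ℕ.n≤1+n _) z≤) k∈U child)))
          rest
          where k∈U = lookup⇒[]= k U eq
        ... | false = *-cong
          (trans (*-cong
            (trans (given-yes (inDiff? T U k) (outside⇒∉ eq , l , l∈U , h (here ≡.refl)))
              (trans (a-inv (shapeIn-⊤ p n c R z≤)) (reflexive (cong (λ ts → a (just (node ts))) (≡.sym off-shape)))))
            (prod-one (labelsF zs) (λ i∈ →
              let j , i→j , j∉U = parents-outside p closed R (outside⇒∉ eq) child i∈ in cutFactor-below i→j j∉U)))
            (*-identityʳ _))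
          rest

    conv-shape : ∀ {n} (T : LTree n) x → rootOf x ≡ root T → Real (parent T) [ x ] → labels x ↭ allFin n →
                 conv a b T ≈ convShape (shape x)
    conv-shape {n} T x@(branch r xs) ≡.refl R′@(cons c R []) L = +-cong
      (*-congˡ (onTrees-shape a a-inv T x ≡.refl R′ L)) (begin
      sumL (map term (filter (isRootedSubtree? T) (allSubsets n)))
        ≡⟨ sumL-map term (rooted T c R L) ⟩
      sum (rooted T c R L) term
        ≈⟨ sum-cong-∈ (rooted T c R L) (λ U∈ → term-decorate (∈-rooted⁻ T c R L U∈)) ⟩
      sum (rooted T c R L) (λ U → weight (decorate U xs))
        ≡⟨ sum-map (λ U → decorate U xs) (rooted T c R L) weight ⟨
      sum (map (λ U → decorate U xs) (rooted T c R L)) weight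
        ≈⟨ sum-↭ weight (rooted-prunings T c R L) ⟩
      sum (prunings xs) weight
        ≈⟨ sum-prunings xs (λ ks → b (just (node ks))) ⟩
      cutSum (shapeF xs) (λ ks → b (just (node ks)))
        ∎)
      where
      p = parent T

      term : Subset n → Carrier
      term U = b (just (restrictShape T U r)) * prodCoef a (diffForest T U)

      weight : List (Plane (Fin n × Bool)) → Carrier
      weight D = b (just (node (keptF D))) * cutProd D

      term-decorate : ∀ {U} → IsRootedSubtree T U → term U ≈ weight (decorate U xs)
      term-decorate {U} (r∈U , closed) = *-cong
        (b-inv (shapeIn-kept p U n c R (size-bound xs L))) (begin
        prodL (map (λ t → a (just t)) (map (subtreeShape T) (filter (inDiff? T U) (allFin n))))
          ≡⟨ cong prodL (≡.sym (List.map-∘ (filter (inDiff? T U) (allFin n)))) ⟩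
        prodL (map (λ j → a (just (subtreeShape T j))) (filter (inDiff? T U) (allFin n)))
          ≡⟨ prodL-prod _ (filter (inDiff? T U) (allFin n)) ⟩
        prod (filter (inDiff? T U) (allFin n)) (λ j → a (just (subtreeShape T j)))
          ≈⟨ prod-filter (inDiff? T U) (allFin n) _ ⟩
        prod (allFin n) (cutFactor T closed)
          ≈⟨ prod-↭ (cutFactor T closed) L ⟨
        cutFactor T closed r * prod (labelsF xs) (cutFactor T closed)
          ≈⟨ *-congʳ (cutFactor-inside T closed r∈U) ⟩
        1# * prod (labelsF xs) (cutFactor T closed)
          ≈⟨ *-identityˡ _ ⟩
        prod (labelsF xs) (cutFactor T closed)
          ≈⟨ prod-cutFactor T closed R (ℕ.≤-trans (ℕ.n≤1+n _) (size-bound xs L)) r∈U (λ k∈ → ∈-children⁻ p (∈-resp-↭ c k∈)) ⟩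
        cutProd (decorate U xs)
          ∎)

-- Assembly of the composition formula

module CompositionTheorem {c ℓ} (R : CommutativeRing c ℓ) (recip : ℕ → CommutativeRing.Carrier R)
  (inverse : ∀ n → CommutativeRing._≈_ R
     (CommutativeRing._*_ R (WithRing.natR R recip (suc n)) (recip (suc n))) (CommutativeRing.1# R))
  (β : WithRing.PS R recip) (a b : WithRing.Coef R recip)
  (a-inv : WithRing.Invariant R recip a) (b-inv : WithRing.Invariant R recip b) where
  open CommutativeRing R hiding (zero)
  open WithRing R recip
  open Sums R
  open PowerSeries R
  open Composition R recip inverse
  open Labelled R recip inverse
  open Shapes R recip inverse
  open Cut R (λ t → a (just t))
  open SetoidReasoning setoid
  private
    module S = CommutativeRing seriesRing
    module SS = Sums seriesRing
    module PS = PowerSeries seriesRing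
    module P = CommutativeRing PS.seriesRing
    module SCut = Cut seriesRing (λ t → const (a (just t)))
  open PrunedForests seriesRing (λ t → const (a (just t))) (scaledDeriv β)
    using (h; weight; composedWeight; pruned; composed; pruned-composed)

  treeWeight : List Tree → PS
  treeWeight us = scaledDeriv β (length us) ⊗ weight us

  weight-split : ∀ ts m → weight ts m ≈ symWeightF ts * derivWeightF β ts m
  treeWeight-split : ∀ ts m → treeWeight ts m ≈ symWeight (node ts) * derivWeight β (node ts) m

  ⊗-scale₂ : ∀ x y F G m → ((λ i → x * F i) ⊗ (λ i → y * G i)) m ≈ (x * y) * (F ⊗ G) m
  ⊗-scale₂ x y F G m = begin
    ((λ i → x * F i) ⊗ (λ i → y * G i)) m    ≈⟨ ⊗-scaleˡ x F (λ i → y * G i) m ⟩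
    x * (F ⊗ (λ i → y * G i)) m              ≈⟨ *-congˡ (⊗-scaleʳ y F G m) ⟩
    x * (y * (F ⊗ G) m)                      ≈⟨ *-assoc _ _ _ ⟨
    (x * y) * (F ⊗ G) m                      ∎

  treeWeight-split ts m = begin
    (scaledDeriv β (length ts) ⊗ weight ts) m
      ≈⟨ S.*-congˡ {scaledDeriv β (length ts)} (weight-split ts) m ⟩
    (scaledDeriv β (length ts) ⊗ (λ m → symWeightF ts * derivWeightF β ts m)) m
      ≈⟨ ⊗-scale₂ _ _ (derivIter (length ts) β) (derivWeightF β ts) m ⟩
    symWeight (node ts) * derivWeight β (node ts) m
      ∎

  weight-split []             m = sym (*-identityˡ _)
  weight-split (node us ∷ ts) m = begin
    (treeWeight us ⊗ weight ts) m
      ≈⟨ S.*-cong (treeWeight-split us) (weight-split ts) m ⟩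
    ((λ m → symWeight (node us) * derivWeight β (node us) m) ⊗ (λ m → symWeightF ts * derivWeightF β ts m)) m
      ≈⟨ ⊗-scale₂ _ _ (derivWeight β (node us)) (derivWeightF β ts) m ⟩
    symWeightF (node us ∷ ts) * derivWeightF β (node us ∷ ts) m
      ∎

  -- Coefficient functions enter only through the plane shape, so f^a, f^b and f^c are treated
  -- alike. The k vertices below the root form the forest.
  fSeries-forests : ∀ cE (cL : ∀ {n} → LTree n → Carrier) (Ψ : Tree → Carrier) →
    (∀ {n} (T : LTree n) x → rootOf x ≡ root T → Real (parent T) [ x ] → labels x ↭ allFin n → cL T ≈ Ψ (shape x)) →
    ∀ k m → fSeries β cE cL (suc k) m ≈ sum (forests k) (λ us → Ψ (node us) * treeWeight us m)
  fSeries-forests cE cL Ψ Ψ-shape k m = begin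
    invFact (suc k) * sumL (map (λ T → cL T * fT β T m) (labeledTrees (suc k)))
      ≡⟨ cong (invFact (suc k) *_) (sumL-map (λ T → cL T * fT β T m) (labeledTrees (suc k))) ⟩
    invFact (suc k) * sum (labeledTrees (suc k)) (λ T → cL T * fT β T m)
      ≈⟨ sum-labeledTrees k _ (λ t → Ψ t * derivWeight β t m)
           (λ T x eq R L → *-cong (Ψ-shape T x eq R L) (fT-shape β T x eq R L m)) ⟩
    sum (map node (forests k)) (λ t → symWeight t * (Ψ t * derivWeight β t m))
      ≡⟨ sum-map node (forests k) _ ⟩
    sum (forests k) (λ us → symWeight (node us) * (Ψ (node us) * derivWeight β (node us) m))
      ≈⟨ sum-cong (forests k) (λ us → trans
           (*-swapˡ _ _ _)
           (*-congˡ (sym (treeWeight-split us m)))) ⟩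
    sum (forests k) (λ us → Ψ (node us) * treeWeight us m)
      ∎

  h-forests : ∀ k m → h k m ≈ sum (forests k) (λ us → a (just (node us)) * treeWeight us m)
  h-forests k m = trans (reflexive (sum-series (forests k) _ m))
    (sum-cong (forests k) (λ us → const-⊗ (a (just (node us))) (treeWeight us) m))

  cutSum-series : ∀ ts (B : List Tree → PS) m → SCut.cutSum ts B m ≈ cutSum ts (λ ks → B ks m)
  cutSum-series []             B m = refl
  cutSum-series (node us ∷ ts) B m = +-cong
    (trans (const-⊗ (a (just (node us))) (SCut.cutSum ts B) m) (*-congˡ (cutSum-series ts B m)))
    (trans (cutSum-series us _ m) (cutSum-cong us (λ ls → cutSum-series ts (λ ks → B (node ls ∷ ks)) m)))

  tri-only-last : ∀ n f → (∀ i j → f i (suc j) ≈ 0#) → tri n f ≈ f n 0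
  tri-only-last zero    f z = refl
  tri-only-last (suc n) f z = begin
    tri (suc n) f                            ≈⟨ tri-last n f ⟩
    f (suc n) 0 + tri n (λ i j → f i (suc j)) ≈⟨ +-congˡ (trans (tri-cong n z) (tri-zero n)) ⟩
    f (suc n) 0 + 0#                         ≈⟨ +-identityʳ _ ⟩
    f (suc n) 0                              ∎

  bNode : List Tree → Carrier
  bNode ks = b (just (node ks))

  -- The initial test function is constant in t and g; only the recursion produces test functions
  -- that are genuine series.
  bSeries : List Tree → PS2
  bSeries ks = PS.const (const (bNode ks))

  pruned-forests : ∀ k m → pruned bSeries (scaledDeriv β) k m ≈
                   sum (forests k) (λ us → cutSum us bNode * treeWeight us m)
  pruned-forests k m = begin
    pruned bSeries (scaledDeriv β) k m
      ≡⟨ tri-series k (λ i j → SS.sum (forests i) (λ ts → summand ts j)) m ⟩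
    tri k (λ i j → SS.sum (forests i) (λ ts → summand ts j) m)
      -- `bSeries` has no positive power of t, so only the forests with all k vertices survive.
      ≈⟨ tri-only-last k _ (λ i j → trans (reflexive (sum-series (forests i) _ m))
           (trans (sum-cong (forests i) (λ ts → trans (S.*-congˡ {treeWeight ts} (SCut.cutSum-0 ts) m) (S.zeroʳ (treeWeight ts) m)))
             (sum-zero (forests i)))) ⟩
    SS.sum (forests k) (λ ts → summand ts 0) m
      ≡⟨ sum-series (forests k) _ m ⟩
    sum (forests k) (λ ts → (treeWeight ts ⊗ SCut.cutSum ts (λ ks → const (bNode ks))) m)
      ≈⟨ sum-cong (forests k) (λ ts → trans (S.*-congˡ {treeWeight ts} (constant ts) m)
           (trans (S.*-comm (treeWeight ts) (const (cutSum ts bNode)) m) (const-⊗ _ (treeWeight ts) m))) ⟩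
    sum (forests k) (λ us → cutSum us bNode * treeWeight us m)
      ∎
    where
    summand : List Tree → ℕ → PS
    summand ts j = treeWeight ts ⊗ SCut.cutSum ts (λ ks → bSeries ks j)

    constant : ∀ ts → SCut.cutSum ts (λ ks → const (bNode ks)) ≋ const (cutSum ts bNode)
    constant ts zero    = cutSum-series ts _ zero
    constant ts (suc m) = trans (cutSum-series ts _ (suc m)) (cutSum-0 ts)

  -- Substituting g + t h is multiplicative, so it acts vertex by vertex; at a vertex with d
  -- children it turns β^(d)/d! into `binSub d`.
  compose-weight : ∀ ts → compose h (weight ts) PS.≋ composedWeight ts
  compose-treeWeight : ∀ ts → compose h (treeWeight ts) PS.≋
    Substitution.binSub seriesRing h (length ts) (scaledDeriv β) PS.⊗ composedWeight ts

  compose-weight []             = compose-one h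
  compose-weight (node us ∷ ts) = P.trans {compose h (treeWeight us ⊗ weight ts)} (compose-⊗ h (treeWeight us) (weight ts))
    (P.*-cong (compose-treeWeight us) (compose-weight ts))

  compose-treeWeight ts = P.trans {compose h (treeWeight ts)} (compose-⊗ h (scaledDeriv β (length ts)) (weight ts))
    (P.*-cong (compose-scaledDeriv h β (length ts)) (compose-weight ts))

  b-forests : ∀ k m → fCoef β b (suc k) m ≈ sum (forests k) (λ us → bNode us * treeWeight us m)
  b-forests = fSeries-forests (b nothing) (onTrees b) (λ t → b (just t)) (onTrees-shape b b-inv)

  compose-b : ∀ i j m → compose h (fCoef β b (suc i)) j m ≈
              sum (forests i) (λ us → bNode us * compose h (treeWeight us) j m)
  compose-b i j m = begin
    compose h (fCoef β b (suc i)) j m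
      ≈⟨ compose-cong h (λ m → trans (b-forests i m) (reflexive (≡.sym (sum-series (forests i) _ m)))) j m ⟩
    compose h (SS.sum (forests i) (λ us m → bNode us * treeWeight us m)) j m
      ≈⟨ compose-sum h (forests i) _ j m ⟩
    sum (forests i) (λ us → compose h (λ m → bNode us * treeWeight us m) j m)
      ≈⟨ sum-cong (forests i) (λ us → compose-scale h (bNode us) (treeWeight us) j m) ⟩
    sum (forests i) (λ us → bNode us * compose h (treeWeight us) j m)
      ∎

  composed-forests : ∀ k m → composed bSeries (scaledDeriv β) k m ≈ tri k (λ i j → compose h (fCoef β b (suc i)) j m)
  composed-forests k m = begin
    composed bSeries (scaledDeriv β) k m
      ≡⟨ tri-series k (λ i j → SS.sum (forests i) (λ ks → summand ks j)) m ⟩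
    tri k (λ i j → SS.sum (forests i) (λ ks → summand ks j) m)
      ≈⟨ tri-cong k (λ i j → trans (reflexive (sum-series (forests i) _ m)) (sum-cong (forests i) (λ ks → per-forest ks j))) ⟩
    tri k (λ i j → sum (forests i) (λ ks → bNode ks * compose h (treeWeight ks) j m))
      ≈⟨ tri-cong k (λ i j → compose-b i j m) ⟨
    tri k (λ i j → compose h (fCoef β b (suc i)) j m)
      ∎
    where
    bin : List Tree → PS2
    bin ks = Substitution.binSub seriesRing h (length ks) (scaledDeriv β)

    summand : List Tree → PS2
    summand ks = (bSeries ks PS.⊗ bin ks) PS.⊗ composedWeight ks

    per-forest : ∀ ks j → summand ks j m ≈ bNode ks * compose h (treeWeight ks) j m
    per-forest ks j = begin
      summand ks j m
        ≈⟨ P.*-assoc (bSeries ks) (bin ks) (composedWeight ks) j m ⟩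
      (bSeries ks PS.⊗ (bin ks PS.⊗ composedWeight ks)) j m
        ≈⟨ PS.const-⊗ (const (bNode ks)) (bin ks PS.⊗ composedWeight ks) j m ⟩
      (const (bNode ks) ⊗ (bin ks PS.⊗ composedWeight ks) j) m
        ≈⟨ const-⊗ (bNode ks) ((bin ks PS.⊗ composedWeight ks) j) m ⟩
      bNode ks * (bin ks PS.⊗ composedWeight ks) j m
        ≈⟨ *-congˡ (compose-treeWeight ks j m) ⟨
      bNode ks * compose h (treeWeight ks) j m
        ∎

  -- The term b(∅) a(T) of the empty subtree does not keep the root, so it is no pruning of the
  -- children; it is split off and sums to b(∅) h.
  conv-forests : ∀ k m → fSeries β (b nothing) (conv a b) (suc k) m ≈
                 b nothing * h k m + pruned bSeries (scaledDeriv β) k m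
  conv-forests k m = begin
    fSeries β (b nothing) (conv a b) (suc k) m
      ≈⟨ fSeries-forests (b nothing) (conv a b) (convShape a b a-inv b-inv) (conv-shape a b a-inv b-inv) k m ⟩
    sum (forests k) (λ us → (b nothing * a (just (node us)) + cutSum us bNode) * treeWeight us m)
      ≈⟨ sum-cong (forests k) (λ us → trans (distribʳ _ _ _) (+-congʳ (*-assoc _ _ _))) ⟩
    sum (forests k) (λ us → b nothing * (a (just (node us)) * treeWeight us m) + cutSum us bNode * treeWeight us m)
      ≈⟨ sum-+ (forests k) _ _ ⟩
    sum (forests k) (λ us → b nothing * (a (just (node us)) * treeWeight us m))
      + sum (forests k) (λ us → cutSum us bNode * treeWeight us m)
      ≈⟨ +-cong (trans (*-congˡ (h-forests k m)) (*-distribˡ-sum (forests k) _ _)) (pruned-forests k m) ⟨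
    b nothing * h k m + pruned bSeries (scaledDeriv β) k m
      ∎

  composition : a nothing ≈ 1# → ∀ n m →
    fSeries β (b nothing) (conv a b) n m ≈ composeTaylor (fCoef β b) (fCoef β a) n m
  -- The condition a(∅) = 1 makes the t-constant part of f^a equal to g, so that f^a = g + t h.
  composition a∅ n m = trans (expand n) (sym
    (composeTaylor-compose h (fCoef β b) (fCoef β a) (λ m → trans (*-congʳ a∅) (*-identityˡ _)) a-forests n m))
    where
    a-forests : ∀ k → fCoef β a (suc k) ≋ h k
    a-forests k m = trans
      (fSeries-forests (a nothing) (onTrees a) (λ t → a (just t)) (onTrees-shape a a-inv) k m) (sym (h-forests k m))

    expand : ∀ n → fSeries β (b nothing) (conv a b) n m ≈ tri n (λ i j → compose h (fCoef β b i) j m)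
    expand zero    = sym (compose-zero h (fCoef β b 0) m)
    expand (suc k) = begin
      fSeries β (b nothing) (conv a b) (suc k) m
        ≈⟨ conv-forests k m ⟩
      b nothing * h k m + pruned bSeries (scaledDeriv β) k m
        -- The empty-subtree term is the part b(∅) g of f^b with g replaced by f^a; it becomes the
        -- summand i = 0 of the composite.
        ≈⟨ +-cong (*-congˡ (sym (compose-gS-suc h k m))) (pruned-composed bSeries (scaledDeriv β) k m) ⟩
      b nothing * compose h gS (suc k) m + composed bSeries (scaledDeriv β) k m
        ≈⟨ +-cong (sym (compose-scale h (b nothing) gS (suc k) m)) (composed-forests k m) ⟩
      compose h (fCoef β b 0) (suc k) m + tri k (λ i j → compose h (fCoef β b (suc i)) j m)
        ∎

mainTheorem10 : ∀ {c ℓ} (R : CommutativeRing c ℓ) (recip : ℕ → CommutativeRing.Carrier R) →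
    let open CommutativeRing R
        open WithRing R recip
    in (∀ n → natR (suc n) * recip (suc n) ≈ 1#) →
       (β : PS) (a b : Coef) → Invariant a → Invariant b → a nothing ≈ 1# →
       ∀ n m → fSeries β (b nothing) (conv a b) n m ≈ composeTaylor (fCoef β b) (fCoef β a) n m
mainTheorem10 R recip inverse β a b a-inv b-inv = CompositionTheorem.composition R recip inverse β a b a-inv b-inv
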